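{- Let $p$ be a prime, $k\ge1$, $d=p^{k-1}d'$ with an integer $d'\ge2$, and $F\in\mathscr F$. Then $\mathrm{Res}(\mathrm{Lex}^-_{F,d}(k))$ is a $\left[\frac{p^k-1}{p-1}d',\ k,\ p^{k-1}d'\right]$ code over $\mathbb F_p$, which is obtained by repeating the $\left[\frac{p^k-1}{p-1},\ k,\ p^{k-1}\right]$ simplex code $d'$ times.
   Context: $\mathbb N$ is the set of non-negative integers. $\mathbb F_p$ is identified with $\{0,1,\dots,p-1\}$, elements compared as integers. $\mathbb F_p^{\mathbb N}$ is the space of finitely supported sequences $(x_i)_{i\in\mathbb N}$ over $\mathbb F_p$, with standard basis $E=(e_0,e_1,\dots)$. For distinct $\xi,\eta\in\mathbb N$, $F(\xi,\eta)=(f_i)_{i\in\mathbb N}$ is the ordered basis with $f_i=e_i$ for $i\ne\xi$ and $f_\xi=e_\xi+e_\eta$. Let $\mathscr F=\{E\}\cup\{F(\xi,\eta):\xi,\eta\in\mathbb N,\ \xi\neq\eta\}$. For an ordered basis $F=(f_i)$ write $x=\sum_i x_{[i]}f_i$; for $x\neq y$ let $N$ be the largest index with $x_{[N]}\ne y_{[N]}$ and set $x<_F y$ iff $x_{[N]}<y_{[N]}$. The Hamming distance is $d(x,y)=|\{i: x_i\neq y_i\}|$ in standard coordinates. The words $w^-(a)=w^-_{F,d}(a)$ ($a\in\mathbb N$) are defined recursively: if $a$ is a power of $p$ (including $p^0=1$), $w^-(a)$ is the $<_F$-minimum $z\in\mathbb F_p^{\mathbb N}$ with $d(z,w^-(b))\ge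 d$ for all $0\le b<a$; otherwise $w^-(a)=\sum_i a_iw^-(p^i)$ where $a=\sum_i a_ip^i$ is the $p$-ary expansion (so $w^-(0)=0$). Put $\mathrm{Lex}^-_{F,d}(k)=\{w^-(0),\dots,w^-(p^k-1)\}$. For $L\subseteq\mathbb F_p^{\mathbb N}$, $\mathrm{Res}(L)$ is obtained from $L$ by deleting all standard coordinates $i$ at which every element of $L$ is zero. An $[n,k,d]$ code is a linear code of length $n$, dimension $k$ and minimum distance $d$; the simplex code is the code having a generator matrix whose columns are one representative of each one-dimensional subspace of $\mathbb F_p^k$; "repeating $d'$ times" means that each column of the generator matrix is repeated $d'$ times, codes being considered up to permutation of coordinates. -}

module Defs where

open import Level using (0ℓ)
open import Data.Nat.Base using (ℕ; zero; suc; _+_; _*_; _∸_; _^_; _⊔_; _≤_; _<_; z≤n; s≤s; z<s; NonZero; NonTrivial; nonTrivial⇒nonZero; nonTrivial⇒n>1; >-nonZero)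
open import Data.Nat.Properties
open import Data.Nat.DivMod
open import Data.Nat.Primality using (Prime; prime⇒nonTrivial)
open import Data.Fin.Base as Fin using (Fin; toℕ; quotient)
open import Data.Fin.Properties as Fin using (toℕ-fromℕ<; toℕ-injective; toℕ<n)
open import Data.Fin.Permutation using (Permutation′; _⟨$⟩ʳ_)
open import Data.List.Base using ([]; _∷_; length; filter; upTo; allFin)
open import Data.List.Properties using (upTo-∷ʳ; filter-++; length-++; filter-accept; filter-reject)
open import Data.Product.Base using (∃; ∃-syntax; Σ-syntax; _×_; _,_; proj₁; proj₂)
open import Data.Product using (∃!)
open import Data.Sum.Base using (_⊎_; inj₁; inj₂)
open import Data.Vec.Functional using (Vector; foldr)
open import Function.Base using (_∘_)
open import Function.Bundles using (_⇔_)
open import Relation.Nullary using (¬_; Dec; yes; no; contradiction)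
open import Relation.Nullary.Decidable using (¬?)
open import Relation.Unary using (Pred; Decidable)
open import Relation.Binary.Definitions using (tri<; tri≈; tri>)
open import Relation.Binary.PropositionalEquality

module Codes (p : ℕ) (p-prime : Prime p) where

  private instance
    p-nonTrivial : NonTrivial p
    p-nonTrivial = prime⇒nonTrivial p-prime

    p-nonZero : NonZero p
    p-nonZero = nonTrivial⇒nonZero p

    p∸1-nonZero : NonZero (p ∸ 1)
    p∸1-nonZero = pred-nonZero p
      where
      pred-nonZero : ∀ n → .{{NonTrivial n}} → NonZero (n ∸ 1)
      pred-nonZero (suc (suc _)) = _

  𝔽 : Set
  𝔽 = Fin p

  infixl 6 _+ₚ_
  infixl 7 _*ₚ_

  _+ₚ_ _*ₚ_ : 𝔽 → 𝔽 → 𝔽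
  a +ₚ b = (toℕ a + toℕ b) mod p
  a *ₚ b = (toℕ a * toℕ b) mod p

  0# 1# : 𝔽
  0# = 0 mod p
  1# = 1 mod p

  Word : ℕ → Set
  Word n = Vector 𝔽 n

  Code : ℕ → Set₁
  Code n = Pred (Word n) 0ℓ

  Matrix : ℕ → ℕ → Set
  Matrix k n = Fin k → Word n

  ∑ : ∀ {k} → Vector 𝔽 k → 𝔽
  ∑ = foldr _+ₚ_ 0#

  _·_ : ∀ {k n} → Word k → Matrix k n → Word n
  (a · G) j = ∑ (λ i → a i *ₚ G i j)

  RowSpace : ∀ {k n} → Matrix k n → Code n
  RowSpace G c = ∃[ a ] (∀ j → c j ≡ (a · G) j)

  LinearlyIndependent : ∀ {k n} → Matrix k n → Set
  LinearlyIndependent G = ∀ a → (∀ j → (a · G) j ≡ 0#) → ∀ i → a i ≡ 0#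

  IsGeneratorMatrix : ∀ {k n} → Matrix k n → Code n → Set
  IsGeneratorMatrix G C = LinearlyIndependent G × (∀ c → C c ⇔ RowSpace G c)

  record IsLinear {n} (C : Code n) : Set where
    field
      zero-closed : C (λ _ → 0#)
      +-closed    : ∀ x y → C x → C y → C (λ j → x j +ₚ y j)
      *-closed    : ∀ a x → C x → C (λ j → a *ₚ x j)

  HasDimension : ∀ {n} → Code n → ℕ → Set
  HasDimension {n} C k = Σ[ G ∈ Matrix k n ] IsGeneratorMatrix G C

  hamming : ∀ {n} → Word n → Word n → ℕ
  hamming {n} x y = length (filter (λ j → ¬? (x j Fin.≟ y j)) (allFin n))

  HasMinimumDistance : ∀ {n} → Code n → ℕ → Set
  HasMinimumDistance C d =
      (∃[ x ] ∃[ y ] C x × C y × ¬ (x ≗ y) × hamming x y ≡ d)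
    × (∀ x y → C x → C y → ¬ (x ≗ y) → d ≤ hamming x y)

  record Is[_,_,_]Code (n k d : ℕ) (C : Code n) : Set where
    field
      linear          : IsLinear C
      dimension       : HasDimension C k
      minimumDistance : HasMinimumDistance C d

  _≅_ : ∀ {n} → Code n → Code n → Set
  _≅_ {n} C D = Σ[ σ ∈ Permutation′ n ] (∀ c → C c ⇔ D (λ j → c (σ ⟨$⟩ʳ j)))

  repeatColumns : ∀ {k m} r → Matrix k m → Matrix k (m * r)
  repeatColumns {m = m} r G i j = G i (quotient {m} r j)

  IsRepetition : ∀ {m} r → Code m → Code (m * r) → Set
  IsRepetition {m} r C₀ C =
    ∃[ k ] Σ[ G ∈ Matrix k m ] IsGeneratorMatrix G C₀ × (C ≅ RowSpace (repeatColumns r G))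

  NonZeroVector : ∀ {k} → Word k → Set
  NonZeroVector v = ¬ (∀ i → v i ≡ 0#)

  Line : ∀ {k} → Word k → Pred (Word k) 0ℓ
  Line v u = ∃[ a ] (∀ i → u i ≡ a *ₚ v i)

  -- The one-dimensional subspaces are the lines through nonzero vectors;
  -- a nonzero element of such a line represents it.
  ColumnsRepresentLines : ∀ {k n} → Matrix k n → Set
  ColumnsRepresentLines G =
      (∀ j → NonZeroVector (λ i → G i j))
    × (∀ v → NonZeroVector v → ∃! _≡_ (λ j → Line v (λ i → G i j)))

  IsSimplex : ∀ {n} → ℕ → Code n → Set
  IsSimplex {n} k C =
    Σ[ G ∈ Matrix k n ] IsGeneratorMatrix G C × ColumnsRepresentLines G

  -- The division is exact.
  simplexLength : ℕ → ℕ
  simplexLength k = (p ^ k ∸ 1) / (p ∸ 1)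

  -- Finitely supported sequences; the bound need not be sharp, and
  -- sequences are compared by _≈_, which ignores it.
  record FinSeq : Set where
    constructor finSeq
    field
      at       : ℕ → 𝔽
      bound    : ℕ
      vanishes : ∀ i → bound ≤ i → at i ≡ 0#

  open FinSeq public

  infix 4 _≈_

  _≈_ : FinSeq → FinSeq → Set
  x ≈ y = ∀ i → at x i ≡ at y i

  module Arithmetic where
    toℕ-mod : ∀ m → toℕ (m mod p) ≡ m % p
    toℕ-mod m = toℕ-fromℕ< (m%n<n m p)

    mod-cong : ∀ {m n} → m % p ≡ n % p → m mod p ≡ n mod p
    mod-cong {m} {n} e = toℕ-injective (trans (toℕ-mod m) (trans e (sym (toℕ-mod n))))

    mod-toℕ : ∀ (a : 𝔽) → toℕ a mod p ≡ a
    mod-toℕ a = toℕ-injective (trans (toℕ-mod (toℕ a)) (m<n⇒m%n≡m (toℕ<n a)))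

    p>1 : 1 < p
    p>1 = nonTrivial⇒n>1 p

    toℕ-0# : toℕ 0# ≡ 0
    toℕ-0# = trans (toℕ-mod 0) (m<n⇒m%n≡m (<-trans z<s p>1))

    toℕ-1# : toℕ 1# ≡ 1
    toℕ-1# = trans (toℕ-mod 1) (m<n⇒m%n≡m p>1)

    1≢0 : 1# ≢ 0#
    1≢0 e with () ← trans (sym toℕ-1#) (trans (cong toℕ e) toℕ-0#)

    +-idˡ : ∀ a → 0# +ₚ a ≡ a
    +-idˡ a = trans (cong (λ t → (t + toℕ a) mod p) toℕ-0#) (mod-toℕ a)

    +ₚ-comm : ∀ a b → a +ₚ b ≡ b +ₚ a
    +ₚ-comm a b = cong (_mod p) (+-comm (toℕ a) (toℕ b))

    +-idʳ : ∀ a → a +ₚ 0# ≡ a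
    +-idʳ a = trans (+ₚ-comm a 0#) (+-idˡ a)

    *-zeroˡₚ : ∀ a → 0# *ₚ a ≡ 0#
    *-zeroˡₚ a = cong (λ t → (t * toℕ a) mod p) toℕ-0#

    *ₚ-comm : ∀ a b → a *ₚ b ≡ b *ₚ a
    *ₚ-comm a b = cong (_mod p) (*-comm (toℕ a) (toℕ b))

    *-zeroʳₚ : ∀ a → a *ₚ 0# ≡ 0#
    *-zeroʳₚ a = trans (*ₚ-comm a 0#) (*-zeroˡₚ a)

    *-idˡ : ∀ a → 1# *ₚ a ≡ a
    *-idˡ a = trans (cong (λ t → (t * toℕ a) mod p) toℕ-1#)
              (trans (cong (_mod p) (*-identityˡ (toℕ a))) (mod-toℕ a))

    *-idʳ : ∀ a → a *ₚ 1# ≡ a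
    *-idʳ a = trans (*ₚ-comm a 1#) (*-idˡ a)

    difference : ∀ a b → ∃[ c ] c +ₚ b ≡ a
    difference a b = c , eq
      where
      c = (toℕ a + (p ∸ toℕ b)) mod p
      open ≡-Reasoning
      α = toℕ a ; β = toℕ b
      eq : c +ₚ b ≡ a
      eq = toℕ-injective (begin
        toℕ (c +ₚ b)                            ≡⟨ toℕ-mod (toℕ c + β) ⟩
        (toℕ c + β) % p                         ≡⟨ cong (λ t → (t + β) % p) (toℕ-mod (α + (p ∸ β))) ⟩
        ((α + (p ∸ β)) % p + β) % p             ≡⟨ cong (λ t → ((α + (p ∸ β)) % p + t) % p) (sym (m<n⇒m%n≡m (toℕ<n b))) ⟩
        ((α + (p ∸ β)) % p + β % p) % p         ≡⟨ sym (%-distribˡ-+ (α + (p ∸ β)) β p) ⟩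
        (α + (p ∸ β) + β) % p                   ≡⟨ cong (_% p) (+-assoc α (p ∸ β) β) ⟩
        (α + (p ∸ β + β)) % p                   ≡⟨ cong (λ t → (α + t) % p) (m∸n+n≡m (<⇒≤ (toℕ<n b))) ⟩
        (α + p) % p                             ≡⟨ [m+n]%n≡m%n α p ⟩
        α % p                                   ≡⟨ m<n⇒m%n≡m (toℕ<n a) ⟩
        α                                       ∎)

  open Arithmetic

  infixl 6 _⊕_
  infixr 7 _⊙_

  0ₛ : FinSeq
  0ₛ = finSeq (λ _ → 0#) 0 (λ _ _ → refl)

  _⊕_ : FinSeq → FinSeq → FinSeq
  x ⊕ y = finSeq (λ i → at x i +ₚ at y i) (bound x ⊔ bound y) λ i b≤i →
    trans (cong₂ _+ₚ_ (vanishes x i (m⊔n≤o⇒m≤o (bound x) (bound y) b≤i))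
                      (vanishes y i (m⊔n≤o⇒n≤o (bound x) (bound y) b≤i)))
          (+-idˡ 0#)

  _⊙_ : 𝔽 → FinSeq → FinSeq
  a ⊙ x = finSeq (λ i → a *ₚ at x i) (bound x) λ i b≤i →
    trans (cong (a *ₚ_) (vanishes x i b≤i)) (*-zeroʳₚ a)

  ∑< : ℕ → (ℕ → FinSeq) → FinSeq
  ∑< zero    f = 0ₛ
  ∑< (suc n) f = ∑< n f ⊕ f n

  e : ℕ → FinSeq
  e i = finSeq δ (suc i) vanish
    where
    δ : ℕ → 𝔽
    δ j with j ≟ i
    ... | yes _ = 1#
    ... | no  _ = 0#
    vanish : ∀ j → suc i ≤ j → δ j ≡ 0#
    vanish j i<j with j ≟ i
    ... | yes refl = contradiction i<j (n≮n j)
    ... | no  _    = refl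

  combine : (ℕ → FinSeq) → FinSeq → FinSeq
  combine f c = ∑< (bound c) (λ i → at c i ⊙ f i)

  data 𝓕 : Set where
    E : 𝓕
    F : (ξ η : ℕ) → ξ ≢ η → 𝓕

  basis : 𝓕 → ℕ → FinSeq
  basis E i = e i
  basis (F ξ η _) i with i ≟ ξ
  ... | yes _ = e ξ ⊕ e η
  ... | no  _ = e i

  Coordinates : (ℕ → FinSeq) → FinSeq → FinSeq → Set
  Coordinates f x c = x ≈ combine f c

  _<[_]_ : FinSeq → (ℕ → FinSeq) → FinSeq → Set
  x <[ f ] y = ∃[ c ] ∃[ c′ ] Coordinates f x c × Coordinates f y c′ ×
    ∃[ N ] at c N Fin.< at c′ N × (∀ i → N < i → at c i ≡ at c′ i)

  record IsMinimum (f : ℕ → FinSeq) (S : Pred FinSeq 0ℓ) (z : FinSeq) : Set where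
    constructor minimum
    field
      member : S z
      least  : ∀ y → S y → z ≈ y ⊎ z <[ f ] y

  dist : FinSeq → FinSeq → ℕ
  dist x y = length (filter (λ i → ¬? (at x i Fin.≟ at y i)) (upTo (bound x ⊔ bound y)))

  digit : ℕ → ℕ → 𝔽
  digit a i = ((a / p ^ i) {{m^n≢0 p i}}) mod p

  module DigitBounds where
    n<p^n : ∀ n → n < p ^ n
    n<p^n zero    = z<s
    n<p^n (suc n) = ≤-trans (s≤s (n<p^n n)) (≤-trans (≤-reflexive (+-comm 1 (p ^ n)))
      (≤-trans (+-monoʳ-≤ (p ^ n) (≤-trans (m^n>0 p n) (≤-reflexive (sym (+-identityʳ (p ^ n))))))
               (*-monoˡ-≤ (p ^ n) p>1)))

    digit-small : ∀ a i → a < p ^ i → digit a i ≡ 0#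
    digit-small a i a<p^i = cong (_mod p) (m<n⇒m/n≡0 {{m^n≢0 p i}} a<p^i)

  open DigitBounds

  -- a has no nonzero digit at positions i ≥ a because i < p ^ i.
  digits : ℕ → FinSeq
  digits a = finSeq (digit a) a λ i a≤i → digit-small a i (≤-<-trans a≤i (n<p^n i))

  IsPower : ℕ → Set
  IsPower a = ∃[ m ] a ≡ p ^ m

  record IsLexWords (f : ℕ → FinSeq) (d : ℕ) (w : ℕ → FinSeq) : Set where
    field
      power    : ∀ a → IsPower a →
                 IsMinimum f (λ z → ∀ {b} → b < a → d ≤ dist z (w b)) (w a)
      nonpower : ∀ a → ¬ IsPower a → w a ≈ combine (λ i → w (p ^ i)) (digits a)

  -- The recursion for the words has a solution.
  module Existence where
    at-∑<-cong : ∀ n {f g : ℕ → FinSeq} i → (∀ j → j < n → at (f j) i ≡ at (g j) i) →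
                 at (∑< n f) i ≡ at (∑< n g) i
    at-∑<-cong zero    i h = refl
    at-∑<-cong (suc n) i h =
      cong₂ _+ₚ_ (at-∑<-cong n i (λ j j<n → h j (m<n⇒m<1+n j<n))) (h n ≤-refl)

    ∑<-zero : ∀ n {f} i → (∀ j → j < n → at (f j) i ≡ 0#) → at (∑< n f) i ≡ 0#
    ∑<-zero zero    i h = refl
    ∑<-zero (suc n) i h =
      trans (cong₂ _+ₚ_ (∑<-zero n i (λ j j<n → h j (m<n⇒m<1+n j<n))) (h n ≤-refl)) (+-idˡ 0#)

    ∑<-spike : ∀ n {f} i s → s < n → (∀ j → j ≢ s → at (f j) i ≡ 0#) →
               at (∑< n f) i ≡ at (f s) i
    ∑<-spike (suc n) {f} i s s<1+n h with m<1+n⇒m<n∨m≡n s<1+n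
    ... | inj₁ s<n  = trans (cong₂ _+ₚ_ (∑<-spike n i s s<n h) (h n (λ n≡s → <⇒≢ s<n (sym n≡s))))
                            (+-idʳ _)
    ... | inj₂ refl = trans (cong (_+ₚ at (f n) i) (∑<-zero n i (λ j j<n → h j (<⇒≢ j<n)))) (+-idˡ _)

    ∑<-spikes : ∀ n {f} i s t → s < t → t < n → (∀ j → j ≢ s → j ≢ t → at (f j) i ≡ 0#) →
                at (∑< n f) i ≡ at (f s) i +ₚ at (f t) i
    ∑<-spikes (suc n) {f} i s t s<t t<1+n h with m<1+n⇒m<n∨m≡n t<1+n
    ... | inj₁ t<n  =
      trans (cong₂ _+ₚ_ (∑<-spikes n i s t s<t t<n h)
                        (h n (λ n≡s → <⇒≢ (<-trans s<t t<n) (sym n≡s)) (λ n≡t → <⇒≢ t<n (sym n≡t))))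
            (+-idʳ _)
    ... | inj₂ refl = cong (_+ₚ at (f n) i) (trans
      (at-∑<-cong n {g = λ j → g j (j ≟ n)} i cg)
      (trans (∑<-spike n i s s<t hg) (gs (s ≟ n))))
      where
      g : ∀ j → Dec (j ≡ n) → FinSeq
      g j (yes _) = 0ₛ
      g j (no  _) = f j
      cg : ∀ j → j < n → at (f j) i ≡ at (g j (j ≟ n)) i
      cg j j<n with j ≟ n
      ... | yes j≡n = contradiction j≡n (<⇒≢ j<n)
      ... | no  _   = refl
      hg : ∀ j → j ≢ s → at (g j (j ≟ n)) i ≡ 0#
      hg j j≢s with j ≟ n
      ... | yes _   = refl
      ... | no  j≢n = h j j≢s j≢n
      gs : ∀ (q : Dec (s ≡ n)) → at (g s q) i ≡ at (f s) i
      gs (yes s≡n) = contradiction s≡n (<⇒≢ s<t)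
      gs (no  _)   = refl

    ∑<-extend : ∀ {m n} {f} i → m ≤ n → (∀ j → m ≤ j → at (f j) i ≡ 0#) →
                at (∑< n f) i ≡ at (∑< m f) i
    ∑<-extend {m} {zero}  i z≤n h = refl
    ∑<-extend {m} {suc n} i m≤1+n h with m≤n⇒m<n∨m≡n m≤1+n
    ... | inj₁ (s≤s m≤n) = trans (cong₂ _+ₚ_ (∑<-extend i m≤n h) (h n m≤n)) (+-idʳ _)
    ... | inj₂ refl      = refl

    combine-bound : ∀ f c n → bound c ≤ n → ∀ i →
                    at (combine f c) i ≡ at (∑< n (λ j → at c j ⊙ f j)) i
    combine-bound f c n b≤n i = sym (∑<-extend i b≤n λ j b≤j →
      trans (cong (_*ₚ at (f j) i) (vanishes c j b≤j)) (*-zeroˡₚ _))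

    combine-cong : ∀ f {c c′} → c ≈ c′ → combine f c ≈ combine f c′
    combine-cong f {c} {c′} c≈c′ i =
      trans (combine-bound f c n (m≤m⊔n _ _) i)
      (trans (at-∑<-cong n i (λ j _ → cong (_*ₚ at (f j) i) (c≈c′ j)))
             (sym (combine-bound f c′ n (m≤n⊔m _ _) i)))
      where n = bound c ⊔ bound c′

    count : ∀ (x y : FinSeq) → ℕ → ℕ
    count x y n = length (filter (λ i → ¬? (at x i Fin.≟ at y i)) (upTo n))

    count-suc : ∀ x y n → count x y (suc n) ≡
                count x y n + length (filter (λ i → ¬? (at x i Fin.≟ at y i)) (n ∷ []))
    count-suc x y n =
      trans (cong (length ∘ filter _) (sym (upTo-∷ʳ n)))
      (trans (cong length (filter-++ _ (upTo n) (n ∷ []))) (length-++ (filter _ (upTo n))))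

    count-≡ : ∀ x y n → at x n ≡ at y n → count x y (suc n) ≡ count x y n
    count-≡ x y n eq = trans (count-suc x y n)
      (trans (cong (λ l → count x y n + length l)
               (filter-reject (λ i → ¬? (at x i Fin.≟ at y i)) (λ ne → ne eq)))
             (+-identityʳ _))

    count-≢ : ∀ x y n → at x n ≢ at y n → count x y (suc n) ≡ suc (count x y n)
    count-≢ x y n ne = trans (count-suc x y n)
      (trans (cong (λ l → count x y n + length l)
               (filter-accept (λ i → ¬? (at x i Fin.≟ at y i)) ne))
             (+-comm _ 1))

    count-extend : ∀ x y {m n} → m ≤ n → (∀ i → m ≤ i → at x i ≡ at y i) →
                   count x y n ≡ count x y m
    count-extend x y {m} {zero}  z≤n h = refl
    count-extend x y {m} {suc n} m≤1+n h with m≤n⇒m<n∨m≡n m≤1+n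
    ... | inj₁ (s≤s m≤n) = trans (count-≡ x y n (h n m≤n)) (count-extend x y m≤n h)
    ... | inj₂ refl      = refl

    count-cong : ∀ x x′ y y′ → x ≈ x′ → y ≈ y′ → ∀ n → count x y n ≡ count x′ y′ n
    count-cong x x′ y y′ x≈ y≈ zero = refl
    count-cong x x′ y y′ x≈ y≈ (suc n) with at x n Fin.≟ at y n
    ... | yes eq = trans (count-≡ x y n eq) (trans (count-cong x x′ y y′ x≈ y≈ n)
                     (sym (count-≡ x′ y′ n (trans (sym (x≈ n)) (trans eq (y≈ n))))))
    ... | no  ne = trans (count-≢ x y n ne) (trans (cong suc (count-cong x x′ y y′ x≈ y≈ n))
                     (sym (count-≢ x′ y′ n (λ eq → ne (trans (x≈ n) (trans eq (sym (y≈ n))))))))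

    dist-count : ∀ x y n → bound x ⊔ bound y ≤ n → dist x y ≡ count x y n
    dist-count x y n b≤n = sym (count-extend x y b≤n λ i b≤i →
      trans (vanishes x i (m⊔n≤o⇒m≤o (bound x) (bound y) b≤i))
            (sym (vanishes y i (m⊔n≤o⇒n≤o (bound x) (bound y) b≤i))))

    dist-cong : ∀ x x′ y y′ → x ≈ x′ → y ≈ y′ → dist x y ≡ dist x′ y′
    dist-cong x x′ y y′ x≈ y≈ =
      trans (dist-count x y n (m≤m⊔n (bound x ⊔ bound y) (bound x′ ⊔ bound y′)))
      (trans (count-cong x x′ y y′ x≈ y≈ n) (sym (dist-count x′ y′ n (m≤n⊔m (bound x ⊔ bound y) (bound x′ ⊔ bound y′)))))
      where n = (bound x ⊔ bound y) ⊔ (bound x′ ⊔ bound y′)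

    -- Base-p digits enumerate the coordinate sequences in increasing order.

    digit-zero : ∀ a → digit a 0 ≡ a mod p
    digit-zero a = cong (_mod p) (n/1≡n a)

    digit-suc : ∀ a i → digit a (suc i) ≡ digit (a / p) i
    digit-suc a i = cong (_mod p) (sym (m/n/o≡m/[n*o] a p (p ^ i) {{p-nonZero}} {{m^n≢0 p i}} {{m^n≢0 p (suc i)}}))

    digits-surjective : ∀ B c → (∀ i → B ≤ i → at c i ≡ 0#) → ∃[ n ] c ≈ digits n
    digits-surjective zero c h = 0 , λ i → trans (h i z≤n) (sym (digit-small 0 i (m^n>0 p i)))
    digits-surjective (suc B) c h = m , agree
      where
      tail : ∃[ n ] (∀ i → at c (suc i) ≡ digit n i)
      tail = digits-surjective B
        (finSeq (at c ∘ suc) (bound c) (λ i b≤i → vanishes c (suc i) (m≤n⇒m≤1+n b≤i)))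
        (λ i B≤i → h (suc i) (s≤s B≤i))
      n  = proj₁ tail
      c₀ = toℕ (at c 0)
      m = c₀ + n * p
      m%p : m % p ≡ c₀ % p
      m%p = [m+kn]%n≡m%n c₀ n p
      m/p : m / p ≡ n
      m/p = trans (+-distrib-/-∣ʳ c₀ (divides-refl n))
                  (cong₂ _+_ (m<n⇒m/n≡0 (toℕ<n (at c 0))) (m*n/n≡m n p))
        where open import Data.Nat.Divisibility using (divides-refl)
      agree : c ≈ digits m
      agree zero    = sym (trans (digit-zero m) (trans (mod-cong m%p) (mod-toℕ (at c 0))))
      agree (suc i) = trans (proj₂ tail i) (sym (trans (digit-suc m i) (cong (λ t → digit t i) m/p)))

    DigitsBelow : ℕ → ℕ → Set
    DigitsBelow m n = ∃[ N ] digit m N Fin.< digit n N × (∀ i → N < i → digit m i ≡ digit n i)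

    digits-mono : ∀ fuel m n → n ≤ fuel → m < n → DigitsBelow m n
    digits-mono zero       m n n≤0 m<n with () ← ≤-trans m<n n≤0
    digits-mono (suc fuel) m n n≤f m<n with m≤n⇒m<n∨m≡n (/-monoˡ-≤ p (<⇒≤ m<n))
    ... | inj₁ lt
      with N , N< , above ← digits-mono fuel (m / p) (n / p)
             (≤-pred (≤-trans (m/n<m n p {{>-nonZero (≤-<-trans z≤n m<n)}} p>1) n≤f)) lt
      = suc N
      , subst₂ Fin._<_ (sym (digit-suc m N)) (sym (digit-suc n N)) N<
      , λ { (suc i) (s≤s N<i) → trans (digit-suc m i) (trans (above i N<i) (sym (digit-suc n i))) }
    ... | inj₂ eq
      = 0
      , subst₂ _<_ (sym (trans (cong toℕ (digit-zero m)) (toℕ-mod m)))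
                   (sym (trans (cong toℕ (digit-zero n)) (toℕ-mod n))) %<
      , λ { (suc i) _ → trans (digit-suc m i) (trans (cong (λ t → digit t i) eq) (sym (digit-suc n i))) }
      where
      %< : m % p < n % p
      %< = +-cancelʳ-< (m / p * p) (m % p) (n % p)
             (subst₂ _<_ (m≡m%n+[m/n]*n m p)
                (trans (m≡m%n+[m/n]*n n p) (cong (λ t → n % p + t * p) (sym eq))) m<n)

    Spans : (ℕ → FinSeq) → Set
    Spans f = ∀ x → ∃[ c ] Coordinates f x c

    leastℕ : ∀ {Q : Pred ℕ 0ℓ} → Decidable Q → ∀ fuel n → n < fuel → Q n →
             ∃[ m ] Q m × (∀ j → Q j → m ≤ j)
    leastℕ Q? (suc fuel) n n<f Qn with anyUpTo? Q? n
    ... | yes (j , j<n , Qj) = leastℕ Q? fuel j (<-≤-trans j<n (≤-pred n<f)) Qj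
    ... | no  none           = n , Qn , λ j Qj → ≮⇒≥ (λ j<n → none (j , j<n , Qj))

    exists-minimum : ∀ f → Spans f → (S : Pred FinSeq 0ℓ) → Decidable S →
                     (∀ x y → x ≈ y → S x → S y) → ∃ S → ∃ (IsMinimum f S)
    exists-minimum f spans S S? resp (x , Sx) = combine f (digits m) , minimum Sm least
      where
      index : ∀ y → ∃[ n ] y ≈ combine f (digits n)
      index y with c , eq ← spans y with n , eq′ ← digits-surjective (bound c) c (vanishes c)
        = n , λ i → trans (eq i) (combine-cong f {c} {digits n} eq′ i)
      n₀ = proj₁ (index x)
      found = leastℕ (λ n → S? (combine f (digits n))) (suc n₀) n₀ ≤-refl
                     (resp x (combine f (digits n₀)) (proj₂ (index x)) Sx)
      m  = proj₁ found
      Sm = proj₁ (proj₂ found)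
      compare : ∀ y n → y ≈ combine f (digits n) → m < n ⊎ m ≡ n →
                combine f (digits m) ≈ y ⊎ combine f (digits m) <[ f ] y
      compare y n eq (inj₁ m<n)  =
        inj₂ (digits m , digits n , (λ _ → refl) , eq , digits-mono n m n ≤-refl m<n)
      compare y n eq (inj₂ m≡n) =
        inj₁ (λ i → trans (cong (λ t → at (combine f (digits t)) i) m≡n) (sym (eq i)))
      least : ∀ y → S y → combine f (digits m) ≈ y ⊎ combine f (digits m) <[ f ] y
      least y Sy = compare y n (proj₂ (index y))
        (m≤n⇒m<n∨m≡n (proj₂ (proj₂ found) n (resp y (combine f (digits n)) (proj₂ (index y)) Sy)))
        where n = proj₁ (index y)

    e-diag : ∀ i → at (e i) i ≡ 1#
    e-diag i with i ≟ i
    ... | yes _   = refl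
    ... | no  i≢i = contradiction refl i≢i

    e-off : ∀ i j → j ≢ i → at (e i) j ≡ 0#
    e-off i j j≢i with j ≟ i
    ... | yes j≡i = contradiction j≡i j≢i
    ... | no  _   = refl

    basis-spans : ∀ B → Spans (basis B)
    basis-spans E x = x , agree
      where
      term : ∀ i j → j ≢ i → at (at x j ⊙ e j) i ≡ 0#
      term i j j≢i = trans (cong (at x j *ₚ_) (e-off j i (j≢i ∘ sym))) (*-zeroʳₚ (at x j))
      agree : x ≈ combine e x
      agree i with i <? bound x
      ... | yes i<b = sym (trans (∑<-spike _ i i i<b (term i))
                                 (trans (cong (at x i *ₚ_) (e-diag i)) (*-idʳ _)))
      ... | no  i≮b = trans (vanishes x i (≮⇒≥ i≮b))
                            (sym (∑<-zero _ i (λ j j<b → term i j (λ { refl → i≮b j<b }))))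
    basis-spans B@(F ξ η ξ≢η) x = c , agree
      where
      δ = difference (at x η) (at x ξ)
      N = bound x + suc (ξ + η)
      ξ<N : ξ < N
      ξ<N = ≤-trans (s≤s (m≤m+n ξ η)) (m≤n+m _ (bound x))
      η<N : η < N
      η<N = ≤-trans (s≤s (m≤n+m η ξ)) (m≤n+m _ (bound x))
      coord : ℕ → 𝔽
      coord i with i ≟ η
      ... | yes _ = proj₁ δ
      ... | no  _ = at x i
      coord-η : coord η ≡ proj₁ δ
      coord-η with η ≟ η
      ... | yes _ = refl
      ... | no ne = contradiction refl ne
      coord-off : ∀ i → i ≢ η → coord i ≡ at x i
      coord-off i i≢η with i ≟ η
      ... | yes i≡η = contradiction i≡η i≢η
      ... | no  _   = refl
      c : FinSeq
      c = finSeq coord N λ i N≤i →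
        trans (coord-off i (λ { refl → <⇒≱ η<N N≤i })) (vanishes x i (≤-trans (m≤m+n _ _) N≤i))
      f = basis B
      f-ξ : ∀ i → at (f ξ) i ≡ at (e ξ) i +ₚ at (e η) i
      f-ξ i with ξ ≟ ξ
      ... | yes _ = refl
      ... | no ne = contradiction refl ne
      f-off : ∀ j → j ≢ ξ → f j ≡ e j
      f-off j j≢ξ with j ≟ ξ
      ... | yes j≡ξ = contradiction j≡ξ j≢ξ
      ... | no  _   = refl
      f-zero : ∀ i j → j ≢ i → (j ≡ ξ → i ≢ η) → at (f j) i ≡ 0#
      f-zero i j j≢i h = by (j ≟ ξ)
        where
        by : Dec (j ≡ ξ) → at (f j) i ≡ 0#
        by (yes refl) = trans (f-ξ i)
          (trans (cong₂ _+ₚ_ (e-off ξ i (j≢i ∘ sym)) (e-off η i (h refl))) (+-idˡ 0#))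
        by (no j≢ξ)   = trans (cong (λ t → at t i) (f-off j j≢ξ)) (e-off j i (j≢i ∘ sym))
      f-diag : ∀ i → i ≢ η → at (f i) i ≡ 1#
      f-diag i i≢η = by (i ≟ ξ)
        where
        by : Dec (i ≡ ξ) → at (f i) i ≡ 1#
        by (yes refl) = trans (f-ξ i) (trans (cong₂ _+ₚ_ (e-diag ξ) (e-off η i i≢η)) (+-idʳ 1#))
        by (no i≢ξ)   = trans (cong (λ t → at t i) (f-off i i≢ξ)) (e-diag i)
      scale0 : ∀ a {t} → t ≡ 0# → a *ₚ t ≡ 0#
      scale0 a eq = trans (cong (a *ₚ_) eq) (*-zeroʳₚ a)
      at-ξ : coord ξ *ₚ at (f ξ) η ≡ at x ξ
      at-ξ = trans (cong₂ _*ₚ_ (coord-off ξ ξ≢η)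
               (trans (f-ξ η) (trans (cong₂ _+ₚ_ (e-off ξ η (ξ≢η ∘ sym)) (e-diag η)) (+-idˡ 1#))))
               (*-idʳ _)
      at-η : coord η *ₚ at (f η) η ≡ proj₁ δ
      at-η = trans (cong₂ _*ₚ_ coord-η
               (trans (cong (λ t → at t η) (f-off η (ξ≢η ∘ sym))) (e-diag η))) (*-idʳ _)
      others : ∀ j → j ≢ ξ → j ≢ η → at (coord j ⊙ f j) η ≡ 0#
      others j j≢ξ j≢η = scale0 (coord j) (f-zero η j j≢η (λ j≡ξ → contradiction j≡ξ j≢ξ))
      agree-η : at (combine f c) η ≡ at x η
      agree-η with <-cmp ξ η
      ... | tri< ξ<η _ _ = trans (∑<-spikes N η ξ η ξ<η η<N others)
              (trans (cong₂ _+ₚ_ at-ξ at-η) (trans (+ₚ-comm (at x ξ) (proj₁ δ)) (proj₂ δ)))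
      ... | tri≈ _ ξ≡η _ = contradiction ξ≡η ξ≢η
      ... | tri> _ _ η<ξ = trans (∑<-spikes N η η ξ η<ξ ξ<N (λ j j≢η j≢ξ → others j j≢ξ j≢η))
              (trans (cong₂ _+ₚ_ at-η at-ξ) (proj₂ δ))
      agree : x ≈ combine f c
      agree i with i ≟ η
      ... | yes refl = sym agree-η
      ... | no  i≢η with i <? N
      ...   | yes i<N = sym (trans
                (∑<-spike N i i i<N (λ j j≢i → scale0 (coord j) (f-zero i j j≢i (λ _ → i≢η))))
                (trans (cong₂ _*ₚ_ (coord-off i i≢η) (f-diag i i≢η)) (*-idʳ _)))
      ...   | no  i≮N = trans (vanishes x i (≤-trans (m≤m+n _ _) (≮⇒≥ i≮N)))
                (sym (∑<-zero N i (λ j j<N →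
                  scale0 (coord j) (f-zero i j (λ { refl → i≮N j<N }) (λ _ → i≢η)))))

    Far : ℕ → (ℕ → FinSeq) → ℕ → Pred FinSeq 0ℓ
    Far d w a z = ∀ {b} → b < a → d ≤ dist z (w b)

    maxBound : (ℕ → FinSeq) → ℕ → ℕ
    maxBound w zero    = 0
    maxBound w (suc a) = maxBound w a ⊔ bound (w a)

    bound≤maxBound : ∀ w {a b} → b < a → bound (w b) ≤ maxBound w a
    bound≤maxBound w {suc a} b<1+a with m<1+n⇒m<n∨m≡n b<1+a
    ... | inj₁ b<a  = ≤-trans (bound≤maxBound w b<a) (m≤m⊔n _ _)
    ... | inj₂ refl = m≤n⊔m (maxBound w a) _

    far-exists : ∀ d w a → ∃ (Far d w a)
    far-exists d w a = z , far
      where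
      B = maxBound w a
      entry : ℕ → 𝔽
      entry i with i <? d + B
      ... | yes _ = 1#
      ... | no  _ = 0#
      entry-in : ∀ i → i < d + B → entry i ≡ 1#
      entry-in i i< with i <? d + B
      ... | yes _  = refl
      ... | no  i≮ = contradiction i< i≮
      z : FinSeq
      z = finSeq entry (d + B) out
        where
        out : ∀ i → d + B ≤ i → entry i ≡ 0#
        out i ≤i with i <? d + B
        ... | yes i< = contradiction ≤i (<⇒≱ i<)
        ... | no  _  = refl
      many : ∀ v → bound v ≤ B → ∀ t → t ≤ d → t ≤ count z v (t + B)
      many v b≤B zero    _   = z≤n
      many v b≤B (suc t) t<d = ≤-trans (s≤s (many v b≤B t (<⇒≤ t<d)))
        (≤-reflexive (sym (count-≢ z v (t + B) λ eq → 1≢0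
          (trans (sym (entry-in (t + B) (+-monoˡ-< B t<d)))
                 (trans eq (vanishes v (t + B) (≤-trans b≤B (m≤n+m B t))))))))
      far : Far d w a z
      far {b} b<a = ≤-trans (many (w b) b≤B d ≤-refl)
        (≤-reflexive (sym (dist-count z (w b) (d + B) (⊔-lub ≤-refl (≤-trans b≤B (m≤n+m B d))))))
        where b≤B = bound≤maxBound w b<a

    far? : ∀ d w a → Decidable (Far d w a)
    far? d w a z = allUpTo? (λ b → d ≤? dist z (w b)) a

    far-resp : ∀ d w a x y → x ≈ y → Far d w a x → Far d w a y
    far-resp d w a x y x≈y far {b} b<a =
      ≤-trans (far b<a) (≤-reflexive (dist-cong x y (w b) (w b) x≈y (λ _ → refl)))

    -- gen m is w(pᵐ); approx m is its approximation, correct below m.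
    module Construction (f : ℕ → FinSeq) (spans : Spans f) (d : ℕ) where

      abstract
        next : ∀ h m → ∃ (IsMinimum f (Far d (combine h ∘ digits) (p ^ m)))
        next h m = let w = combine h ∘ digits in
          exists-minimum f spans (Far d w (p ^ m))
                     (far? d w (p ^ m)) (far-resp d w (p ^ m)) (far-exists d w (p ^ m))

      approx : ℕ → ℕ → FinSeq
      approx zero    i = 0ₛ
      approx (suc m) i with i <? m
      ... | yes _ = approx m i
      ... | no  _ = proj₁ (next (approx m) m)

      gen : ℕ → FinSeq
      gen m = proj₁ (next (approx m) m)

      word : ℕ → FinSeq
      word a = combine gen (digits a)

      approx≡gen : ∀ m i → i < m → approx m i ≡ gen i
      approx≡gen (suc m) i i<1+m with i <? m
      ... | yes i<m = approx≡gen m i i<m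
      ... | no  i≮m = cong gen (≤-antisym (≮⇒≥ i≮m) (≤-pred i<1+m))

      approx-word : ∀ m b → b < p ^ m → combine (approx m) (digits b) ≈ word b
      approx-word m b b<p^m i = at-∑<-cong b i λ j _ → agree j
        where
        agree : ∀ j → digit b j *ₚ at (approx m j) i ≡ digit b j *ₚ at (gen j) i
        agree j with j <? m
        ... | yes j<m = cong (λ t → digit b j *ₚ at t i) (approx≡gen m j j<m)
        ... | no  j≮m = trans (zero* (at (approx m j) i)) (sym (zero* (at (gen j) i)))
          where
          zero* : ∀ t → digit b j *ₚ t ≡ 0#
          zero* t = trans (cong (_*ₚ t) (digit-small b j (<-≤-trans b<p^m (^-monoʳ-≤ p (≮⇒≥ j≮m)))))
                          (*-zeroˡₚ t)

      digit-power : ∀ m → digit (p ^ m) m ≡ 1#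
      digit-power m = cong (_mod p) (n/n≡1 (p ^ m) {{m^n≢0 p m}})

      digit-power-off : ∀ m i → i ≢ m → digit (p ^ m) i ≡ 0#
      digit-power-off zero    zero    ne = contradiction refl ne
      digit-power-off zero    (suc i) ne =
        digit-small 1 (suc i) (<-≤-trans p>1 (≤-trans (≤-reflexive (sym (*-identityʳ p))) (*-monoʳ-≤ p (m^n>0 p i))))
      digit-power-off (suc m) zero    ne =
        trans (digit-zero (p ^ suc m)) (mod-cong (trans (trans (cong (_% p) (*-comm p (p ^ m))) (m*n%n≡0 (p ^ m) p))
          (sym (m<n⇒m%n≡m (<-trans z<s p>1)))))
      digit-power-off (suc m) (suc i) ne =
        trans (digit-suc (p ^ suc m) i)
        (trans (cong (λ t → digit t i) (trans (/-congˡ (*-comm p (p ^ m))) (m*n/n≡m (p ^ m) p)))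
               (digit-power-off m i (ne ∘ cong suc)))

      word-power : ∀ m → word (p ^ m) ≈ gen m
      word-power m i =
        trans (∑<-spike (p ^ m) i m (n<p^n m) λ j j≢m →
                 trans (cong (_*ₚ at (gen j) i) (digit-power-off m j j≢m)) (*-zeroˡₚ _))
              (trans (cong (_*ₚ at (gen m) i) (digit-power m)) (*-idˡ _))

      isLexWords : IsLexWords f d word
      isLexWords = record { power = power ; nonpower = nonpower }
        where
        power : ∀ a → IsPower a → IsMinimum f (Far d word a) (word a)
        power _ (m , refl) = minimum mem lst
          where
          min = proj₂ (next (approx m) m)
          mem : Far d word (p ^ m) (word (p ^ m))
          mem {b} b< = ≤-trans (IsMinimum.member min b<)
            (≤-reflexive (dist-cong (gen m) (word (p ^ m)) (combine (approx m) (digits b)) (word b)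
              (λ i → sym (word-power m i)) (approx-word m b b<)))
          lst : ∀ y → Far d word (p ^ m) y → word (p ^ m) ≈ y ⊎ word (p ^ m) <[ f ] y
          lst y far with IsMinimum.least min y (λ {b} b< → ≤-trans (far b<)
                (≤-reflexive (dist-cong y y (word b) (combine (approx m) (digits b))
                  (λ _ → refl) (λ i → sym (approx-word m b b< i)))))
          ... | inj₁ eq = inj₁ (λ i → trans (word-power m i) (eq i))
          ... | inj₂ (c , c′ , eq , rest) = inj₂ (c , c′ , (λ i → trans (word-power m i) (eq i)) , rest)
        nonpower : ∀ a → ¬ IsPower a → word a ≈ combine (λ i → word (p ^ i)) (digits a)
        nonpower a _ i = at-∑<-cong a i λ j _ → cong (digit a j *ₚ_) (sym (word-power j i))

  abstract
    lexWords : ∀ B d → ∃ (IsLexWords (basis B) d)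
    lexWords B d = word , isLexWords
      where
      open Existence
      open Construction (basis B) (basis-spans B) d

  -- Only the recursion characterises w⁻; it determines each word up to _≈_.
  w⁻ : 𝓕 → ℕ → ℕ → FinSeq
  w⁻ B d = proj₁ (lexWords B d)

  w⁻-isLexWords : ∀ B d → IsLexWords (basis B) d (w⁻ B d)
  w⁻-isLexWords B d = proj₂ (lexWords B d)

  Lex⁻ : 𝓕 → ℕ → ℕ → Pred FinSeq 0ℓ
  Lex⁻ B d k x = ∃[ a ] a < p ^ k × x ≈ w⁻ B d a

  -- The coordinates surviving in Res L, listed in increasing order; n is
  -- the length of Res L.
  record Survivors (L : Pred FinSeq 0ℓ) (n : ℕ) : Set where
    field
      position   : Fin n → ℕ
      increasing : ∀ {i j} → i Fin.< j → position i < position j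
      survives   : ∀ i → (∃[ j ] position j ≡ i) ⇔ (¬ (∀ x → L x → at x i ≡ 0#))

  Res : ∀ L {n} → Survivors L n → Code n
  Res L s c = ∃[ x ] L x × (∀ j → c j ≡ at x (Survivors.position s j))

-- Record the generators w⁻(1), w⁻(p), … found so far as columns, one for each position. If all
-- nonzero words have weight d and the columns are normalised, averaging the weight over the words
-- orthogonal to a point v shows that each point of the projective space occurs equally often as a
-- column (Bonisoli). Averaging the distance from z to all words shows that an admissible z has at
-- least d₁ = d / pʲ nonzero entries outside the support, and that with exactly d₁ of them z is at
-- distance d from every word, so the next code has constant weight d again. A word with exactly d₁
-- outer entries is admissible as soon as, on each class of equal columns, it takes every value
-- equally often; since d₁ ≥ 2, such a word can be prescribed at both ξ and η. Hence the minimal z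
-- has no superfluous outer entry, its support is, apart from ξ and η, an initial segment, and its
-- outer entries are 1, so that the columns stay normalised and columns on one line are equal.

module Submission where

open import Defs
open import Algebra.Bundles using (CommutativeRing)
open import Data.Bool.Base using (if_then_else_)
open import Data.Empty using (⊥)
open import Data.Fin.Base as Fin using (Fin; zero; suc; toℕ; _↑ˡ_; _↑ʳ_; punchIn; quotient)
import Data.Fin.Properties as Fin
open import Data.Fin.Permutation as Perm using (Permutation′; _⟨$⟩ʳ_; _⟨$⟩ˡ_)
open import Data.List.Base using (List; []; _∷_; _++_; map; length; filter; lookup; upTo; allFin; cartesianProductWith)
open import Data.List.Membership.Propositional using (_∈_)
open import Data.List.Membership.Propositional.Properties using (∈-filter⁺; ∈-filter⁻; ∈-upTo⁺; ∈-upTo⁻; ∈-allFin; ∈-lookup; ∈-cartesianProductWith⁺; ∈-cartesianProductWith⁻)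
open import Data.List.Properties using (upTo-∷ʳ; map-++; map-∘; map-tabulate; length-tabulate)
open import Data.List.Relation.Unary.All as All using ([]; _∷_)
open import Data.List.Relation.Unary.AllPairs using (AllPairs; []; _∷_)
import Data.List.Relation.Unary.AllPairs.Properties as AllPairs
open import Data.List.Relation.Unary.Any as Any using (here; there)
open import Data.List.Relation.Unary.Any.Properties using (lookup-index)
open import Data.List.Relation.Unary.Unique.Propositional using (Unique)
open import Data.List.Relation.Unary.Unique.Propositional.Properties using (allFin⁺; upTo⁺; cartesianProductWith⁺)
open import Data.Nat.Base using (ℕ; zero; suc; _+_; _*_; _∸_; _^_; _⊔_; _≤_; _<_; z≤n; s≤s; z<s; NonZero; ≢-nonZero; >-nonZero)
open import Data.Nat.Coprimality using (prime⇒coprime; coprime-Bézout)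
open import Data.Nat.Divisibility using (divides-refl)
open import Data.Nat.DivMod
import Data.Nat.GCD as GCD
open import Data.Nat.ListAction using (sum)
open import Data.Nat.ListAction.Properties using (sum-++)
open import Data.Nat.Primality using (Prime; prime⇒nonZero)
open import Data.Nat.Properties
open import Data.Nat.Tactic.RingSolver using (solve-∀)
open import Data.Product.Base using (∃-syntax; Σ-syntax; _×_; _,_; proj₁; proj₂)
open import Data.Sum.Base using (_⊎_; inj₁; inj₂)
open import Data.Unit.Base using (⊤; tt)
open import Data.Vec.Base as Vec using (Vec; []; _∷_; insertAt; removeAt)
import Data.Vec.Properties as Vec
open import Function.Base using (_∘_; id)
open import Function.Bundles using (_⇔_; mk⇔; Equivalence)
open import Level using (0ℓ)
open import Relation.Binary.Definitions using (DecidableEquality; tri<; tri≈; tri>)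
open import Relation.Binary.PropositionalEquality
open import Relation.Nullary using (¬_; Dec; yes; no; does; contradiction; ¬?; _×-dec_; _⊎-dec_)
open import Relation.Nullary.Decidable using (decidable-stable)
import Algebra.Properties.CommutativeSemigroup +-commutativeSemigroup as ℕ+
import Algebra.Properties.CommutativeSemigroup *-commutativeSemigroup as ℕ*

-- In the basis `F ξ η` the coordinate of `x` at `η` is `x η - x ξ`; every other coordinate is the
-- entry itself. So the order compares entries from the top down, except that a change at `ξ` is
-- also felt at `η`, possibly far above. This coupling is the obstacle. To refute minimality of a
-- word, an outer entry is cleared and the distances are repaired by rewriting the entries on the
-- support of the earlier generators. The order does not notice this if all rewritten positions lie
-- below the cleared one, which can fail only at `ξ` and `η`; there the old entries are kept. In the
-- worst case both lie in one class of equal columns and carry the same value, using up two of the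
-- `d₁` places of that value. On a class of equal columns every word is constant, so a balanced
-- refill is equally far from all words there and no case distinction over words arises. That outer
-- entries are 1 needs another comparison: replacing outer entries by nonzero ones shortens no
-- distance. At `ξ` and `η` this works only if their membership in the support is suitably linked,
-- which is why the induction carries `Exceptional`.

-- Finite sums

private variable
  A B : Set
  P Q : Set

-- The Iverson bracket. All counting is done by summing brackets over lists, so that counts can be
-- scaled, split and interchanged like other sums.
⟦_⟧ : Dec P → ℕ
⟦ p? ⟧ = if does p? then 1 else 0

⟦⟧-yes : (p? : Dec P) → P → ⟦ p? ⟧ ≡ 1
⟦⟧-yes (yes _) _ = refl
⟦⟧-yes (no ¬p) p = contradiction p ¬p

⟦⟧-no : (p? : Dec P) → ¬ P → ⟦ p? ⟧ ≡ 0
⟦⟧-no (yes p) ¬p = contradiction p ¬p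
⟦⟧-no (no _)  _  = refl

⟦⟧-cong : (p? : Dec P) (q? : Dec Q) → (P → Q) → (Q → P) → ⟦ p? ⟧ ≡ ⟦ q? ⟧
⟦⟧-cong (yes p) q? f g = sym (⟦⟧-yes q? (f p))
⟦⟧-cong (no ¬p) q? f g = sym (⟦⟧-no q? (¬p ∘ g))

⟦⟧-mono : (p? : Dec P) (q? : Dec Q) → (P → Q) → ⟦ p? ⟧ ≤ ⟦ q? ⟧
⟦⟧-mono (yes p) q? f = ≤-reflexive (sym (⟦⟧-yes q? (f p)))
⟦⟧-mono (no _)  q? f = z≤n

⟦⟧≤1 : (p? : Dec P) → ⟦ p? ⟧ ≤ 1
⟦⟧≤1 (yes _) = ≤-refl
⟦⟧≤1 (no _)  = z≤n

⟦⟧-× : (p? : Dec P) (q? : Dec Q) → ⟦ p? ×-dec q? ⟧ ≡ ⟦ p? ⟧ * ⟦ q? ⟧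
⟦⟧-× (yes _) (yes _) = refl
⟦⟧-× (yes _) (no _)  = refl
⟦⟧-× (no _)  _       = refl

⟦⟧-¬ : (p? : Dec P) → ⟦ ¬? p? ⟧ + ⟦ p? ⟧ ≡ 1
⟦⟧-¬ (yes _) = refl
⟦⟧-¬ (no _)  = refl

sumOver : List A → (A → ℕ) → ℕ
sumOver xs f = sum (map f xs)

module _ {A : Set} where

  sum-cong-∈ : ∀ xs {f g : A → ℕ} → (∀ x → x ∈ xs → f x ≡ g x) → sumOver xs f ≡ sumOver xs g
  sum-cong-∈ []       h = refl
  sum-cong-∈ (x ∷ xs) h = cong₂ _+_ (h x (here refl)) (sum-cong-∈ xs (λ y → h y ∘ there))

  sum-cong : ∀ xs {f g : A → ℕ} → (∀ x → f x ≡ g x) → sumOver xs f ≡ sumOver xs g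
  sum-cong xs h = sum-cong-∈ xs (λ x _ → h x)

  sum-mono : ∀ xs {f g : A → ℕ} → (∀ x → f x ≤ g x) → sumOver xs f ≤ sumOver xs g
  sum-mono []       h = z≤n
  sum-mono (x ∷ xs) h = +-mono-≤ (h x) (sum-mono xs h)

  sum-+ : ∀ xs {f g : A → ℕ} → sumOver xs (λ x → f x + g x) ≡ sumOver xs f + sumOver xs g
  sum-+ []               = refl
  sum-+ (x ∷ xs) {f} {g} = trans (cong (f x + g x +_) (sum-+ xs)) (ℕ+.interchange (f x) (g x) _ _)

  sum-*ˡ : ∀ xs c {f : A → ℕ} → sumOver xs (λ x → c * f x) ≡ c * sumOver xs f
  sum-*ˡ []       c     = sym (*-zeroʳ c)
  sum-*ˡ (x ∷ xs) c {f} = trans (cong (c * f x +_) (sum-*ˡ xs c)) (sym (*-distribˡ-+ c (f x) _))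

  sum-const : ∀ (xs : List A) c → sumOver xs (λ _ → c) ≡ length xs * c
  sum-const []       c = refl
  sum-const (x ∷ xs) c = cong (c +_) (sum-const xs c)

  sum-zero : ∀ xs {f : A → ℕ} → (∀ x → x ∈ xs → f x ≡ 0) → sumOver xs f ≡ 0
  sum-zero []       h = refl
  sum-zero (x ∷ xs) h = cong₂ _+_ (h x (here refl)) (sum-zero xs (λ y → h y ∘ there))

  sum-≥ : ∀ xs c {f : A → ℕ} → (∀ x → c ≤ f x) → length xs * c ≤ sumOver xs f
  sum-≥ xs c h = ≤-trans (≤-reflexive (sym (sum-const xs c))) (sum-mono xs h)

  -- A sum that does not exceed its termwise lower bound leaves no slack in any term. This turns a
  -- statement about an average into one about every word.
  sum-squeeze : ∀ xs c {f : A → ℕ} → (∀ x → c ≤ f x) → sumOver xs f ≤ length xs * c →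
                ∀ {x} → x ∈ xs → f x ≡ c
  sum-squeeze (x ∷ xs) c {f} h s≤ (here refl) = ≤-antisym
    (+-cancelʳ-≤ (length xs * c) (f x) c (≤-trans (+-monoʳ-≤ (f x) (sum-≥ xs c h)) s≤)) (h x)
  sum-squeeze (x ∷ xs) c {f} h s≤ (there y∈) = sum-squeeze xs c h
    (+-cancelˡ-≤ c _ _ (≤-trans (+-monoˡ-≤ _ (h x)) s≤)) y∈

  sum-positive : ∀ xs (f : A → ℕ) → 0 < sumOver xs f → ∃[ x ] x ∈ xs × 0 < f x
  sum-positive (x ∷ xs) f 0< with f x in eq
  ... | suc _ = x , here refl , subst (0 <_) (sym eq) z<s
  ... | zero  with y , y∈ , 0<fy ← sum-positive xs f 0< = y , there y∈ , 0<fy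

  sum-list-++ : ∀ xs ys (f : A → ℕ) → sumOver (xs ++ ys) f ≡ sumOver xs f + sumOver ys f
  sum-list-++ xs ys f = trans (cong sum (map-++ f xs ys)) (sum-++ (map f xs) (map f ys))

  length-filter-sum : ∀ {P : A → Set} (P? : ∀ x → Dec (P x)) xs →
                      length (filter P? xs) ≡ sumOver xs (λ x → ⟦ P? x ⟧)
  length-filter-sum P? []       = refl
  length-filter-sum P? (x ∷ xs) with P? x
  ... | yes _ = cong suc (length-filter-sum P? xs)
  ... | no _  = length-filter-sum P? xs

  sum-filter : ∀ {P : A → Set} (P? : ∀ x → Dec (P x)) xs f →
               sumOver (filter P? xs) f ≡ sumOver xs (λ x → ⟦ P? x ⟧ * f x)
  sum-filter P? []       f = refl
  sum-filter P? (x ∷ xs) f with P? x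
  ... | yes _ = cong₂ _+_ (sym (*-identityˡ (f x))) (sum-filter P? xs f)
  ... | no _  = sum-filter P? xs f

  module _ (_≟ᴬ_ : DecidableEquality A) where

    sum-δ : ∀ {xs y} → Unique xs → y ∈ xs → ∀ (f : A → ℕ) → sumOver xs (λ x → ⟦ y ≟ᴬ x ⟧ * f x) ≡ f y
    sum-δ {x ∷ xs} {y} (x∉ ∷ u) (here refl) f =
      trans (cong₂ _+_ (trans (cong (_* f y) (⟦⟧-yes (y ≟ᴬ y) refl)) (*-identityˡ (f y)))
                       (sum-zero xs (λ z z∈ → cong (_* f z)
                         (⟦⟧-no (y ≟ᴬ z) (λ { refl → All.lookup x∉ z∈ refl })))))
            (+-identityʳ (f y))
    sum-δ {x ∷ xs} {y} (x∉ ∷ u) (there y∈) f =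
      cong₂ _+_ (cong (_* f x) (⟦⟧-no (y ≟ᴬ x) (λ { refl → All.lookup x∉ y∈ refl })))
                (sum-δ u y∈ f)

    sum-δ-1 : ∀ {xs y} → Unique xs → y ∈ xs → sumOver xs (λ x → ⟦ y ≟ᴬ x ⟧) ≡ 1
    sum-δ-1 {xs} u y∈ = trans (sum-cong xs (λ x → sym (*-identityʳ _))) (sum-δ u y∈ (λ _ → 1))

sum-map : ∀ (g : A → B) xs (f : B → ℕ) → sumOver (map g xs) f ≡ sumOver xs (f ∘ g)
sum-map g xs f = cong sum (sym (map-∘ xs))

sum-comm : ∀ (xs : List A) (ys : List B) {f : A → B → ℕ} →
           sumOver xs (λ x → sumOver ys (f x)) ≡ sumOver ys (λ y → sumOver xs (λ x → f x y))
sum-comm []       ys     = sym (sum-zero ys (λ _ _ → refl))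
sum-comm (x ∷ xs) ys {f} = trans (cong (sumOver ys (f x) +_) (sum-comm xs ys)) (sym (sum-+ ys))

sum-cartesianProductWith : ∀ {C : Set} (g : A → B → C) xs ys f →
  sumOver (cartesianProductWith g xs ys) f ≡ sumOver xs (λ x → sumOver ys (λ y → f (g x y)))
sum-cartesianProductWith g []       ys f = refl
sum-cartesianProductWith g (x ∷ xs) ys f =
  trans (sum-list-++ (map (g x) ys) _ f)
        (cong₂ _+_ (sum-map (g x) ys f) (sum-cartesianProductWith g xs ys f))

length-sum : ∀ (xs : List A) → length xs ≡ sumOver xs (λ _ → 1)
length-sum xs = sym (trans (sum-const xs 1) (*-identityʳ _))

sum-upTo-suc : ∀ n (f : ℕ → ℕ) → sumOver (upTo (suc n)) f ≡ sumOver (upTo n) f + f n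
sum-upTo-suc n f = trans (cong (λ l → sumOver l f) (sym (upTo-∷ʳ n)))
  (trans (sum-list-++ (upTo n) (n ∷ []) f) (cong (sumOver (upTo n) f +_) (+-identityʳ (f n))))

sum-upTo-cong : ∀ n {f g : ℕ → ℕ} → (∀ i → i < n → f i ≡ g i) → sumOver (upTo n) f ≡ sumOver (upTo n) g
sum-upTo-cong n h = sum-cong-∈ (upTo n) (λ i i∈ → h i (∈-upTo⁻ i∈))

sum-upTo-split : ∀ n u → u < n → (f : ℕ → ℕ) →
                 sumOver (upTo n) f ≡ sumOver (upTo n) (λ i → ⟦ ¬? (u ≟ i) ⟧ * f i) + f u
sum-upTo-split n u u<n f = begin
  sumOver (upTo n) f
    ≡⟨ sum-cong (upTo n) (λ i → sym (trans (sym (*-distribʳ-+ (f i) ⟦ ¬? (u ≟ i) ⟧ _))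
         (trans (cong (_* f i) (⟦⟧-¬ (u ≟ i))) (*-identityˡ (f i))))) ⟩
  sumOver (upTo n) (λ i → ⟦ ¬? (u ≟ i) ⟧ * f i + ⟦ u ≟ i ⟧ * f i)
    ≡⟨ sum-+ (upTo n) ⟩
  sumOver (upTo n) (λ i → ⟦ ¬? (u ≟ i) ⟧ * f i) + sumOver (upTo n) (λ i → ⟦ u ≟ i ⟧ * f i)
    ≡⟨ cong (sumOver (upTo n) (λ i → ⟦ ¬? (u ≟ i) ⟧ * f i) +_) (sum-δ _≟_ (upTo⁺ n) (∈-upTo⁺ u<n) f) ⟩
  sumOver (upTo n) (λ i → ⟦ ¬? (u ≟ i) ⟧ * f i) + f u ∎
  where open ≡-Reasoning

sum-allFin-suc : ∀ n (f : Fin (suc n) → ℕ) → sumOver (allFin (suc n)) f ≡ f zero + sumOver (allFin n) (f ∘ suc)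
sum-allFin-suc n f = cong (λ l → f zero + sum l)
  (trans (cong (map f) (sym (map-tabulate id suc))) (sym (map-∘ (allFin n))))

sum-allFin-lookup : ∀ (xs : List A) f → sumOver (allFin (length xs)) (f ∘ lookup xs) ≡ sumOver xs f
sum-allFin-lookup []       f = refl
sum-allFin-lookup (x ∷ xs) f = trans (sum-allFin-suc (length xs) (f ∘ lookup (x ∷ xs)))
  (cong (f x +_) (sum-allFin-lookup xs f))

sum-allFin-punchIn : ∀ {n} (i : Fin (suc n)) (f : Fin (suc n) → ℕ) →
  sumOver (allFin (suc n)) f ≡ f i + sumOver (allFin n) (f ∘ punchIn i)
sum-allFin-punchIn {n}     zero    f = sum-allFin-suc n f
sum-allFin-punchIn {suc n} (suc i) f = begin
  sumOver (allFin (2 + n)) f                                         ≡⟨ sum-allFin-suc (suc n) f ⟩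
  f zero + sumOver (allFin (suc n)) (f ∘ suc)                        ≡⟨ cong (f zero +_) (sum-allFin-punchIn i (f ∘ suc)) ⟩
  f zero + (f (suc i) + sumOver (allFin n) (f ∘ suc ∘ punchIn i))    ≡⟨ ℕ+.x∙yz≈y∙xz (f zero) (f (suc i)) _ ⟩
  f (suc i) + (f zero + sumOver (allFin n) (f ∘ suc ∘ punchIn i))    ≡⟨ cong (f (suc i) +_) (sym (sum-allFin-suc n (f ∘ punchIn (suc i)))) ⟩
  f (suc i) + sumOver (allFin (suc n)) (f ∘ punchIn (suc i))         ∎
  where open ≡-Reasoning

sum-allFin-++ : ∀ m n (f : Fin (m + n) → ℕ) →
  sumOver (allFin (m + n)) f ≡ sumOver (allFin m) (f ∘ (_↑ˡ n)) + sumOver (allFin n) (f ∘ (m ↑ʳ_))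
sum-allFin-++ zero    n f = refl
sum-allFin-++ (suc m) n f = begin
  sumOver (allFin (suc m + n)) f                 ≡⟨ sum-allFin-suc (m + n) f ⟩
  f zero + sumOver (allFin (m + n)) (f ∘ suc)    ≡⟨ cong (f zero +_) (sum-allFin-++ m n (f ∘ suc)) ⟩
  f zero + (sumOver (allFin m) (f ∘ suc ∘ (_↑ˡ n)) + R) ≡⟨ sym (+-assoc (f zero) _ R) ⟩
  f zero + sumOver (allFin m) (f ∘ suc ∘ (_↑ˡ n)) + R   ≡⟨ cong (_+ R) (sym (sum-allFin-suc m (f ∘ (_↑ˡ n)))) ⟩
  sumOver (allFin (suc m)) (f ∘ (_↑ˡ n)) + R ∎
  where
  open ≡-Reasoning
  R = sumOver (allFin n) (f ∘ (suc m ↑ʳ_))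

length-allFin : ∀ n → length (allFin n) ≡ n
length-allFin n = length-tabulate id

sum-quotient : ∀ m r (f : Fin m → ℕ) →
  sumOver (allFin (m * r)) (f ∘ quotient {m} r) ≡ r * sumOver (allFin m) f
sum-quotient zero    r f = sym (*-zeroʳ r)
sum-quotient (suc m) r f = begin
  sumOver (allFin (suc m * r)) (f ∘ quotient {suc m} r)
    ≡⟨ sum-allFin-++ r (m * r) (f ∘ quotient {suc m} r) ⟩
  sumOver (allFin r) (f ∘ quotient {suc m} r ∘ (_↑ˡ m * r))
    + sumOver (allFin (m * r)) (f ∘ quotient {suc m} r ∘ (r ↑ʳ_))
    ≡⟨ cong₂ _+_ (trans (sum-cong (allFin r) (cong f ∘ left)) (trans (sum-const (allFin r) (f zero)) (cong (_* f zero) (length-allFin r))))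
                 (trans (sum-cong (allFin (m * r)) (cong f ∘ right)) (sum-quotient m r (f ∘ suc))) ⟩
  r * f zero + r * sumOver (allFin m) (f ∘ suc)
    ≡⟨ sym (*-distribˡ-+ r (f zero) _) ⟩
  r * (f zero + sumOver (allFin m) (f ∘ suc))
    ≡⟨ cong (r *_) (sym (sum-allFin-suc m f)) ⟩
  r * sumOver (allFin (suc m)) f ∎
  where
  open ≡-Reasoning
  left : ∀ j → quotient {suc m} r (j ↑ˡ m * r) ≡ zero
  left j rewrite Fin.splitAt-↑ˡ r j (m * r) = refl
  right : ∀ j → quotient {suc m} r (r ↑ʳ j) ≡ suc (quotient {m} r j)
  right j rewrite Fin.splitAt-↑ʳ r (m * r) j = refl

-- Permutations from equal counts; enumerations of lists

module _ (_≟ᴬ_ : DecidableEquality A) where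

  insert-self : ∀ {n} (i j : Fin (suc n)) (π : Permutation′ n) → Perm.insert i j π ⟨$⟩ʳ i ≡ j
  insert-self i j π with i Fin.≟ i
  ... | yes _  = refl
  ... | no i≢i = contradiction refl i≢i

  -- The value `g zero` has positive count, so `f` takes it at some `i`. Removing `i` from `f` and
  -- `zero` from `g` leaves equal counts, and the permutation of the rest is extended by this match.
  equal-counts⇒permutation : ∀ {n} (f g : Fin n → A) →
    (∀ x → sumOver (allFin n) (λ j → ⟦ f j ≟ᴬ x ⟧) ≡ sumOver (allFin n) (λ j → ⟦ g j ≟ᴬ x ⟧)) →
    Σ[ σ ∈ Permutation′ n ] (∀ j → f (σ ⟨$⟩ʳ j) ≡ g j)
  equal-counts⇒permutation {zero}  f g h = Perm.id , λ ()
  equal-counts⇒permutation {suc n} f g h = Perm.insert zero i σ , agree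
    where
    hit : ∃[ i ] f i ≡ g zero
    hit with sum-positive (allFin (suc n)) (λ j → ⟦ f j ≟ᴬ g zero ⟧)
               (≤-trans (≤-reflexive (sym (⟦⟧-yes (g zero ≟ᴬ g zero) refl)))
                 (≤-trans (m≤m+n _ _) (≤-reflexive (sym (trans (h (g zero)) (sum-allFin-suc n _))))))
    ... | i , _ , 0< with f i ≟ᴬ g zero
    ... | yes eq = i , eq
    i = proj₁ hit
    tails : ∃[ σ ] (∀ j → f (punchIn i (σ ⟨$⟩ʳ j)) ≡ g (suc j))
    tails = equal-counts⇒permutation (f ∘ punchIn i) (g ∘ suc) λ x → +-cancelˡ-≡ ⟦ f i ≟ᴬ x ⟧ _ _
      (trans (sym (sum-allFin-punchIn i _)) (trans (h x) (trans (sum-allFin-suc n _)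
        (cong (λ y → ⟦ y ≟ᴬ x ⟧ + _) (sym (proj₂ hit))))))
    σ = proj₁ tails
    agree : ∀ j → f (Perm.insert zero i σ ⟨$⟩ʳ j) ≡ g j
    agree zero    = trans (cong f (insert-self zero i σ)) (proj₂ hit)
    agree (suc j) = trans (cong f (Perm.insert-punchIn zero i σ j)) (proj₂ tails j)

AllPairs-lookup : ∀ {R : A → A → Set} {xs} → AllPairs R xs → ∀ {i j} → i Fin.< j → R (lookup xs i) (lookup xs j)
AllPairs-lookup (r ∷ _) {zero}  {suc j} _         = All.lookup r (∈-lookup j)
AllPairs-lookup (_ ∷ a) {suc i} {suc j} (s≤s i<j) = AllPairs-lookup a i<j

-- A list indexed by an `n` only propositionally equal to its length, so that codes get the length
-- named in the theorem without transport. `pairs` ranges over all `R` because it yields both the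
-- order of the surviving positions and the distinctness of the simplex columns.
record Enumeration (xs : List A) (n : ℕ) : Set₁ where
  field
    entry   : Fin n → A
    entry∈  : ∀ j → entry j ∈ xs
    find    : ∀ {x} → x ∈ xs → ∃[ j ] entry j ≡ x
    pairs   : ∀ {R : A → A → Set} → AllPairs R xs → ∀ {i j} → i Fin.< j → R (entry i) (entry j)
    sums    : ∀ f → sumOver (allFin n) (f ∘ entry) ≡ sumOver xs f

enumerate : ∀ (xs : List A) {n} → length xs ≡ n → Enumeration xs n
enumerate xs refl = record
  { entry  = lookup xs
  ; entry∈ = ∈-lookup
  ; find   = λ x∈ → Any.index x∈ , sym (lookup-index x∈)
  ; pairs  = AllPairs-lookup
  ; sums   = sum-allFin-lookup xs
  }

upTo-sorted : ∀ n → AllPairs _<_ (upTo n)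
upTo-sorted n = AllPairs.applyUpTo⁺₁ id n (λ i<j _ → i<j)

-- Balanced colourings

∈⇒≤sum : ∀ {A : Set} {xs} {x : A} (f : A → ℕ) → x ∈ xs → f x ≤ sumOver xs f
∈⇒≤sum f (here refl) = m≤m+n _ _
∈⇒≤sum f (there x∈)  = ≤-trans (∈⇒≤sum f x∈) (m≤n+m _ _)

override : ∀ {A : Set} → ℕ → A → (ℕ → A) → ℕ → A
override u x h i = if does (u ≟ i) then x else h i

if-yes : ∀ {A P : Set} (p? : Dec P) {x y : A} → P → (if does p? then x else y) ≡ x
if-yes (yes _) p = refl
if-yes (no ¬p) p = contradiction p ¬p

if-no : ∀ {A P : Set} (p? : Dec P) {x y : A} → ¬ P → (if does p? then x else y) ≡ y
if-no (yes p) ¬p = contradiction p ¬p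
if-no (no _)  ¬p = refl

override-at : ∀ {A : Set} u (x : A) h → override u x h u ≡ x
override-at u x h = if-yes (u ≟ u) refl

override-off : ∀ {A : Set} u (x : A) h {i} → u ≢ i → override u x h i ≡ h i
override-off u x h {i} = if-no (u ≟ i)

sum-upTo-split₂ : ∀ M {ξ η} → ξ ≢ η → ξ < M → η < M → (f : ℕ → ℕ) →
  sumOver (upTo M) f ≡ sumOver (upTo M) (λ i → (⟦ ¬? (ξ ≟ i) ⟧ * ⟦ ¬? (η ≟ i) ⟧) * f i) + (f ξ + f η)
sum-upTo-split₂ M {ξ} {η} ξ≢η ξ<M η<M f = begin
  sumOver (upTo M) f                                         ≡⟨ sum-upTo-split M ξ ξ<M f ⟩
  sumOver (upTo M) g + f ξ                                   ≡⟨ cong (_+ f ξ) (sum-upTo-split M η η<M g) ⟩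
  sumOver (upTo M) (λ i → ⟦ ¬? (η ≟ i) ⟧ * g i) + g η + f ξ
    ≡⟨ cong₂ (λ s t → s + t + f ξ) (sum-cong (upTo M) (λ i → arith ⟦ ¬? (η ≟ i) ⟧ ⟦ ¬? (ξ ≟ i) ⟧ (f i)))
             (trans (cong (_* f η) (⟦⟧-yes (¬? (ξ ≟ η)) ξ≢η)) (*-identityˡ (f η))) ⟩
  S + f η + f ξ                                              ≡⟨ trans (+-assoc S _ _) (cong (S +_) (+-comm (f η) (f ξ))) ⟩
  S + (f ξ + f η)                                            ∎
  where
  open ≡-Reasoning
  g : ℕ → ℕ
  g i = ⟦ ¬? (ξ ≟ i) ⟧ * f i
  S = sumOver (upTo M) (λ i → (⟦ ¬? (ξ ≟ i) ⟧ * ⟦ ¬? (η ≟ i) ⟧) * f i)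
  arith : ∀ a b c → a * (b * c) ≡ (b * a) * c
  arith = solve-∀

module Colouring {c : ℕ} (default : Fin c) where

  -- Greedy choice: as long as a position of `A` is left to colour, the quotas have positive total,
  -- so some colour still has quota. Positions outside `A` are not counted and take any colour.
  colouring : ∀ {A : ℕ → Set} (A? : ∀ i → Dec (A i)) M (q : Fin c → ℕ) →
    sumOver (allFin c) q ≡ sumOver (upTo M) (λ i → ⟦ A? i ⟧) →
    Σ[ h ∈ (ℕ → Fin c) ] (∀ b → sumOver (upTo M) (λ i → ⟦ A? i ⟧ * ⟦ h i Fin.≟ b ⟧) ≡ q b)
  colouring A? zero q total = (λ _ → default) , λ b →
    sym (n≤0⇒n≡0 (≤-trans (∈⇒≤sum q (∈-allFin b)) (≤-reflexive total)))
  colouring {A} A? (suc M) q total = by (A? M) (trans total (sum-upTo-suc M _))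
    where
    open ≡-Reasoning
    by : (a : Dec (A M)) → sumOver (allFin c) q ≡ sumOver (upTo M) (λ i → ⟦ A? i ⟧) + ⟦ a ⟧ →
      Σ[ h ∈ (ℕ → Fin c) ] (∀ b → sumOver (upTo (suc M)) (λ i → ⟦ A? i ⟧ * ⟦ h i Fin.≟ b ⟧) ≡ q b)
    by (no ¬a) eq with h , hq ← colouring A? M q (trans eq (+-identityʳ _)) = h , λ b →
      trans (sum-upTo-suc M _) (trans (cong₂ _+_ (hq b) (cong (_* ⟦ h M Fin.≟ b ⟧) (⟦⟧-no (A? M) ¬a))) (+-identityʳ (q b)))
    by (yes a) eq with b₀ , _ , 0<q ← sum-positive (allFin c) q (≤-trans (m≤n+m 1 _) (≤-reflexive (sym eq))) =
      override M b₀ h , count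
      where
      q′ : Fin c → ℕ
      q′ b = q b ∸ ⟦ b₀ Fin.≟ b ⟧
      below : ∀ b (t : Dec (b₀ ≡ b)) → ⟦ t ⟧ ≤ q b
      below b (yes refl) = 0<q
      below b (no _)     = z≤n
      q≡q′ : ∀ b → q b ≡ q′ b + ⟦ b₀ Fin.≟ b ⟧
      q≡q′ b = sym (m∸n+n≡m (below b (b₀ Fin.≟ b)))
      rest = colouring A? M q′ (+-cancelʳ-≡ 1 _ _ (begin
        sumOver (allFin c) q′ + 1 ≡⟨ cong (sumOver (allFin c) q′ +_) (sym (sum-δ-1 Fin._≟_ (allFin⁺ c) (∈-allFin b₀))) ⟩
        sumOver (allFin c) q′ + sumOver (allFin c) (λ b → ⟦ b₀ Fin.≟ b ⟧) ≡⟨ sym (sum-+ (allFin c)) ⟩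
        sumOver (allFin c) (λ b → q′ b + ⟦ b₀ Fin.≟ b ⟧) ≡⟨ sum-cong (allFin c) (λ b → sym (q≡q′ b)) ⟩
        sumOver (allFin c) q ≡⟨ eq ⟩
        sumOver (upTo M) (λ i → ⟦ A? i ⟧) + 1 ∎))
      h = proj₁ rest
      count : ∀ b → sumOver (upTo (suc M)) (λ i → ⟦ A? i ⟧ * ⟦ override M b₀ h i Fin.≟ b ⟧) ≡ q b
      count b = begin
        sumOver (upTo (suc M)) (λ i → ⟦ A? i ⟧ * ⟦ override M b₀ h i Fin.≟ b ⟧) ≡⟨ sum-upTo-suc M _ ⟩
        sumOver (upTo M) (λ i → ⟦ A? i ⟧ * ⟦ override M b₀ h i Fin.≟ b ⟧) + ⟦ A? M ⟧ * ⟦ override M b₀ h M Fin.≟ b ⟧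
          ≡⟨ cong₂ _+_ (sum-upTo-cong M (λ i i<M → cong (λ t → ⟦ A? i ⟧ * ⟦ t Fin.≟ b ⟧) (override-off M b₀ h (<⇒≢ i<M ∘ sym))))
               (trans (cong₂ (λ s t → s * ⟦ t Fin.≟ b ⟧) (⟦⟧-yes (A? M) a) (override-at M b₀ h)) (*-identityˡ _)) ⟩
        sumOver (upTo M) (λ i → ⟦ A? i ⟧ * ⟦ h i Fin.≟ b ⟧) + ⟦ b₀ Fin.≟ b ⟧ ≡⟨ cong (_+ ⟦ b₀ Fin.≟ b ⟧) (proj₂ rest b) ⟩
        q′ b + ⟦ b₀ Fin.≟ b ⟧ ≡⟨ sym (q≡q′ b) ⟩
        q b ∎

  module _ {K : Set} (_≟ᴷ_ : DecidableEquality K) (κ : ℕ → K) {M ξ η : ℕ} (ξ≢η : ξ ≢ η) (ξ<M : ξ < M) (η<M : η < M)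
           (x y : Fin c) {d₁ : ℕ} (2≤d₁ : 2 ≤ d₁) where

    -- The two pinned positions are set aside, the quotas are reduced by the places they occupy, and
    -- the rest of each class is coloured by the reduced quotas. The reduction is legitimate because
    -- the pins occupy at most two places of one colour in one class, and `2 ≤ d₁`.
    pinned-colouring : Σ[ h ∈ (ℕ → Fin c) ] h ξ ≡ x × h η ≡ y ×
      (∀ n → sumOver (upTo M) (λ i → ⟦ κ i ≟ᴷ n ⟧) ≡ c * d₁ →
       ∀ b → sumOver (upTo M) (λ i → ⟦ κ i ≟ᴷ n ⟧ * ⟦ h i Fin.≟ b ⟧) ≡ d₁)
    pinned-colouring = h , h-ξ , h-η , balanced
      where
      open ≡-Reasoning
      free : ℕ → ℕ
      free i = ⟦ ¬? (ξ ≟ i) ⟧ * ⟦ ¬? (η ≟ i) ⟧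
      A? : ∀ n i → Dec ((ξ ≢ i × η ≢ i) × κ i ≡ n)
      A? n i = (¬? (ξ ≟ i) ×-dec ¬? (η ≟ i)) ×-dec (κ i ≟ᴷ n)
      ⟦A⟧ : ∀ n i → ⟦ A? n i ⟧ ≡ free i * ⟦ κ i ≟ᴷ n ⟧
      ⟦A⟧ n i = trans (⟦⟧-× (¬? (ξ ≟ i) ×-dec ¬? (η ≟ i)) (κ i ≟ᴷ n)) (cong (_* ⟦ κ i ≟ᴷ n ⟧) (⟦⟧-× (¬? (ξ ≟ i)) (¬? (η ≟ i))))
      pins : K → Fin c → ℕ
      pins n b = ⟦ κ ξ ≟ᴷ n ⟧ * ⟦ x Fin.≟ b ⟧ + ⟦ κ η ≟ᴷ n ⟧ * ⟦ y Fin.≟ b ⟧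
      pins≤d₁ : ∀ n b → pins n b ≤ d₁
      pins≤d₁ n b = ≤-trans (+-mono-≤ (*-mono-≤ (⟦⟧≤1 (κ ξ ≟ᴷ n)) (⟦⟧≤1 (x Fin.≟ b)))
                                      (*-mono-≤ (⟦⟧≤1 (κ η ≟ᴷ n)) (⟦⟧≤1 (y Fin.≟ b)))) 2≤d₁
      quota : K → Fin c → ℕ
      quota n b = d₁ ∸ pins n b
      quota+pins : ∀ n b → quota n b + pins n b ≡ d₁
      quota+pins n b = m∸n+n≡m (pins≤d₁ n b)
      count : K → ℕ
      count n = sumOver (upTo M) (λ i → ⟦ κ i ≟ᴷ n ⟧)

      pinned-total : ∀ n → sumOver (allFin c) (pins n) ≡ ⟦ κ ξ ≟ᴷ n ⟧ + ⟦ κ η ≟ᴷ n ⟧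
      pinned-total n = trans (sum-+ (allFin c)) (cong₂ _+_ (one ⟦ κ ξ ≟ᴷ n ⟧ x) (one ⟦ κ η ≟ᴷ n ⟧ y))
        where
        one : ∀ k z → sumOver (allFin c) (λ b → k * ⟦ z Fin.≟ b ⟧) ≡ k
        one k z = trans (sum-*ˡ (allFin c) k) (trans (cong (k *_) (sum-δ-1 Fin._≟_ (allFin⁺ c) (∈-allFin z))) (*-identityʳ k))

      quota-total : ∀ n → count n ≡ c * d₁ → sumOver (allFin c) (quota n) ≡ sumOver (upTo M) (λ i → ⟦ A? n i ⟧)
      quota-total n eq = +-cancelʳ-≡ (⟦ κ ξ ≟ᴷ n ⟧ + ⟦ κ η ≟ᴷ n ⟧) _ _ (begin
        sumOver (allFin c) (quota n) + (⟦ κ ξ ≟ᴷ n ⟧ + ⟦ κ η ≟ᴷ n ⟧)   ≡⟨ cong (sumOver (allFin c) (quota n) +_) (sym (pinned-total n)) ⟩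
        sumOver (allFin c) (quota n) + sumOver (allFin c) (pins n)     ≡⟨ sym (sum-+ (allFin c)) ⟩
        sumOver (allFin c) (λ b → quota n b + pins n b)                ≡⟨ sum-cong (allFin c) (quota+pins n) ⟩
        sumOver (allFin c) (λ _ → d₁)                                  ≡⟨ trans (sum-const (allFin c) d₁) (cong (_* d₁) (length-allFin c)) ⟩
        c * d₁                                                         ≡⟨ sym eq ⟩
        count n                                                        ≡⟨ sum-upTo-split₂ M ξ≢η ξ<M η<M _ ⟩
        sumOver (upTo M) (λ i → free i * ⟦ κ i ≟ᴷ n ⟧) + (⟦ κ ξ ≟ᴷ n ⟧ + ⟦ κ η ≟ᴷ n ⟧)
          ≡⟨ cong (_+ _) (sum-cong (upTo M) (λ i → sym (⟦A⟧ n i))) ⟩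
        sumOver (upTo M) (λ i → ⟦ A? n i ⟧) + (⟦ κ ξ ≟ᴷ n ⟧ + ⟦ κ η ≟ᴷ n ⟧) ∎)

      class : ∀ n → Σ[ h ∈ (ℕ → Fin c) ] (count n ≡ c * d₁ → ∀ b →
        sumOver (upTo M) (λ i → ⟦ A? n i ⟧ * ⟦ h i Fin.≟ b ⟧) ≡ quota n b)
      class n with count n ≟ c * d₁
      ... | yes eq = let h , hq = colouring (A? n) M (quota n) (quota-total n eq) in h , λ _ → hq
      -- Nothing is asked of a class of another size, so any colouring serves.
      ... | no ne  = (λ _ → default) , λ eq → contradiction eq ne

      base : ℕ → Fin c
      base i = proj₁ (class (κ i)) i
      h : ℕ → Fin c
      h = override ξ x (override η y base)
      h-ξ : h ξ ≡ x
      h-ξ = override-at ξ x (override η y base)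
      h-η : h η ≡ y
      h-η = trans (override-off ξ x (override η y base) ξ≢η) (override-at η y base)
      h-off : ∀ {i} → ξ ≢ i → η ≢ i → h i ≡ base i
      h-off ξ≢i η≢i = trans (override-off ξ x (override η y base) ξ≢i) (override-off η y base η≢i)

      agree : ∀ n b i → free i * (⟦ κ i ≟ᴷ n ⟧ * ⟦ h i Fin.≟ b ⟧) ≡ ⟦ A? n i ⟧ * ⟦ proj₁ (class n) i Fin.≟ b ⟧
      agree n b i = trans (by (ξ ≟ i) (η ≟ i) (κ i ≟ᴷ n)) (cong (_* ⟦ proj₁ (class n) i Fin.≟ b ⟧) (sym (⟦A⟧ n i)))
        where
        by : (s : Dec (ξ ≡ i)) (t : Dec (η ≡ i)) (u : Dec (κ i ≡ n)) →
          (⟦ ¬? s ⟧ * ⟦ ¬? t ⟧) * (⟦ u ⟧ * ⟦ h i Fin.≟ b ⟧) ≡ (⟦ ¬? s ⟧ * ⟦ ¬? t ⟧) * ⟦ u ⟧ * ⟦ proj₁ (class n) i Fin.≟ b ⟧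
        by (yes _) _ _ = refl
        by (no _) (yes _) _ = refl
        by (no _) (no _) (no _) = refl
        by (no ξ≢i) (no η≢i) (yes refl) = trans (cong (λ t → 1 * (1 * ⟦ t Fin.≟ b ⟧))
          (h-off ξ≢i η≢i)) (*-identityˡ _)

      balanced : ∀ n → count n ≡ c * d₁ → ∀ b → sumOver (upTo M) (λ i → ⟦ κ i ≟ᴷ n ⟧ * ⟦ h i Fin.≟ b ⟧) ≡ d₁
      balanced n eq b = begin
        sumOver (upTo M) (λ i → ⟦ κ i ≟ᴷ n ⟧ * ⟦ h i Fin.≟ b ⟧) ≡⟨ sum-upTo-split₂ M ξ≢η ξ<M η<M _ ⟩
        sumOver (upTo M) (λ i → free i * (⟦ κ i ≟ᴷ n ⟧ * ⟦ h i Fin.≟ b ⟧)) + (⟦ κ ξ ≟ᴷ n ⟧ * ⟦ h ξ Fin.≟ b ⟧ + ⟦ κ η ≟ᴷ n ⟧ * ⟦ h η Fin.≟ b ⟧)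
          ≡⟨ cong₂ _+_ (sum-cong (upTo M) (agree n b))
               (cong₂ (λ s t → ⟦ κ ξ ≟ᴷ n ⟧ * ⟦ s Fin.≟ b ⟧ + ⟦ κ η ≟ᴷ n ⟧ * ⟦ t Fin.≟ b ⟧)
                 h-ξ h-η) ⟩
        sumOver (upTo M) (λ i → ⟦ A? n i ⟧ * ⟦ proj₁ (class n) i Fin.≟ b ⟧) + pins n b
          ≡⟨ cong (_+ pins n b) (proj₂ (class n) eq b) ⟩
        quota n b + pins n b ≡⟨ quota+pins n b ⟩
        d₁ ∎

module Lexicodes (p : ℕ) (p-prime : Prime p) where
  open Codes p p-prime
  open Arithmetic
  open DigitBounds
  open Existence using (∑<-spike; ∑<-spikes; ∑<-extend; combine-bound; dist-count; count-extend; digit-zero; digit-suc;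
    e-diag; e-off; basis-spans; maxBound; bound≤maxBound; module Construction)

  -- Linear algebra over the field with p elements

  instance
    p-nonZero : NonZero p
    p-nonZero = prime⇒nonZero p-prime

  mod-+ : ∀ m n → m mod p +ₚ n mod p ≡ (m + n) mod p
  mod-+ m n = mod-cong (trans (cong₂ (λ s t → (s + t) % p) (toℕ-mod m) (toℕ-mod n)) (sym (%-distribˡ-+ m n p)))

  mod-* : ∀ m n → (m mod p) *ₚ (n mod p) ≡ (m * n) mod p
  mod-* m n = mod-cong (trans (cong₂ (λ s t → (s * t) % p) (toℕ-mod m) (toℕ-mod n)) (sym (%-distribˡ-* m n p)))

  +ₚ-assoc : ∀ a b c → (a +ₚ b) +ₚ c ≡ a +ₚ (b +ₚ c)
  +ₚ-assoc a b c = begin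
    (a +ₚ b) +ₚ c                              ≡⟨ cong (a +ₚ b +ₚ_) (sym (mod-toℕ c)) ⟩
    (a +ₚ b) +ₚ toℕ c mod p                    ≡⟨ mod-+ (toℕ a + toℕ b) (toℕ c) ⟩
    (toℕ a + toℕ b + toℕ c) mod p              ≡⟨ cong (_mod p) (+-assoc (toℕ a) _ _) ⟩
    (toℕ a + (toℕ b + toℕ c)) mod p            ≡⟨ sym (mod-+ (toℕ a) _) ⟩
    toℕ a mod p +ₚ (b +ₚ c)                    ≡⟨ cong (_+ₚ (b +ₚ c)) (mod-toℕ a) ⟩
    a +ₚ (b +ₚ c)                              ∎
    where open ≡-Reasoning

  *ₚ-assoc : ∀ a b c → (a *ₚ b) *ₚ c ≡ a *ₚ (b *ₚ c)
  *ₚ-assoc a b c = begin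
    (a *ₚ b) *ₚ c                              ≡⟨ cong (a *ₚ b *ₚ_) (sym (mod-toℕ c)) ⟩
    (a *ₚ b) *ₚ (toℕ c mod p)                  ≡⟨ mod-* (toℕ a * toℕ b) (toℕ c) ⟩
    (toℕ a * toℕ b * toℕ c) mod p              ≡⟨ cong (_mod p) (*-assoc (toℕ a) _ _) ⟩
    (toℕ a * (toℕ b * toℕ c)) mod p            ≡⟨ sym (mod-* (toℕ a) _) ⟩
    (toℕ a mod p) *ₚ (b *ₚ c)                  ≡⟨ cong (_*ₚ (b *ₚ c)) (mod-toℕ a) ⟩
    a *ₚ (b *ₚ c)                              ∎
    where open ≡-Reasoning

  *ₚ-distribˡ : ∀ a b c → a *ₚ (b +ₚ c) ≡ a *ₚ b +ₚ a *ₚ c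
  *ₚ-distribˡ a b c = begin
    a *ₚ (b +ₚ c)                              ≡⟨ cong (_*ₚ (b +ₚ c)) (sym (mod-toℕ a)) ⟩
    (toℕ a mod p) *ₚ (b +ₚ c)                  ≡⟨ mod-* (toℕ a) _ ⟩
    (toℕ a * (toℕ b + toℕ c)) mod p            ≡⟨ cong (_mod p) (*-distribˡ-+ (toℕ a) _ _) ⟩
    (toℕ a * toℕ b + toℕ a * toℕ c) mod p      ≡⟨ sym (mod-+ (toℕ a * toℕ b) _) ⟩
    a *ₚ b +ₚ a *ₚ c                           ∎
    where open ≡-Reasoning

  *ₚ-distribʳ : ∀ a b c → (b +ₚ c) *ₚ a ≡ b *ₚ a +ₚ c *ₚ a
  *ₚ-distribʳ a b c = trans (*ₚ-comm _ a) (trans (*ₚ-distribˡ a b c) (cong₂ _+ₚ_ (*ₚ-comm a b) (*ₚ-comm a c)))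

  infix 8 -ₚ_
  -ₚ_ : 𝔽 → 𝔽
  -ₚ a = proj₁ (difference 0# a)

  -ₚ-inverseˡ : ∀ a → -ₚ a +ₚ a ≡ 0#
  -ₚ-inverseˡ a = proj₂ (difference 0# a)

  -ₚ-inverseʳ : ∀ a → a +ₚ -ₚ a ≡ 0#
  -ₚ-inverseʳ a = trans (+ₚ-comm a _) (-ₚ-inverseˡ a)

  𝔽-ring : CommutativeRing 0ℓ 0ℓ
  𝔽-ring = record
    { Carrier = 𝔽 ; _≈_ = _≡_ ; _+_ = _+ₚ_ ; _*_ = _*ₚ_ ; -_ = -ₚ_ ; 0# = 0# ; 1# = 1#
    ; isCommutativeRing = record
      { isRing = record
        { +-isAbelianGroup = record
          { isGroup = record
            { isMonoid = record
              { isSemigroup = record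
                { isMagma = record { isEquivalence = isEquivalence ; ∙-cong = cong₂ _+ₚ_ }
                ; assoc = +ₚ-assoc }
              ; identity = +-idˡ , +-idʳ }
            ; inverse = -ₚ-inverseˡ , -ₚ-inverseʳ
            ; ⁻¹-cong = cong -ₚ_ }
          ; comm = +ₚ-comm }
        ; *-cong = cong₂ _*ₚ_
        ; *-assoc = *ₚ-assoc
        ; *-identity = *-idˡ , *-idʳ
        ; distrib = *ₚ-distribˡ , *ₚ-distribʳ }
      ; *-comm = *ₚ-comm } }

  open import Algebra.Properties.Ring (CommutativeRing.ring 𝔽-ring) public
    using (-‿distribˡ-*; -‿distribʳ-*; -‿involutive; -‿+-comm; -0#≈0#)
    renaming (+-cancelˡ to +ₚ-cancelˡ; +-cancelʳ to +ₚ-cancelʳ)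
  open import Algebra.Properties.CommutativeSemigroup
    (CommutativeRing.+-commutativeSemigroup 𝔽-ring) public
    using () renaming (interchange to +ₚ-interchange; x∙yz≈y∙xz to +ₚ-swap)

  infix 4 _≟ₚ_
  _≟ₚ_ : (a b : 𝔽) → Dec (a ≡ b)
  _≟ₚ_ = Fin._≟_

  multiple-of-p : ∀ n → (n * p) mod p ≡ 0#
  multiple-of-p n = mod-cong (trans (m*n%n≡0 n p) (sym (m<n⇒m%n≡m (<-trans z<s p>1))))

  inverse : ∀ {x} → x ≢ 0# → ∃[ y ] y *ₚ x ≡ 1#
  inverse {x} x≢0 with coprime-Bézout (prime⇒coprime p-prime {{≢-nonZero (λ n≡0 → x≢0 (Fin.toℕ-injective (trans n≡0 (sym toℕ-0#))))}} (Fin.toℕ<n x))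
  ... | GCD.Bézout.-+ u v eq = v mod p , (begin
    (v mod p) *ₚ x                  ≡⟨ cong ((v mod p) *ₚ_) (sym (mod-toℕ x)) ⟩
    (v mod p) *ₚ (toℕ x mod p)      ≡⟨ mod-* v (toℕ x) ⟩
    (v * toℕ x) mod p               ≡⟨ cong (_mod p) (sym eq) ⟩
    (1 + u * p) mod p               ≡⟨ sym (mod-+ 1 (u * p)) ⟩
    1# +ₚ (u * p) mod p             ≡⟨ cong (1# +ₚ_) (multiple-of-p u) ⟩
    1# +ₚ 0#                        ≡⟨ +-idʳ 1# ⟩
    1#                              ∎)
    where open ≡-Reasoning
  -- Over the natural numbers Bézout's identity comes with two signs. Here `1 + v * x = u * p`, so
  -- the inverse is `- v`.
  ... | GCD.Bézout.+- u v eq = -ₚ (v mod p) , +ₚ-cancelʳ ((v mod p) *ₚ x) _ _ (begin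
    -ₚ (v mod p) *ₚ x +ₚ (v mod p) *ₚ x  ≡⟨ sym (*ₚ-distribʳ x (-ₚ (v mod p)) (v mod p)) ⟩
    (-ₚ (v mod p) +ₚ v mod p) *ₚ x       ≡⟨ cong (_*ₚ x) (-ₚ-inverseˡ _) ⟩
    0# *ₚ x                              ≡⟨ *-zeroˡₚ x ⟩
    0#                                   ≡⟨ sym (multiple-of-p u) ⟩
    (u * p) mod p                        ≡⟨ cong (_mod p) (sym eq) ⟩
    (1 + v * toℕ x) mod p                ≡⟨ sym (mod-+ 1 (v * toℕ x)) ⟩
    1# +ₚ (v * toℕ x) mod p              ≡⟨ cong (1# +ₚ_) (sym (mod-* v (toℕ x))) ⟩
    1# +ₚ (v mod p) *ₚ (toℕ x mod p)     ≡⟨ cong (λ t → 1# +ₚ (v mod p) *ₚ t) (mod-toℕ x) ⟩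
    1# +ₚ (v mod p) *ₚ x                 ∎)
    where open ≡-Reasoning

  *ₚ-cancelʳ : ∀ {x} → x ≢ 0# → ∀ {a b} → a *ₚ x ≡ b *ₚ x → a ≡ b
  *ₚ-cancelʳ {x} x≢0 {a} {b} eq with y , yx ← inverse x≢0 = trans (sym (cancel a)) (trans (cong (_*ₚ y) eq) (cancel b))
    where
    cancel : ∀ c → (c *ₚ x) *ₚ y ≡ c
    cancel c = trans (*ₚ-assoc c x y) (trans (cong (c *ₚ_) (trans (*ₚ-comm x y) yx)) (*-idʳ c))

  infixl 6 _-ₚ_
  _-ₚ_ : 𝔽 → 𝔽 → 𝔽
  a -ₚ b = a +ₚ -ₚ b

  -ₚ-solve : ∀ a b c → a +ₚ b ≡ c → b ≡ c -ₚ a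
  -ₚ-solve a b c refl = sym (trans (cong (_+ₚ -ₚ a) (+ₚ-comm a b)) (trans (+ₚ-assoc b a _) (trans (cong (b +ₚ_) (-ₚ-inverseʳ a)) (+-idʳ b))))

  -ₚ-cancel : ∀ a c → a +ₚ (c -ₚ a) ≡ c
  -ₚ-cancel a c = trans (+ₚ-swap a c (-ₚ a)) (trans (cong (c +ₚ_) (-ₚ-inverseʳ a)) (+-idʳ c))

  -ₚ≡0 : ∀ {a b} → a -ₚ b ≡ 0# → a ≡ b
  -ₚ≡0 {a} {b} eq = +ₚ-cancelʳ (-ₚ b) a b (trans eq (sym (-ₚ-inverseʳ b)))

  toℕ-nonzero : ∀ {a} → a ≢ 0# → 0 < toℕ a
  toℕ-nonzero a≢0 = n≢0⇒n>0 (λ eq → a≢0 (Fin.toℕ-injective (trans eq (sym toℕ-0#))))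

  0#<nonzero : ∀ {a} → a ≢ 0# → 0# Fin.< a
  0#<nonzero {a} a≢0 = subst (_< toℕ a) (sym toℕ-0#) (toℕ-nonzero a≢0)

  1#<other : ∀ {a} → a ≢ 0# → a ≢ 1# → 1# Fin.< a
  1#<other {a} a≢0 a≢1 = subst (_< toℕ a) (sym toℕ-1#)
    (≤∧≢⇒< (toℕ-nonzero a≢0) (λ eq → a≢1 (Fin.toℕ-injective (trans (sym eq) (sym toℕ-1#)))))

  -- Vectors and linear forms

  V : ℕ → Set
  V = Vec 𝔽

  _≟ᵛ_ : ∀ {j} (u v : V j) → Dec (u ≡ v)
  _≟ᵛ_ = Vec.≡-dec Fin._≟_

  0ᵛ : ∀ {j} → V j
  0ᵛ = Vec.replicate _ 0#

  infixl 6 _+ᵛ_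
  infixr 7 _•_
  _+ᵛ_ : ∀ {j} → V j → V j → V j
  _+ᵛ_ = Vec.zipWith _+ₚ_

  _•_ : ∀ {j} → 𝔽 → V j → V j
  x • u = Vec.map (x *ₚ_) u

  dot : ∀ {j} → V j → V j → 𝔽
  dot []      []      = 0#
  dot (x ∷ a) (y ∷ u) = x *ₚ y +ₚ dot a u

  dot-comm : ∀ {j} (a u : V j) → dot a u ≡ dot u a
  dot-comm []      []      = refl
  dot-comm (x ∷ a) (y ∷ u) = cong₂ _+ₚ_ (*ₚ-comm x y) (dot-comm a u)

  dot-zeroˡ : ∀ {j} (u : V j) → dot 0ᵛ u ≡ 0#
  dot-zeroˡ []      = refl
  dot-zeroˡ (y ∷ u) = trans (cong₂ _+ₚ_ (*-zeroˡₚ y) (dot-zeroˡ u)) (+-idˡ 0#)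

  dot-zeroʳ : ∀ {j} (a : V j) → dot a 0ᵛ ≡ 0#
  dot-zeroʳ a = trans (dot-comm a 0ᵛ) (dot-zeroˡ a)

  dot-+ˡ : ∀ {j} (a b u : V j) → dot (a +ᵛ b) u ≡ dot a u +ₚ dot b u
  dot-+ˡ []      []      []      = sym (+-idˡ 0#)
  dot-+ˡ (x ∷ a) (y ∷ b) (z ∷ u) =
    trans (cong₂ _+ₚ_ (*ₚ-distribʳ z x y) (dot-+ˡ a b u)) (+ₚ-interchange (x *ₚ z) (y *ₚ z) (dot a u) (dot b u))

  dot-•ˡ : ∀ {j} x (a u : V j) → dot (x • a) u ≡ x *ₚ dot a u
  dot-•ˡ x []      []      = sym (*-zeroʳₚ x)
  dot-•ˡ x (y ∷ a) (z ∷ u) =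
    trans (cong₂ _+ₚ_ (*ₚ-assoc x y z) (dot-•ˡ x a u)) (sym (*ₚ-distribˡ x _ _))

  dot-+ʳ : ∀ {j} (a u v : V j) → dot a (u +ᵛ v) ≡ dot a u +ₚ dot a v
  dot-+ʳ a u v = trans (dot-comm a _) (trans (dot-+ˡ u v a) (cong₂ _+ₚ_ (dot-comm u a) (dot-comm v a)))

  dot-•ʳ : ∀ {j} x (a u : V j) → dot a (x • u) ≡ x *ₚ dot a u
  dot-•ʳ x a u = trans (dot-comm a _) (trans (dot-•ˡ x u a) (cong (x *ₚ_) (dot-comm u a)))

  dot-insertAt : ∀ {j} (b : V j) s t u → dot (insertAt b s t) u ≡ t *ₚ Vec.lookup u s +ₚ dot b (removeAt u s)
  dot-insertAt b       zero    t (y ∷ u)       = refl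
  dot-insertAt (x ∷ b) (suc s) t (y ∷ z ∷ u)   =
    trans (cong (x *ₚ y +ₚ_) (dot-insertAt b s t (z ∷ u))) (+ₚ-swap _ _ _)

  1•_ : ∀ {j} (u : V j) → 1# • u ≡ u
  1• []      = refl
  1• (y ∷ u) = cong₂ _∷_ (*-idˡ y) (1• u)

  0•_ : ∀ {j} (u : V j) → 0# • u ≡ 0ᵛ
  0• []      = refl
  0• (y ∷ u) = cong₂ _∷_ (*-zeroˡₚ y) (0• u)

  •-0ᵛ : ∀ {j} x → x • 0ᵛ {j} ≡ 0ᵛ
  •-0ᵛ {zero}  x = refl
  •-0ᵛ {suc j} x = cong₂ _∷_ (*-zeroʳₚ x) (•-0ᵛ x)

  •-assoc : ∀ {j} x y (u : V j) → x • (y • u) ≡ (x *ₚ y) • u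
  •-assoc x y []      = refl
  •-assoc x y (z ∷ u) = cong₂ _∷_ (sym (*ₚ-assoc x y z)) (•-assoc x y u)

  +ᵛ-zero : ∀ {j} x (u v : V j) → u +ᵛ (-ₚ x) • v ≡ 0ᵛ → u ≡ x • v
  +ᵛ-zero x []      []      _  = refl
  +ᵛ-zero x (y ∷ u) (z ∷ v) eq = cong₂ _∷_
    (-ₚ≡0 (trans (cong (y +ₚ_) (-‿distribˡ-* x z)) (Vec.∷-injectiveˡ eq)))
    (+ᵛ-zero x u v (Vec.∷-injectiveʳ eq))

  zero-+ᵛ : ∀ {j} x (v : V j) → x • v +ᵛ (-ₚ x) • v ≡ 0ᵛ
  zero-+ᵛ x []      = refl
  zero-+ᵛ x (z ∷ v) = cong₂ _∷_ (trans (cong (x *ₚ z +ₚ_) (sym (-‿distribˡ-* x z))) (-ₚ-inverseʳ _)) (zero-+ᵛ x v)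

  lookup-0ᵛ : ∀ {j} (s : Fin j) → Vec.lookup 0ᵛ s ≡ 0#
  lookup-0ᵛ s = Vec.lookup-replicate s 0#

  removeAt-• : ∀ {j} x (u : V (suc j)) s → removeAt (x • u) s ≡ x • removeAt u s
  removeAt-• x (y ∷ u)     zero    = refl
  removeAt-• x (y ∷ z ∷ u) (suc s) = cong (x *ₚ y ∷_) (removeAt-• x (z ∷ u) s)

  insertAt-0ᵛ : ∀ {j} (s : Fin (suc j)) → insertAt 0ᵛ s 0# ≡ 0ᵛ
  insertAt-0ᵛ         zero    = refl
  insertAt-0ᵛ {suc j} (suc s) = cong (0# ∷_) (insertAt-0ᵛ s)

  insertAt≡0ᵛ : ∀ {j} (b : V j) s t → insertAt b s t ≡ 0ᵛ → b ≡ 0ᵛ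
  insertAt≡0ᵛ b       zero    t eq = Vec.∷-injectiveʳ eq
  insertAt≡0ᵛ (x ∷ b) (suc s) t eq = cong₂ _∷_ (Vec.∷-injectiveˡ eq) (insertAt≡0ᵛ b s t (Vec.∷-injectiveʳ eq))

  -- Counting words by the value of a linear form

  vectors : ∀ j → List (V j)
  vectors zero    = [] ∷ []
  vectors (suc j) = cartesianProductWith _∷_ (allFin p) (vectors j)

  ∈-vectors : ∀ {j} (u : V j) → u ∈ vectors j
  ∈-vectors []      = here refl
  ∈-vectors (x ∷ u) = ∈-cartesianProductWith⁺ _∷_ (∈-allFin x) (∈-vectors u)

  sum-vectors-suc : ∀ {j} (f : V (suc j) → ℕ) →
    sumOver (vectors (suc j)) f ≡ sumOver (allFin p) (λ x → sumOver (vectors j) (λ a → f (x ∷ a)))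
  sum-vectors-suc {j} f = sum-cartesianProductWith _∷_ (allFin p) (vectors j) f

  length-vectors : ∀ j → length (vectors j) ≡ p ^ j
  length-vectors zero    = refl
  length-vectors (suc j) = begin
    length (vectors (suc j))                                     ≡⟨ length-sum (vectors (suc j)) ⟩
    sumOver (vectors (suc j)) (λ _ → 1)                          ≡⟨ sum-vectors-suc {j} (λ _ → 1) ⟩
    sumOver (allFin p) (λ _ → sumOver (vectors j) (λ _ → 1))     ≡⟨ sum-const (allFin p) _ ⟩
    length (allFin p) * sumOver (vectors j) (λ _ → 1)            ≡⟨ cong₂ _*_ (length-allFin p) (trans (sym (length-sum (vectors j))) (length-vectors j)) ⟩
    p ^ suc j                                                    ∎
    where open ≡-Reasoning

  sum-scalars-≢ : ∀ y → sumOver (allFin p) (λ c → ⟦ ¬? (y ≟ₚ c) ⟧) ≡ p ∸ 1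
  sum-scalars-≢ y = begin
    S                     ≡⟨ sym (m+n∸n≡m S 1) ⟩
    S + 1 ∸ 1             ≡⟨ cong (λ t → S + t ∸ 1) (sym (sum-δ-1 _≟ₚ_ (allFin⁺ p) (∈-allFin y))) ⟩
    S + T ∸ 1             ≡⟨ cong (_∸ 1) (sym (sum-+ (allFin p))) ⟩
    sumOver (allFin p) (λ c → ⟦ ¬? (y ≟ₚ c) ⟧ + ⟦ y ≟ₚ c ⟧) ∸ 1
                          ≡⟨ cong (_∸ 1) (sum-cong (allFin p) (λ c → ⟦⟧-¬ (y ≟ₚ c))) ⟩
    sumOver (allFin p) (λ c → 1) ∸ 1
                          ≡⟨ cong (_∸ 1) (trans (sym (length-sum (allFin p))) (length-allFin p)) ⟩
    p ∸ 1                 ∎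
    where
    open ≡-Reasoning
    S = sumOver (allFin p) (λ c → ⟦ ¬? (y ≟ₚ c) ⟧)
    T = sumOver (allFin p) (λ c → ⟦ y ≟ₚ c ⟧)

  sum-multiples-≢ : ∀ {x} y → x ≢ 0# → sumOver (allFin p) (λ c → ⟦ ¬? (y ≟ₚ c *ₚ x) ⟧) ≡ p ∸ 1
  sum-multiples-≢ {x} y x≢0 with r , rx ← inverse x≢0 = trans
    (sum-cong (allFin p) (λ c → ⟦⟧-cong (¬? (y ≟ₚ c *ₚ x)) (¬? (y *ₚ r ≟ₚ c))
      (λ ne eq → ne (trans (sym (rcancel y)) (cong (_*ₚ x) eq)))
      (λ ne eq → ne (*ₚ-cancelʳ x≢0 (trans (rcancel y) eq)))))
    (sum-scalars-≢ (y *ₚ r))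
    where
    rcancel : ∀ y → (y *ₚ r) *ₚ x ≡ y
    rcancel y = trans (*ₚ-assoc y r x) (trans (cong (y *ₚ_) rx) (*-idʳ y))

  -- A nonzero linear form takes every value equally often; what is used later is that the count
  -- does not depend on `y`. The factor `p` avoids writing `p ^ (j - 1)`. With the first coefficient
  -- fixed, the tail of `u` gives the same problem for a shifted `y`, unless that tail is zero and
  -- only the first coefficient matters.
  linear-form-≢ : ∀ {j} {u : V j} → u ≢ 0ᵛ → ∀ y →
    p * sumOver (vectors j) (λ a → ⟦ ¬? (y ≟ₚ dot a u) ⟧) ≡ (p ∸ 1) * p ^ j
  linear-form-≢ {zero}  {[]}    u≢0 y = contradiction refl u≢0
  linear-form-≢ {suc j} {x ∷ u} u≢0 y = by (u ≟ᵛ 0ᵛ)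
    where
    open ≡-Reasoning
    by : Dec (u ≡ 0ᵛ) → p * sumOver (vectors (suc j)) (λ a → ⟦ ¬? (y ≟ₚ dot a (x ∷ u)) ⟧) ≡ (p ∸ 1) * p ^ suc j
    by (yes refl) = begin
      p * sumOver (vectors (suc j)) (λ a → ⟦ ¬? (y ≟ₚ dot a (x ∷ u)) ⟧)
        ≡⟨ cong (p *_) (sum-vectors-suc {j} _) ⟩
      p * sumOver (allFin p) (λ c → sumOver (vectors j) (λ a → ⟦ ¬? (y ≟ₚ c *ₚ x +ₚ dot a u) ⟧))
        ≡⟨ cong (p *_) (sum-cong (allFin p) (λ c → trans
             (sum-cong (vectors j) (λ a → cong (λ t → ⟦ ¬? (y ≟ₚ t) ⟧)
               (trans (cong (c *ₚ x +ₚ_) (dot-zeroʳ a)) (+-idʳ _))))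
             (trans (sum-const (vectors j) _) (cong (_* _) (length-vectors j))))) ⟩
      p * sumOver (allFin p) (λ c → p ^ j * ⟦ ¬? (y ≟ₚ c *ₚ x) ⟧)
        ≡⟨ cong (p *_) (trans (sum-*ˡ (allFin p) (p ^ j)) (cong (p ^ j *_) (sum-multiples-≢ y (λ { refl → u≢0 refl })))) ⟩
      p * (p ^ j * (p ∸ 1))   ≡⟨ sym (*-assoc p (p ^ j) _) ⟩
      p ^ suc j * (p ∸ 1)     ≡⟨ *-comm (p ^ suc j) _ ⟩
      (p ∸ 1) * p ^ suc j ∎
    by (no u≢0′) = begin
      p * sumOver (vectors (suc j)) (λ a → ⟦ ¬? (y ≟ₚ dot a (x ∷ u)) ⟧)
        ≡⟨ cong (p *_) (sum-vectors-suc {j} _) ⟩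
      p * sumOver (allFin p) (λ c → sumOver (vectors j) (λ a → ⟦ ¬? (y ≟ₚ c *ₚ x +ₚ dot a u) ⟧))
        ≡⟨ sym (sum-*ˡ (allFin p) p) ⟩
      sumOver (allFin p) (λ c → p * sumOver (vectors j) (λ a → ⟦ ¬? (y ≟ₚ c *ₚ x +ₚ dot a u) ⟧))
        ≡⟨ sum-cong (allFin p) (λ c → trans (cong (p *_) (sum-cong (vectors j) (λ a →
             ⟦⟧-cong (¬? (y ≟ₚ c *ₚ x +ₚ dot a u)) (¬? (y -ₚ c *ₚ x ≟ₚ dot a u))
               (λ ne eq → ne (sym (trans (cong (c *ₚ x +ₚ_) (sym eq)) (-ₚ-cancel (c *ₚ x) y))))
               (λ ne eq → ne (sym (-ₚ-solve (c *ₚ x) (dot a u) y (sym eq)))))))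
             (linear-form-≢ u≢0′ (y -ₚ c *ₚ x))) ⟩
      sumOver (allFin p) (λ c → (p ∸ 1) * p ^ j)
        ≡⟨ trans (sum-const (allFin p) _) (cong (_* ((p ∸ 1) * p ^ j)) (length-allFin p)) ⟩
      p * ((p ∸ 1) * p ^ j)   ≡⟨ ℕ*.x∙yz≈y∙xz p (p ∸ 1) (p ^ j) ⟩
      (p ∸ 1) * p ^ suc j ∎

  -- Normalised vectors as points of the projective space

  -- Columns list the generators latest first, so it is the last nonzero entry,
  -- that of the earliest generator, which is required to be 1.
  Normalised : ∀ {j} → V j → Set
  Normalised []      = ⊥
  Normalised (x ∷ u) = Normalised u ⊎ (u ≡ 0ᵛ × x ≡ 1#)

  Normalised≢0 : ∀ {j} {u : V j} → Normalised u → u ≢ 0ᵛ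
  Normalised≢0 {u = x ∷ u} (inj₁ nu)         eq = Normalised≢0 nu (Vec.∷-injectiveʳ eq)
  Normalised≢0 {u = x ∷ u} (inj₂ (_ , refl)) eq = 1≢0 (Vec.∷-injectiveˡ eq)

  •≡0ᵛ : ∀ {j} x {u : V j} → x ≢ 0# → x • u ≡ 0ᵛ → u ≡ 0ᵛ
  •≡0ᵛ x {u} x≢0 eq with r , rx ← inverse x≢0 = begin
    u              ≡⟨ sym (1• u) ⟩
    1# • u         ≡⟨ cong (_• u) (sym rx) ⟩
    (r *ₚ x) • u   ≡⟨ sym (•-assoc r x u) ⟩
    r • (x • u)    ≡⟨ cong (r •_) eq ⟩
    r • 0ᵛ         ≡⟨ •-0ᵛ r ⟩
    0ᵛ             ∎
    where open ≡-Reasoning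

  -- Scaling by a nonzero scalar keeps the place of the last nonzero entry and turns its value 1
  -- into `x`. Hence a line contains at most one normalised vector.
  Normalised-multiple : ∀ {j} x {u : V j} → Normalised u → Normalised (x • u) → x ≡ 1#
  Normalised-multiple x {y ∷ u} (inj₁ nu) (inj₁ nxu) = Normalised-multiple x nu nxu
  Normalised-multiple x {y ∷ u} (inj₁ nu) (inj₂ (xu≡0 , xy≡1)) = contradiction
    (•≡0ᵛ x (λ { refl → 1≢0 (trans (sym xy≡1) (*-zeroˡₚ y)) }) xu≡0) (Normalised≢0 nu)
  Normalised-multiple x {y ∷ u} (inj₂ (refl , _)) (inj₁ nxu) = contradiction (•-0ᵛ x) (Normalised≢0 nxu)
  Normalised-multiple x {y ∷ u} (inj₂ (_ , refl)) (inj₂ (_ , x1≡1)) = trans (sym (*-idʳ x)) x1≡1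

  unit-entry : ∀ {j} {u : V j} → Normalised u → ∃[ s ] Vec.lookup u s ≡ 1#
  unit-entry {u = x ∷ u} (inj₁ nu) with s , eq ← unit-entry nu = suc s , eq
  unit-entry {u = x ∷ u} (inj₂ (_ , eq)) = zero , eq

  normalise : ∀ {j} {u : V j} → u ≢ 0ᵛ → ∃[ x ] x ≢ 0# × Normalised (x • u)
  normalise {u = []}    u≢0 = contradiction refl u≢0
  normalise {u = y ∷ u} u≢0 with u ≟ᵛ 0ᵛ
  ... | no u≢0′ with x , x≢0 , n ← normalise u≢0′ = x , x≢0 , inj₁ n
  ... | yes refl with r , ry ← inverse {y} (λ { refl → u≢0 refl }) =
    r , (λ { refl → 1≢0 (trans (sym ry) (*-zeroˡₚ y)) }) , inj₂ (•-0ᵛ r , ry)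

  -- The points of the projective space, each given by the normalised vector on its line: either the
  -- first unit vector or an arbitrary entry in front of a shorter normalised vector.
  points : ∀ j → List (V j)
  points zero    = []
  points (suc j) = (1# ∷ 0ᵛ) ∷ cartesianProductWith _∷_ (allFin p) (points j)

  ∈-points⁺ : ∀ {j} {u : V j} → Normalised u → u ∈ points j
  ∈-points⁺ {u = x ∷ u} (inj₁ nu)           = there (∈-cartesianProductWith⁺ _∷_ (∈-allFin x) (∈-points⁺ nu))
  ∈-points⁺ {u = x ∷ u} (inj₂ (refl , refl)) = here refl

  ∈-points⁻ : ∀ {j} {u : V j} → u ∈ points j → Normalised u
  ∈-points⁻ {suc j} (here refl) = inj₂ (refl , refl)
  ∈-points⁻ {suc j} (there u∈) with _ , _ , _ , v∈ , refl ← ∈-cartesianProductWith⁻ _∷_ (allFin p) (points j) u∈ =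
    inj₁ (∈-points⁻ v∈)

  points-unique : ∀ j → Unique (points j)
  points-unique zero    = []
  points-unique (suc j) =
    All.tabulate (λ u∈ → λ { refl → new u∈ })
    ∷ cartesianProductWith⁺ _∷_ (λ eq → Vec.∷-injectiveˡ eq , Vec.∷-injectiveʳ eq) (allFin⁺ p) (points-unique j)
    where
    new : ¬ ((1# ∷ 0ᵛ) ∈ cartesianProductWith _∷_ (allFin p) (points j))
    new u∈ with _ , _ , _ , v∈ , eq ← ∈-cartesianProductWith⁻ _∷_ (allFin p) (points j) u∈ =
      Normalised≢0 (∈-points⁻ v∈) (sym (Vec.∷-injectiveʳ eq))

  p≡1+[p∸1] : p ≡ suc (p ∸ 1)
  p≡1+[p∸1] = sym (m+[n∸m]≡n (<⇒≤ p>1))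

  length-points : ∀ j → length (points j) * (p ∸ 1) + 1 ≡ p ^ j
  length-points zero    = refl
  length-points (suc j) = begin
    suc (length (cartesianProductWith _∷_ (allFin p) (points j))) * r + 1  ≡⟨ cong (λ t → suc t * r + 1) len ⟩
    suc (p * L) * r + 1            ≡⟨ cong (λ t → suc (t * L) * r + 1) p≡1+[p∸1] ⟩
    suc (suc r * L) * r + 1        ≡⟨ arith r L ⟩
    suc r * (L * r + 1)            ≡⟨ cong₂ _*_ (sym p≡1+[p∸1]) (length-points j) ⟩
    p ^ suc j                      ∎
    where
    open ≡-Reasoning
    r = p ∸ 1
    L = length (points j)
    arith : ∀ r L → suc (suc r * L) * r + 1 ≡ suc r * (L * r + 1)
    arith = solve-∀
    len : length (cartesianProductWith _∷_ (allFin p) (points j)) ≡ p * L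
    len = trans (length-sum (cartesianProductWith _∷_ (allFin p) (points j)))
          (trans (sum-cartesianProductWith _∷_ (allFin p) (points j) _)
          (trans (sum-const (allFin p) _) (cong₂ _*_ (length-allFin p) (sym (length-sum (points j))))))

  -- Weights of words and codes of constant weight

  weight : ∀ {I : Set} {j} → List I → (I → V j) → V j → ℕ
  weight xs col a = sumOver xs (λ i → ⟦ ¬? (0# ≟ₚ dot a (col i)) ⟧)

  weight-0ᵛ : ∀ {I : Set} {j} (xs : List I) (col : I → V j) → weight xs col 0ᵛ ≡ 0
  weight-0ᵛ xs col = sum-zero xs (λ i _ → ⟦⟧-no (¬? (0# ≟ₚ _)) (λ ne → ne (sym (dot-zeroˡ (col i)))))

  -- After exchanging the sums, a zero column contributes nothing and a nonzero one acts as a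
  -- nonzero linear form on the words.
  total-weight : ∀ {I : Set} {j} (xs : List I) (col : I → V j) →
    p * sumOver (vectors j) (weight xs col) ≡ ((p ∸ 1) * p ^ j) * sumOver xs (λ i → ⟦ ¬? (col i ≟ᵛ 0ᵛ) ⟧)
  total-weight {j = j} xs col = begin
    p * sumOver (vectors j) (weight xs col)
      ≡⟨ cong (p *_) (sum-comm (vectors j) xs) ⟩
    p * sumOver xs (λ i → sumOver (vectors j) (λ a → ⟦ ¬? (0# ≟ₚ dot a (col i)) ⟧))
      ≡⟨ sym (sum-*ˡ xs p) ⟩
    sumOver xs (λ i → p * sumOver (vectors j) (λ a → ⟦ ¬? (0# ≟ₚ dot a (col i)) ⟧))
      ≡⟨ sum-cong xs (λ i → by (col i) (col i ≟ᵛ 0ᵛ)) ⟩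
    sumOver xs (λ i → ((p ∸ 1) * p ^ j) * ⟦ ¬? (col i ≟ᵛ 0ᵛ) ⟧)
      ≡⟨ sum-*ˡ xs ((p ∸ 1) * p ^ j) ⟩
    ((p ∸ 1) * p ^ j) * sumOver xs (λ i → ⟦ ¬? (col i ≟ᵛ 0ᵛ) ⟧) ∎
    where
    open ≡-Reasoning
    by : ∀ u (q : Dec (u ≡ 0ᵛ)) → p * sumOver (vectors j) (λ a → ⟦ ¬? (0# ≟ₚ dot a u) ⟧)
         ≡ ((p ∸ 1) * p ^ j) * ⟦ ¬? q ⟧
    by u (yes refl) = trans (cong (p *_) (sum-zero (vectors j) (λ a _ → ⟦⟧-no (¬? (0# ≟ₚ _)) (λ ne → ne (sym (dot-zeroʳ a))))))
                      (trans (*-zeroʳ p) (sym (*-zeroʳ ((p ∸ 1) * p ^ j))))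
    by u (no u≢0) = trans (linear-form-≢ u≢0 0#) (sym (*-identityʳ _))

  -- The extra `d` on the left stands in for the zero word, which keeps the identity free of
  -- subtraction.
  sum-constant-off-0 : ∀ {j} (f : V j → ℕ) d → f 0ᵛ ≡ 0 → (∀ a → a ≢ 0ᵛ → f a ≡ d) →
    sumOver (vectors j) f + d ≡ p ^ j * d
  sum-constant-off-0 {j} f d f0 fd = begin
    sumOver (vectors j) f + d
      ≡⟨ cong (sumOver (vectors j) f +_) (sym (sum-δ _≟ᵛ_ (vectors-unique j) (∈-vectors 0ᵛ) (λ _ → d))) ⟩
    sumOver (vectors j) f + sumOver (vectors j) (λ a → ⟦ 0ᵛ ≟ᵛ a ⟧ * d)
      ≡⟨ sym (sum-+ (vectors j)) ⟩
    sumOver (vectors j) (λ a → f a + ⟦ 0ᵛ ≟ᵛ a ⟧ * d)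
      ≡⟨ sum-cong (vectors j) (λ a → by a (0ᵛ ≟ᵛ a)) ⟩
    sumOver (vectors j) (λ a → d)
      ≡⟨ trans (sum-const (vectors j) d) (cong (_* d) (length-vectors j)) ⟩
    p ^ j * d ∎
    where
    open ≡-Reasoning
    vectors-unique : ∀ j → Unique (vectors j)
    vectors-unique zero    = All.[] ∷ []
    vectors-unique (suc j) = cartesianProductWith⁺ _∷_ (λ eq → Vec.∷-injectiveˡ eq , Vec.∷-injectiveʳ eq)
                               (allFin⁺ p) (vectors-unique j)
    by : ∀ a (q : Dec (0ᵛ ≡ a)) → f a + ⟦ q ⟧ * d ≡ d
    by a (yes refl) = trans (cong (_+ (d + 0)) f0) (+-identityʳ d)
    by a (no 0≢a)   = trans (+-identityʳ _) (fd a (0≢a ∘ sym))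

  -- Subtracting from the total weight of all words that of the words orthogonal to v
  -- leaves only the columns on the line through v.
  module Bonisoli {I : Set} {j : ℕ} (xs : List I) (col : I → V (suc j)) (d : ℕ)
    (normalised : ∀ i → col i ≡ 0ᵛ ⊎ Normalised (col i))
    (constant-weight : ∀ a → a ≢ 0ᵛ → weight xs col a ≡ d)
    {v : V (suc j)} (nv : Normalised v) where

    private
      s = proj₁ (unit-entry nv)
      v′ = removeAt v s
      -- Projection from `v`, whose entry at `s` is 1: subtract the multiple of `v` that clears this
      -- entry, then drop the entry. The kernel is the line through `v`.
      T : V (suc j) → V j
      T u = removeAt u s +ᵛ (-ₚ Vec.lookup u s) • v′

      -- As `v` has entry 1 at `s`, a word orthogonal to `v` is free in its other entries and
      -- determined by them at `s`.
      orthogonal : V j → V (suc j)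
      orthogonal b = insertAt b s (-ₚ dot b v′)

      -- `T` is the transpose of `orthogonal`: the words orthogonal to `v` form a code with columns
      -- `T ∘ col`, to which `total-weight` applies again.
      dot-orthogonal : ∀ b u → dot (orthogonal b) u ≡ dot b (T u)
      dot-orthogonal b u = begin
        dot (orthogonal b) u                             ≡⟨ dot-insertAt b s (-ₚ dot b v′) u ⟩
        -ₚ dot b v′ *ₚ uₛ +ₚ dot b u′                    ≡⟨ +ₚ-comm (-ₚ dot b v′ *ₚ uₛ) (dot b u′) ⟩
        dot b u′ +ₚ -ₚ dot b v′ *ₚ uₛ                    ≡⟨ cong (dot b u′ +ₚ_) (trans (sym (-‿distribˡ-* (dot b v′) uₛ))
                                                              (trans (cong -ₚ_ (*ₚ-comm (dot b v′) uₛ)) (-‿distribˡ-* uₛ (dot b v′)))) ⟩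
        dot b u′ +ₚ (-ₚ uₛ) *ₚ dot b v′                  ≡⟨ cong (dot b u′ +ₚ_) (sym (dot-•ʳ (-ₚ uₛ) b v′)) ⟩
        dot b u′ +ₚ dot b ((-ₚ uₛ) • v′)                 ≡⟨ sym (dot-+ʳ b u′ _) ⟩
        dot b (T u)                                      ∎
        where
        open ≡-Reasoning
        uₛ = Vec.lookup u s
        u′ = removeAt u s

      insertAt-• : ∀ {j} x (w : V j) s t → insertAt (x • w) s (x *ₚ t) ≡ x • insertAt w s t
      insertAt-• x w       zero    t = refl
      insertAt-• x (y ∷ w) (suc s) t = cong (x *ₚ y ∷_) (insertAt-• x w s t)

      T≡0⇒multiple : ∀ u → T u ≡ 0ᵛ → u ≡ Vec.lookup u s • v
      T≡0⇒multiple u eq = begin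
        u                                  ≡⟨ sym (Vec.insertAt-removeAt u s) ⟩
        insertAt (removeAt u s) s uₛ       ≡⟨ cong₂ (λ w t → insertAt w s t) (+ᵛ-zero uₛ (removeAt u s) v′ eq) (sym (*-idʳ uₛ)) ⟩
        insertAt (uₛ • v′) s (uₛ *ₚ 1#)    ≡⟨ insertAt-• uₛ v′ s 1# ⟩
        uₛ • insertAt v′ s 1#              ≡⟨ cong (λ t → uₛ • insertAt v′ s t) (sym (proj₂ (unit-entry nv))) ⟩
        uₛ • insertAt v′ s (Vec.lookup v s) ≡⟨ cong (uₛ •_) (Vec.insertAt-removeAt v s) ⟩
        uₛ • v                             ∎
        where
        open ≡-Reasoning
        uₛ = Vec.lookup u s

      T-multiple : ∀ x → T (x • v) ≡ 0ᵛ
      T-multiple x = trans (cong₂ (λ w t → w +ᵛ (-ₚ t) • v′) (removeAt-• x v s)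
        (trans (Vec.lookup-map s (x *ₚ_) v) (trans (cong (x *ₚ_) (proj₂ (unit-entry nv))) (*-idʳ x)))) (zero-+ᵛ x v′)

      n  = sumOver xs (λ i → ⟦ ¬? (col i ≟ᵛ 0ᵛ) ⟧)
      n′ = sumOver xs (λ i → ⟦ ¬? (T (col i) ≟ᵛ 0ᵛ) ⟧)
      μ  = sumOver xs (λ i → ⟦ col i ≟ᵛ v ⟧)

      -- A normalised column on the line through `v` is `v` itself, so `T` kills only the zero
      -- columns and the copies of `v`.
      split : ∀ u → u ≡ 0ᵛ ⊎ Normalised u → ⟦ ¬? (u ≟ᵛ 0ᵛ) ⟧ ≡ ⟦ ¬? (T u ≟ᵛ 0ᵛ) ⟧ + ⟦ u ≟ᵛ v ⟧
      split u (inj₁ refl) = trans (⟦⟧-no (¬? (u ≟ᵛ 0ᵛ)) (λ ne → ne refl)) (sym (cong₂ _+_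
        (⟦⟧-no (¬? (T u ≟ᵛ 0ᵛ)) (λ ne → ne (trans (cong T (sym (0• v))) (T-multiple 0#))))
        (⟦⟧-no (u ≟ᵛ v) (Normalised≢0 nv ∘ sym))))
      split u (inj₂ nu) = trans (⟦⟧-yes (¬? (u ≟ᵛ 0ᵛ)) (Normalised≢0 nu)) (sym (by (u ≟ᵛ v)))
        where
        by : (q : Dec (u ≡ v)) → ⟦ ¬? (T u ≟ᵛ 0ᵛ) ⟧ + ⟦ q ⟧ ≡ 1
        by (yes refl) = cong (_+ 1) (⟦⟧-no (¬? (T u ≟ᵛ 0ᵛ)) (λ ne → ne (trans (cong T (sym (1• v))) (T-multiple 1#))))
        by (no u≢v) = cong (_+ 0) (⟦⟧-yes (¬? (T u ≟ᵛ 0ᵛ)) λ eq →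
          let u≡ = T≡0⇒multiple u eq in
          u≢v (trans u≡ (trans (cong (_• v) (Normalised-multiple (Vec.lookup u s) nv (subst Normalised u≡ nu))) (1• v))))

      n≡n′+μ : n ≡ n′ + μ
      n≡n′+μ = trans (sum-cong xs (λ i → split (col i) (normalised i))) (sum-+ xs)

      r = p ∸ 1
      q = p ^ j
      Sₐ = sumOver (vectors (suc j)) (weight xs col)
      Sᵦ = sumOver (vectors j) (weight xs (T ∘ col))

      all-words : p * Sₐ ≡ (r * (p * q)) * n
      all-words = total-weight xs col

      orthogonal-words : p * Sᵦ ≡ (r * q) * n′
      orthogonal-words = total-weight xs (T ∘ col)

      Sₐ+d : Sₐ + d ≡ (p * q) * d
      Sₐ+d = sum-constant-off-0 (weight xs col) d (weight-0ᵛ xs col) constant-weight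

      Sᵦ+d : Sᵦ + d ≡ q * d
      Sᵦ+d = sum-constant-off-0 (weight xs (T ∘ col)) d (weight-0ᵛ xs (T ∘ col)) λ b b≢0 → trans
        (sum-cong xs (λ i → cong (λ t → ⟦ ¬? (0# ≟ₚ t) ⟧) (sym (dot-orthogonal b (col i)))))
        (constant-weight (orthogonal b) (b≢0 ∘ insertAt≡0ᵛ b s (-ₚ dot b v′)))

      -- With `r = p - 1`, the identities for all words give `r q n + d = p q d`, and `p` times
      -- those for the orthogonal words give `r q n′ + p d = p q d`. Their difference is
      -- `r q μ = r d`.
      cancel : ∀ r .{{_ : NonZero r}} p q n n′ μ d Sₐ Sᵦ → .{{_ : NonZero p}} → p ≡ suc r → n ≡ n′ + μ →
        p * Sₐ ≡ (r * (p * q)) * n → p * Sᵦ ≡ (r * q) * n′ → Sₐ + d ≡ (p * q) * d → Sᵦ + d ≡ q * d → q * μ ≡ d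
      cancel r p q n n′ μ d Sₐ Sᵦ p≡ refl e₁ e₂ e₃ e₄ = *-cancelˡ-≡ _ _ r (+-cancelʳ-≡ (r * q * n′ + d) _ _ (begin
        r * (q * μ) + (r * q * n′ + d)    ≡⟨ a₁ r q μ n′ d ⟩
        r * q * (n′ + μ) + d              ≡⟨ cong (_+ d) (sym Sₐ≡) ⟩
        Sₐ + d                            ≡⟨ e₃ ⟩
        p * q * d                         ≡⟨ *-assoc p q d ⟩
        p * (q * d)                       ≡⟨ cong (p *_) (sym e₄) ⟩
        p * (Sᵦ + d)                      ≡⟨ *-distribˡ-+ p Sᵦ d ⟩
        p * Sᵦ + p * d                    ≡⟨ cong₂ _+_ e₂ (cong (_* d) p≡) ⟩
        r * q * n′ + (d + r * d)          ≡⟨ a₂ (r * q * n′) d (r * d) ⟩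
        r * d + (r * q * n′ + d)          ∎))
        where
        open ≡-Reasoning
        a₁ : ∀ r q μ n′ d → r * (q * μ) + (r * q * n′ + d) ≡ r * q * (n′ + μ) + d
        a₁ = solve-∀
        a₂ : ∀ x d y → x + (d + y) ≡ y + (x + d)
        a₂ = solve-∀
        a₃ : ∀ r p q n → (r * (p * q)) * n ≡ p * (r * q * n)
        a₃ = solve-∀
        Sₐ≡ : Sₐ ≡ r * q * (n′ + μ)
        Sₐ≡ = *-cancelˡ-≡ _ _ p (trans e₁ (a₃ r p q (n′ + μ)))

    multiplicity : p ^ j * sumOver xs (λ i → ⟦ col i ≟ᵛ v ⟧) ≡ d
    multiplicity = cancel r {{≢-nonZero (λ r≡0 → <-irrefl (sym (trans p≡1+[p∸1] (cong suc r≡0))) p>1)}} p q n n′ μ d Sₐ Sᵦ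
      p≡1+[p∸1] n≡n′+μ all-words orthogonal-words Sₐ+d Sᵦ+d

  -- Coordinates, the order, and the invariant of the construction

  -- For E the two exceptional positions play no role and are arbitrary.
  exc₁ exc₂ : 𝓕 → ℕ
  exc₁ E         = 0
  exc₁ (F ξ η _) = ξ
  exc₂ E         = 1
  exc₂ (F ξ η _) = η

  exc₁≢exc₂ : ∀ B → exc₁ B ≢ exc₂ B
  exc₁≢exc₂ E           ()
  exc₁≢exc₂ (F ξ η ξ≢η) = ξ≢η

  -- The expansion solved for its coefficients: `f ξ` also has an entry at `η`, so the coefficient
  -- at `η` is what remains of `x η` after removing `x ξ`.
  coordinate : 𝓕 → (ℕ → 𝔽) → ℕ → 𝔽
  coordinate E         x i = x i
  coordinate (F ξ η _) x i = if does (η ≟ i) then x η -ₚ x ξ else x i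

  coordinate-off : ∀ B x {i} → exc₂ B ≢ i → coordinate B x i ≡ x i
  coordinate-off E         x     _   = refl
  coordinate-off (F ξ η _) x {i} η≢i = if-no (η ≟ i) η≢i

  coordinate-η : ∀ {ξ η ξ≢η} x → coordinate (F ξ η ξ≢η) x η ≡ x η -ₚ x ξ
  coordinate-η {ξ} {η} x = if-yes (η ≟ η) refl

  coordinate-agree : ∀ B x y i → x (exc₁ B) ≡ y (exc₁ B) → x (exc₂ B) ≡ y (exc₂ B) → x i ≡ y i →
                     coordinate B x i ≡ coordinate B y i
  coordinate-agree E         x y i _  _  xi = xi
  coordinate-agree (F ξ η _) x y i xξ xη xi =
    cong₂ (if does (η ≟ i) then_else_) (cong₂ _-ₚ_ xη xξ) xi

  -- The strict order read off from entries, with no coordinate sequences to supply. It is stated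
  -- for bare functions so that `override` can be applied to its arguments.
  Lower : 𝓕 → (ℕ → 𝔽) → (ℕ → 𝔽) → Set
  Lower B y z = ∃[ N ] coordinate B y N Fin.< coordinate B z N ×
                (∀ i → N < i → coordinate B y i ≡ coordinate B z i)

  -- What replaces the initial-segment property at `ξ` and `η`. A new entry at an outer `ξ` disturbs
  -- the coordinate at `η`; the second clause ensures that whenever `η` lies above `ξ` it is outer
  -- too, so that a correction there is possible. By the first clause, an outer `η` can always be
  -- treated together with `ξ`.
  Exceptional : 𝓕 → ∀ {j} → (ℕ → V j) → Set
  Exceptional E         col = ⊤
  Exceptional (F ξ η _) col = (col η ≡ 0ᵛ → col ξ ≡ 0ᵛ) × (ξ < η → col ξ ≡ 0ᵛ → col η ≡ 0ᵛ)

  -- col i lists the i-th entries of the generators found so far, the latest first.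
  record Invariant (B : 𝓕) (M d : ℕ) {j : ℕ} (col : ℕ → V j) : Set where
    field
      vanish          : ∀ i → M ≤ i → col i ≡ 0ᵛ
      constant-weight : ∀ a → a ≢ 0ᵛ → weight (upTo M) col a ≡ d
      initial         : ∀ {v i} → v < i → exc₁ B ≢ v → exc₂ B ≢ v → exc₁ B ≢ i → exc₂ B ≢ i →
                        col i ≢ 0ᵛ → col v ≢ 0ᵛ
      normalised      : ∀ i → col i ≡ 0ᵛ ⊎ Normalised (col i)
      exceptional     : Exceptional B col

  -- The modifications of `z` that cannot bring it closer to any word, whatever the number of its
  -- outer entries. Zero outer entries of `z` may be changed freely.
  record Dominates {j} (M : ℕ) (col : ℕ → V j) (z y : ℕ → 𝔽) : Set where
    constructor dominates
    field
      inside  : ∀ i → col i ≢ 0ᵛ → y i ≡ z i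
      outside : ∀ i → col i ≡ 0ᵛ → z i ≢ 0# → y i ≢ 0#
      beyond  : ∀ i → M ≤ i → y i ≡ 0#

  module _ {j} {M : ℕ} {col : ℕ → V j} where

    dominates-refl : ∀ {z} → (∀ i → M ≤ i → z i ≡ 0#) → Dominates M col z z
    dominates-refl z-out = dominates (λ _ _ → refl) (λ _ _ ne → ne) z-out

    dominates-override : ∀ {z y u x} → Dominates M col z y → col u ≡ 0ᵛ → u < M → x ≢ 0# →
                         Dominates M col z (override u x y)
    dominates-override {z} {y} {u} {x} (dominates ins out bey) cu u<M x≢0 = dominates
      (λ i ci → trans (override-off u x y (λ { refl → ci cu })) (ins i ci))
      (λ i ci zi → by i (out i ci zi) (u ≟ i))
      (λ i M≤i → trans (override-off u x y (λ { refl → <⇒≱ u<M M≤i })) (bey i M≤i))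
      where
      by : ∀ i → y i ≢ 0# → Dec (u ≡ i) → override u x y i ≢ 0#
      by i _  (yes refl) eq = x≢0 (trans (sym (override-at u x y)) eq)
      by i ne (no u≢i)   eq = ne (trans (sym (override-off u x y u≢i)) eq)

  -- The outer entries of a minimal word

  module _ {M : ℕ} {j : ℕ} {col : ℕ → V j} {z : ℕ → 𝔽} (z-out : ∀ i → M ≤ i → z i ≡ 0#) where

    -- An outer entry other than 0 and 1 could be lowered to 1 within `Dominates`. For `F ξ η` the
    -- entries at `ξ` and `η` must be altered so that the coordinate at `η` does not rise; the
    -- clauses of `Exceptional` make this possible and are re-established for the extended columns.
    minimal⇒1 : ∀ B → Exceptional B col → exc₁ B < M → exc₂ B < M →
      (∀ y → Dominates M col z y → ¬ Lower B y z) →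
      (∀ u → col u ≡ 0ᵛ → z u ≢ 0# → z u ≡ 1#) × Exceptional B (λ i → z i ∷ col i)
    minimal⇒1 E _ _ _ minimal = unit , tt
      where
      unit : ∀ u → col u ≡ 0ᵛ → z u ≢ 0# → z u ≡ 1#
      unit u cu zu = decidable-stable (z u ≟ₚ 1#) λ zu≢1 → minimal (override u 1# z)
        (dominates-override (dominates-refl z-out) cu (≰⇒> (zu ∘ z-out u)) 1≢0)
        (u , subst (Fin._< z u) (sym (override-at u 1# z)) (1#<other zu zu≢1) ,
         λ i u<i → override-off u 1# z (<⇒≢ u<i))
    minimal⇒1 B@(F ξ η ξ≢η) (η⇒ξ , ξ⇒η) ξ<M η<M minimal = unit , ex₁ , ex₂
      where
      lower-η : ∀ y → Dominates M col z y → y η -ₚ y ξ Fin.< z η -ₚ z ξ → (∀ i → η < i → y i ≡ z i) → ⊥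
      lower-η y dom lt above = minimal y dom (η ,
        subst₂ Fin._<_ (sym (coordinate-η {ξ≢η = ξ≢η} y)) (sym (coordinate-η {ξ≢η = ξ≢η} z)) lt ,
        λ i η<i → trans (coordinate-off B y (<⇒≢ η<i)) (trans (above i η<i) (sym (coordinate-off B z (<⇒≢ η<i)))))

      -- The last hypothesis is asked for only when `N < η`: the coordinate at `η` then belongs to
      -- the part that must agree, and it may have changed through the entry at `ξ`.
      lower : ∀ y N → η ≢ N → Dominates M col z y → y N Fin.< z N →
              (∀ i → N < i → η ≢ i → y i ≡ z i) → (N < η → y η -ₚ y ξ ≡ z η -ₚ z ξ) → ⊥
      lower y N η≢N dom lt above at-η = minimal y dom (N ,
        subst₂ Fin._<_ (sym (coordinate-off B y η≢N)) (sym (coordinate-off B z η≢N)) lt ,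
        λ i N<i → by i N<i (η ≟ i))
        where
        by : ∀ i → N < i → Dec (η ≡ i) → coordinate B y i ≡ coordinate B z i
        by i N<i (yes refl) = trans (coordinate-η {ξ≢η = ξ≢η} y) (trans (at-η N<i) (sym (coordinate-η {ξ≢η = ξ≢η} z)))
        by i N<i (no η≢i)   = trans (coordinate-off B y η≢i) (trans (above i N<i η≢i) (sym (coordinate-off B z η≢i)))

      self : Dominates M col z z
      self = dominates-refl z-out

      -ₚ-self : ∀ a → a -ₚ a ≡ 0#
      -ₚ-self = -ₚ-inverseʳ

      -ₚ-zero : ∀ a {b} → b ≡ 0# → a -ₚ b ≡ a
      -ₚ-zero a refl = trans (cong (a +ₚ_) -0#≈0#) (+-idʳ a)

      copy : col ξ ≡ 0ᵛ → col η ≡ 0ᵛ → z ξ ≢ 0# → z η ≡ z ξ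
      copy cξ cη zξ = decidable-stable (z η ≟ₚ z ξ) λ ne →
        lower-η (override η (z ξ) z) (dominates-override self cη η<M zξ)
          (subst (Fin._< (z η -ₚ z ξ))
            (sym (trans (cong₂ _-ₚ_ (override-at η (z ξ) z) (override-off η (z ξ) z (ξ≢η ∘ sym))) (-ₚ-self (z ξ))))
            (0#<nonzero (ne ∘ -ₚ≡0)))
          (λ i η<i → override-off η (z ξ) z (<⇒≢ η<i))

      unit-ξ : col ξ ≡ 0ᵛ → z ξ ≢ 0# → z ξ ≡ 1#
      unit-ξ cξ zξ = decidable-stable (z ξ ≟ₚ 1#) (λ ne → by ne (col η ≟ᵛ 0ᵛ))
        where
        by : z ξ ≢ 1# → Dec (col η ≡ 0ᵛ) → ⊥
        -- By `copy` the coordinate at `η` is already zero; setting both entries to 1 keeps it zero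
        -- while the one at `ξ` drops.
        by ne (yes cη) = lower (override ξ 1# z′) ξ (ξ≢η ∘ sym)
          (dominates-override (dominates-override self cη η<M 1≢0) cξ ξ<M 1≢0)
          (subst (Fin._< z ξ) (sym (override-at ξ 1# z′)) (1#<other zξ ne))
          (λ i ξ<i η≢i → trans (override-off ξ 1# z′ (<⇒≢ ξ<i)) (override-off η 1# z η≢i))
          (λ _ → trans (trans (cong₂ _-ₚ_ (trans (override-off ξ 1# z′ ξ≢η) (override-at η 1# z)) (override-at ξ 1# z′)) (-ₚ-self 1#))
                       (sym (trans (cong (_-ₚ z ξ) (copy cξ cη zξ)) (-ₚ-self (z ξ)))))
          where z′ = override η 1# z
        -- The entry at `η` is fixed here, so the coordinate at `η` changes. This is harmless
        -- because `η` lies below `ξ`: otherwise `Exceptional` would make `η` outer.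
        by ne (no cη) = lower (override ξ 1# z) ξ (ξ≢η ∘ sym) (dominates-override self cξ ξ<M 1≢0)
          (subst (Fin._< z ξ) (sym (override-at ξ 1# z)) (1#<other zξ ne))
          (λ i ξ<i _ → override-off ξ 1# z (<⇒≢ ξ<i))
          (λ ξ<η → contradiction (ξ⇒η ξ<η cξ) cη)

      unit-η : col η ≡ 0ᵛ → z η ≢ 0# → z η ≡ 1#
      unit-η cη zη = by (z ξ ≟ₚ 0#)
        where
        by : Dec (z ξ ≡ 0#) → z η ≡ 1#
        by (no zξ)  = let cξ = η⇒ξ cη in trans (copy cξ cη zξ) (unit-ξ cξ zξ)
        by (yes zξ) = decidable-stable (z η ≟ₚ 1#) λ ne →
          lower-η (override η 1# z) (dominates-override self cη η<M 1≢0)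
            (subst₂ Fin._<_
              (sym (trans (cong₂ _-ₚ_ (override-at η 1# z) (override-off η 1# z (ξ≢η ∘ sym))) (-ₚ-zero 1# zξ)))
              (sym (-ₚ-zero (z η) zξ))
              (1#<other zη ne))
            (λ i η<i → override-off η 1# z (<⇒≢ η<i))

      unit : ∀ u → col u ≡ 0ᵛ → z u ≢ 0# → z u ≡ 1#
      unit u cu zu = by (η ≟ u) (ξ ≟ u)
        where
        by : Dec (η ≡ u) → Dec (ξ ≡ u) → z u ≡ 1#
        by (yes refl) _ = unit-η cu zu
        by (no _) (yes refl) = unit-ξ cu zu
        by (no η≢u) (no ξ≢u) = decidable-stable (z u ≟ₚ 1#) λ ne →
          lower (override u 1# z) u η≢u (dominates-override self cu (≰⇒> (zu ∘ z-out u)) 1≢0)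
            (subst (Fin._< z u) (sym (override-at u 1# z)) (1#<other zu ne))
            (λ i u<i _ → override-off u 1# z (<⇒≢ u<i))
            (λ _ → cong₂ _-ₚ_ (override-off u 1# z (η≢u ∘ sym)) (override-off u 1# z (ξ≢u ∘ sym)))

      ex₁ : z η ∷ col η ≡ 0ᵛ → z ξ ∷ col ξ ≡ 0ᵛ
      ex₁ eq = cong₂ _∷_ (decidable-stable (z ξ ≟ₚ 0#) (λ zξ → zξ (trans (sym (copy cξ cη zξ)) zη))) cξ
        where
        zη = Vec.∷-injectiveˡ eq
        cη = Vec.∷-injectiveʳ eq
        cξ = η⇒ξ cη

      -- If `η` had a nonzero entry and `ξ` a zero one, copying the entry from `η` to `ξ` would make
      -- the coordinate at `η` zero. The coordinate raised at `ξ` does not count, as it lies below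
      -- `η`.
      ex₂ : ξ < η → z ξ ∷ col ξ ≡ 0ᵛ → z η ∷ col η ≡ 0ᵛ
      ex₂ ξ<η eq = cong₂ _∷_ (decidable-stable (z η ≟ₚ 0#) λ zη →
        lower-η (override ξ (z η) z) (dominates-override self cξ ξ<M zη)
          (subst₂ Fin._<_
            (sym (trans (cong₂ _-ₚ_ (override-off ξ (z η) z ξ≢η) (override-at ξ (z η) z)) (-ₚ-self (z η))))
            (sym (-ₚ-zero (z η) zξ))
            (0#<nonzero zη))
          (λ i η<i → override-off ξ (z η) z (<⇒≢ (<-trans ξ<η η<i)))) (ξ⇒η ξ<η cξ)
        where
        zξ = Vec.∷-injectiveˡ eq
        cξ = Vec.∷-injectiveʳ eq

  -- Distances to all words and their average

  module Distances {j} (M : ℕ) (col : ℕ → V j) where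

    distance : (ℕ → 𝔽) → V j → ℕ
    distance y a = sumOver (upTo M) (λ i → ⟦ ¬? (y i ≟ₚ dot a (col i)) ⟧)

    outer : (ℕ → 𝔽) → ℕ
    outer y = sumOver (upTo M) (λ i → ⟦ col i ≟ᵛ 0ᵛ ⟧ * ⟦ ¬? (y i ≟ₚ 0#) ⟧)

    -- Only the positions off the support of col make the average distance from y
    -- to the words larger than their average weight.
    total-distance : ∀ y → sumOver (vectors j) (distance y) ≡ sumOver (vectors j) (weight (upTo M) col) + p ^ j * outer y
    total-distance y = begin
      sumOver (vectors j) (distance y)                              ≡⟨ sum-comm (vectors j) (upTo M) ⟩
      sumOver (upTo M) (λ i → N (y i) (col i))                       ≡⟨ sum-cong (upTo M) (λ i → by (y i) (col i) (col i ≟ᵛ 0ᵛ)) ⟩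
      sumOver (upTo M) (λ i → N 0# (col i) + p ^ j * (⟦ col i ≟ᵛ 0ᵛ ⟧ * ⟦ ¬? (y i ≟ₚ 0#) ⟧)) ≡⟨ sum-+ (upTo M) ⟩
      sumOver (upTo M) (λ i → N 0# (col i)) + sumOver (upTo M) (λ i → p ^ j * (⟦ col i ≟ᵛ 0ᵛ ⟧ * ⟦ ¬? (y i ≟ₚ 0#) ⟧))
        ≡⟨ cong₂ _+_ (sym (sum-comm (vectors j) (upTo M))) (sum-*ˡ (upTo M) (p ^ j)) ⟩
      sumOver (vectors j) (weight (upTo M) col) + p ^ j * outer y ∎
      where
      open ≡-Reasoning
      N : 𝔽 → V j → ℕ
      N x u = sumOver (vectors j) (λ a → ⟦ ¬? (x ≟ₚ dot a u) ⟧)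
      N-0ᵛ : ∀ x → N x 0ᵛ ≡ p ^ j * ⟦ ¬? (x ≟ₚ 0#) ⟧
      N-0ᵛ x = trans (sum-cong (vectors j) (λ a → cong (λ t → ⟦ ¬? (x ≟ₚ t) ⟧) (dot-zeroʳ a)))
                     (trans (sum-const (vectors j) _) (cong (_* ⟦ ¬? (x ≟ₚ 0#) ⟧) (length-vectors j)))
      by : ∀ x u (q : Dec (u ≡ 0ᵛ)) → N x u ≡ N 0# u + p ^ j * (⟦ q ⟧ * ⟦ ¬? (x ≟ₚ 0#) ⟧)
      by x u (yes refl) = trans (N-0ᵛ x) (sym (cong₂ _+_
        (trans (N-0ᵛ 0#) (trans (cong (p ^ j *_) (⟦⟧-no (¬? (0# ≟ₚ 0#)) (λ ne → ne refl))) (*-zeroʳ (p ^ j))))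
        (cong (p ^ j *_) (*-identityˡ ⟦ ¬? (x ≟ₚ 0#) ⟧))))
      by x u (no u≢0) = trans (*-cancelˡ-≡ _ _ p (trans (linear-form-≢ u≢0 x) (sym (linear-form-≢ u≢0 0#))))
                              (sym (trans (cong (N 0# u +_) (*-zeroʳ (p ^ j))) (+-identityʳ _)))

    outer-override : ∀ {u} x y → col u ≡ 0ᵛ → u < M →
      outer (override u x y) + ⟦ ¬? (y u ≟ₚ 0#) ⟧ ≡ outer y + ⟦ ¬? (x ≟ₚ 0#) ⟧
    outer-override {u} x y cu u<M = begin
      outer (override u x y) + Y      ≡⟨ cong (_+ Y) (trans (sum-upTo-split M u u<M _) (cong₂ _+_ (sum-cong (upTo M) (λ i → by i (u ≟ i))) (at-u {override u x y u} {x} (override-at u x y)))) ⟩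
      rest + ⟦ ¬? (x ≟ₚ 0#) ⟧ + Y     ≡⟨ arith rest ⟦ ¬? (x ≟ₚ 0#) ⟧ Y ⟩
      rest + Y + ⟦ ¬? (x ≟ₚ 0#) ⟧     ≡⟨ cong (_+ ⟦ ¬? (x ≟ₚ 0#) ⟧) (sym (trans (sum-upTo-split M u u<M _) (cong (rest +_) (at-u {y u} refl)))) ⟩
      outer y + ⟦ ¬? (x ≟ₚ 0#) ⟧      ∎
      where
      open ≡-Reasoning
      Y = ⟦ ¬? (y u ≟ₚ 0#) ⟧
      rest = sumOver (upTo M) (λ i → ⟦ ¬? (u ≟ i) ⟧ * (⟦ col i ≟ᵛ 0ᵛ ⟧ * ⟦ ¬? (y i ≟ₚ 0#) ⟧))
      at-u : ∀ {s t} → s ≡ t → ⟦ col u ≟ᵛ 0ᵛ ⟧ * ⟦ ¬? (s ≟ₚ 0#) ⟧ ≡ ⟦ ¬? (t ≟ₚ 0#) ⟧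
      at-u {s} refl = trans (cong (_* ⟦ ¬? (s ≟ₚ 0#) ⟧) (⟦⟧-yes (col u ≟ᵛ 0ᵛ) cu)) (*-identityˡ _)
      by : ∀ i (q : Dec (u ≡ i)) → ⟦ ¬? q ⟧ * (⟦ col i ≟ᵛ 0ᵛ ⟧ * ⟦ ¬? (override u x y i ≟ₚ 0#) ⟧)
                                 ≡ ⟦ ¬? q ⟧ * (⟦ col i ≟ᵛ 0ᵛ ⟧ * ⟦ ¬? (y i ≟ₚ 0#) ⟧)
      by i (yes _)  = refl
      by i (no u≢i) = cong (λ t → 1 * (⟦ col i ≟ᵛ 0ᵛ ⟧ * ⟦ ¬? (t ≟ₚ 0#) ⟧)) (override-off u x y u≢i)
      arith : ∀ a b c → a + b + c ≡ a + c + b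
      arith = solve-∀

  -- Adding one generator

  module _ (B : 𝓕) (M : ℕ) {j} (col : ℕ → V j) (d₁ : ℕ) (2≤d₁ : 2 ≤ d₁) (inv : Invariant B M (p ^ j * d₁) col)
           (exc₁<M : exc₁ B < M) (exc₂<M : exc₂ B < M) where

    open Invariant inv
    open Distances M col

    private
      d = p ^ j * d₁
      instance
        p^j-nonZero : NonZero (p ^ j)
        p^j-nonZero = m^n≢0 p j

    Far : (ℕ → 𝔽) → Set
    Far y = ∀ a → d ≤ distance y a

    -- Divided by `p ^ j`, this says that the average distance from `y` plus `d₁` is `d + outer y`.
    total : ∀ y → sumOver (vectors j) (distance y) + d ≡ p ^ j * d + p ^ j * outer y
    total y = begin
      sumOver (vectors j) (distance y) + d       ≡⟨ cong (_+ d) (total-distance y) ⟩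
      W + p ^ j * outer y + d                    ≡⟨ arith W (p ^ j * outer y) d ⟩
      W + d + p ^ j * outer y                    ≡⟨ cong (_+ p ^ j * outer y) (sum-constant-off-0 (weight (upTo M) col) d (weight-0ᵛ (upTo M) col) constant-weight) ⟩
      p ^ j * d + p ^ j * outer y                ∎
      where
      open ≡-Reasoning
      W = sumOver (vectors j) (weight (upTo M) col)
      arith : ∀ a b c → a + b + c ≡ a + c + b
      arith = solve-∀

    far⇒outer : ∀ y → Far y → d₁ ≤ outer y
    far⇒outer y far = *-cancelˡ-≤ (p ^ j) (+-cancelˡ-≤ (p ^ j * d) _ _ (begin
      p ^ j * d + d                             ≡⟨ cong (λ l → l * d + d) (sym (length-vectors j)) ⟩
      length (vectors j) * d + d                ≤⟨ +-monoˡ-≤ d (sum-≥ (vectors j) d far) ⟩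
      sumOver (vectors j) (distance y) + d      ≡⟨ total y ⟩
      p ^ j * d + p ^ j * outer y               ∎))
      where open ≤-Reasoning

    far-equidistant : ∀ y → Far y → outer y ≡ d₁ → ∀ a → distance y a ≡ d
    far-equidistant y far eq a = sum-squeeze (vectors j) d far (≤-reflexive (+-cancelʳ-≡ d _ _ (begin
      sumOver (vectors j) (distance y) + d      ≡⟨ total y ⟩
      p ^ j * d + p ^ j * outer y               ≡⟨ cong (λ t → p ^ j * d + p ^ j * t) eq ⟩
      p ^ j * d + d                             ≡⟨ cong (λ l → l * d + d) (sym (length-vectors j)) ⟩
      length (vectors j) * d + d                ∎))) (∈-vectors a)
      where open ≡-Reasoning

    -- On the support the entries agree. Off it every word is zero and `y` is nonzero wherever `z`
    -- is, so no distance drops.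
    dominates⇒far : ∀ z y → Far z → Dominates M col z y → Far y
    dominates⇒far z y far (dominates ins out _) a =
      ≤-trans (far a) (sum-mono (upTo M) (λ i → by i (col i) refl (col i ≟ᵛ 0ᵛ)))
      where
      by : ∀ i u → col i ≡ u → Dec (u ≡ 0ᵛ) → ⟦ ¬? (z i ≟ₚ dot a (col i)) ⟧ ≤ ⟦ ¬? (y i ≟ₚ dot a (col i)) ⟧
      by i u refl (yes ci) = ⟦⟧-mono (¬? (z i ≟ₚ dot a (col i))) (¬? (y i ≟ₚ dot a (col i)))
        (λ ne eq → out i ci (λ zi → ne (trans zi (sym zero-here))) (trans eq zero-here))
        where zero-here = trans (cong (dot a) ci) (dot-zeroʳ a)
      by i u refl (no ci)  = ≤-reflexive (cong (λ t → ⟦ ¬? (t ≟ₚ dot a (col i)) ⟧) (sym (ins i ci)))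

    -- For `j = suc i` the multiplicity formula says that `p ^ i` times the size is
    -- `p ^ suc i * d₁`; for `j = 0` there is no normalised vector. The local `size` generalises `j`
    -- so that it can be matched on.
    class-size : ∀ {n} → Normalised n → sumOver (upTo M) (λ i → ⟦ col i ≟ᵛ n ⟧) ≡ p * d₁
    class-size = size inv
      where
      size : ∀ {j} {col : ℕ → V j} → Invariant B M (p ^ j * d₁) col → ∀ {n} → Normalised n →
             sumOver (upTo M) (λ i → ⟦ col i ≟ᵛ n ⟧) ≡ p * d₁
      size {zero}  inv {[]} ()
      size {suc j} {col} inv nn = *-cancelˡ-≡ _ _ (p ^ j) {{m^n≢0 p j}} (trans
        (Bonisoli.multiplicity (upTo M) col (p ^ suc j * d₁) (Invariant.normalised inv) (Invariant.constant-weight inv) nn)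
        (arith p (p ^ j) d₁))
        where
        arith : ∀ a b c → a * b * c ≡ b * (a * c)
        arith = solve-∀

    Balanced : (ℕ → 𝔽) → Set
    Balanced y = ∀ {n} → Normalised n → ∀ b → sumOver (upTo M) (λ i → ⟦ col i ≟ᵛ n ⟧ * ⟦ y i ≟ₚ b ⟧) ≡ d₁

    -- On the class of `n` a word has the constant value `dot a n`, which `y` takes at `d₁` of the
    -- `p * d₁` positions, so the class contributes `(p - 1) * d₁` for every word. Off the support
    -- the contribution is `outer y`. Summed over all points, the distance plus `d₁` is
    -- `d + outer y`.
    balanced⇒far : ∀ y → Balanced y → d₁ ≤ outer y → Far y
    balanced⇒far y balanced d₁≤ a = +-cancelʳ-≤ d₁ _ _ (begin
      d + d₁                        ≤⟨ +-monoʳ-≤ d d₁≤ ⟩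
      d + outer y                   ≡⟨ sym distance+d₁ ⟩
      distance y a + d₁             ∎)
      where
      open ≤-Reasoning
      f : V j → ℕ → ℕ
      f n i = ⟦ ¬? (y i ≟ₚ dot a n) ⟧
      by-class : ∀ i → f (col i) i ≡ ⟦ col i ≟ᵛ 0ᵛ ⟧ * ⟦ ¬? (y i ≟ₚ 0#) ⟧ + sumOver (points j) (λ n → ⟦ col i ≟ᵛ n ⟧ * f n i)
      by-class i = by (normalised i)
        where
        by : col i ≡ 0ᵛ ⊎ Normalised (col i) →
             f (col i) i ≡ ⟦ col i ≟ᵛ 0ᵛ ⟧ * ⟦ ¬? (y i ≟ₚ 0#) ⟧ + sumOver (points j) (λ n → ⟦ col i ≟ᵛ n ⟧ * f n i)
        by (inj₁ ci) = sym (trans (cong₂ _+_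
          (trans (cong (_* ⟦ ¬? (y i ≟ₚ 0#) ⟧) (⟦⟧-yes (col i ≟ᵛ 0ᵛ) ci)) (*-identityˡ _))
          (sum-zero (points j) (λ n n∈ → cong (_* f n i) (⟦⟧-no (col i ≟ᵛ n) (λ eq → Normalised≢0 (∈-points⁻ n∈) (trans (sym eq) ci))))))
          (trans (+-identityʳ _) (cong (λ t → ⟦ ¬? (y i ≟ₚ t) ⟧) (sym (trans (cong (dot a) ci) (dot-zeroʳ a))))))
        by (inj₂ nc) = sym (cong₂ _+_
          (cong (_* ⟦ ¬? (y i ≟ₚ 0#) ⟧) (⟦⟧-no (col i ≟ᵛ 0ᵛ) (Normalised≢0 nc)))
          (sum-δ _≟ᵛ_ (points-unique j) (∈-points⁺ nc) (λ n → f n i)))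
      class-distance : ∀ {n} → Normalised n → sumOver (upTo M) (λ i → ⟦ col i ≟ᵛ n ⟧ * f n i) ≡ (p ∸ 1) * d₁
      class-distance {n} nn = +-cancelʳ-≡ d₁ _ _ (begin-equality
        sumOver (upTo M) (λ i → ⟦ col i ≟ᵛ n ⟧ * f n i) + d₁
          ≡⟨ cong (sumOver (upTo M) (λ i → ⟦ col i ≟ᵛ n ⟧ * f n i) +_) (sym (balanced nn (dot a n))) ⟩
        sumOver (upTo M) (λ i → ⟦ col i ≟ᵛ n ⟧ * f n i) + sumOver (upTo M) (λ i → ⟦ col i ≟ᵛ n ⟧ * ⟦ y i ≟ₚ dot a n ⟧)
          ≡⟨ sym (sum-+ (upTo M)) ⟩
        sumOver (upTo M) (λ i → ⟦ col i ≟ᵛ n ⟧ * f n i + ⟦ col i ≟ᵛ n ⟧ * ⟦ y i ≟ₚ dot a n ⟧)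
          ≡⟨ sum-cong (upTo M) (λ i → trans (sym (*-distribˡ-+ ⟦ col i ≟ᵛ n ⟧ _ _))
               (trans (cong (⟦ col i ≟ᵛ n ⟧ *_) (⟦⟧-¬ (y i ≟ₚ dot a n))) (*-identityʳ _))) ⟩
        sumOver (upTo M) (λ i → ⟦ col i ≟ᵛ n ⟧)   ≡⟨ class-size nn ⟩
        p * d₁                                    ≡⟨ cong (_* d₁) p≡1+[p∸1] ⟩
        d₁ + (p ∸ 1) * d₁                         ≡⟨ +-comm d₁ _ ⟩
        (p ∸ 1) * d₁ + d₁                         ∎)
      L = length (points j)
      arith : ∀ t L r d₁ → t + L * (r * d₁) + d₁ ≡ (L * r + 1) * d₁ + t
      arith = solve-∀
      distance+d₁ : distance y a + d₁ ≡ d + outer y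
      distance+d₁ = begin-equality
        distance y a + d₁
          ≡⟨ cong (_+ d₁) (trans (sum-cong (upTo M) by-class) (sum-+ (upTo M))) ⟩
        outer y + sumOver (upTo M) (λ i → sumOver (points j) (λ n → ⟦ col i ≟ᵛ n ⟧ * f n i)) + d₁
          ≡⟨ cong (λ t → outer y + t + d₁) (trans (sum-comm (upTo M) (points j))
               (trans (sum-cong-∈ (points j) (λ n n∈ → class-distance (∈-points⁻ n∈))) (sum-const (points j) _))) ⟩
        outer y + L * ((p ∸ 1) * d₁) + d₁      ≡⟨ arith (outer y) L (p ∸ 1) d₁ ⟩
        (L * (p ∸ 1) + 1) * d₁ + outer y       ≡⟨ cong (λ t → t * d₁ + outer y) (length-points j) ⟩
        d + outer y                            ∎

    module _ {z : ℕ → 𝔽} (z-out : ∀ i → M ≤ i → z i ≡ 0#) (far : Far z)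
             (minimal : ∀ y → (∀ i → M ≤ i → y i ≡ 0#) → Far y → ¬ Lower B y z) where

      -- Refilling the support of col with a balanced colouring that agrees with z at the two
      -- exceptional positions compensates for the cleared entry; the refilled positions lie below u.
      cannot-clear : ∀ {u} → exc₁ B ≢ u → exc₂ B ≢ u → col u ≡ 0ᵛ → z u ≢ 0# → ∀ z′ → z′ u ≡ 0# →
        z′ (exc₁ B) ≡ z (exc₁ B) → z′ (exc₂ B) ≡ z (exc₂ B) → (∀ i → u < i → z′ i ≡ z i) → ¬ (d₁ ≤ outer z′)
      cannot-clear {u} u≢ξ u≢η cu zu z′ z′u z′ξ z′η above d₁≤ =
        minimal y y-out (balanced⇒far y y-balanced (≤-trans d₁≤ (≤-reflexive (sym y-outer)))) (u ,
          subst₂ Fin._<_ (sym (trans (coordinate-off B y u≢η) (trans (y-off cu) z′u))) (sym (coordinate-off B z u≢η)) (0#<nonzero zu) ,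
          λ i u<i → coordinate-agree B y z i (y-exc z′ξ hξ) (y-exc z′η hη) (y-above i u<i))
        where
        pinned = Colouring.pinned-colouring 0# _≟ᵛ_ col (exc₁≢exc₂ B) exc₁<M exc₂<M (z (exc₁ B)) (z (exc₂ B)) 2≤d₁
        h = proj₁ pinned
        hξ = proj₁ (proj₂ pinned)
        hη = proj₁ (proj₂ (proj₂ pinned))
        y : ℕ → 𝔽
        y i = if does (col i ≟ᵛ 0ᵛ) then z′ i else h i
        y-off : ∀ {i} → col i ≡ 0ᵛ → y i ≡ z′ i
        y-off {i} = if-yes (col i ≟ᵛ 0ᵛ)
        y-in : ∀ {i} → col i ≢ 0ᵛ → y i ≡ h i
        y-in {i} = if-no (col i ≟ᵛ 0ᵛ)
        u<M : u < M
        u<M = ≰⇒> (zu ∘ z-out u)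
        y-out : ∀ i → M ≤ i → y i ≡ 0#
        y-out i M≤i = trans (y-off (vanish i M≤i)) (trans (above i (<-≤-trans u<M M≤i)) (z-out i M≤i))
        y-exc : ∀ {i} → z′ i ≡ z i → h i ≡ z i → y i ≡ z i
        y-exc {i} z′i hi = by (col i ≟ᵛ 0ᵛ)
          where
          by : Dec (col i ≡ 0ᵛ) → y i ≡ z i
          by (yes ci) = trans (y-off ci) z′i
          by (no ci)  = trans (y-in ci) hi
        y-above : ∀ i → u < i → y i ≡ z i
        y-above i u<i = by (exc₁ B ≟ i) (exc₂ B ≟ i)
          where
          by : Dec (exc₁ B ≡ i) → Dec (exc₂ B ≡ i) → y i ≡ z i
          by (yes refl) _ = y-exc z′ξ hξ
          by (no _) (yes refl) = y-exc z′η hη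
          by (no ξ≢i) (no η≢i) = trans (y-off (decidable-stable (col i ≟ᵛ 0ᵛ)
            (λ ci → initial u<i u≢ξ u≢η ξ≢i η≢i ci cu))) (above i u<i)
        y-balanced : Balanced y
        y-balanced {n} nn b = trans
          (sum-cong (upTo M) (λ i → by i (col i ≟ᵛ n)))
          (proj₂ (proj₂ (proj₂ pinned)) n (class-size nn) b)
          where
          by : ∀ i (q : Dec (col i ≡ n)) → ⟦ q ⟧ * ⟦ y i ≟ₚ b ⟧ ≡ ⟦ q ⟧ * ⟦ h i ≟ₚ b ⟧
          by i (yes ci) = cong (λ t → 1 * ⟦ t ≟ₚ b ⟧) (y-in (λ c0 → Normalised≢0 nn (trans (sym ci) c0)))
          by i (no _)   = refl
        y-outer : outer y ≡ outer z′
        y-outer = sum-cong (upTo M) (λ i → by i (col i ≟ᵛ 0ᵛ))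
          where
          by : ∀ i (q : Dec (col i ≡ 0ᵛ)) → ⟦ q ⟧ * ⟦ ¬? (y i ≟ₚ 0#) ⟧ ≡ ⟦ q ⟧ * ⟦ ¬? (z′ i ≟ₚ 0#) ⟧
          by i (yes ci) = cong (λ t → 1 * ⟦ ¬? (t ≟ₚ 0#) ⟧) (y-off ci)
          by i (no _)   = refl

      -- More than `d₁` outer entries means at least three, so one of them avoids both exceptional
      -- positions; clearing it still leaves `d₁`.
      outer≡d₁ : outer z ≡ d₁
      outer≡d₁ = ≤-antisym (≮⇒≥ impossible) (far⇒outer z far)
        where
        g : ℕ → ℕ
        g i = ⟦ col i ≟ᵛ 0ᵛ ⟧ * ⟦ ¬? (z i ≟ₚ 0#) ⟧
        free : ℕ → ℕ
        free i = ⟦ ¬? (exc₁ B ≟ i) ⟧ * ⟦ ¬? (exc₂ B ≟ i) ⟧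
        g≤1 : ∀ i → g i ≤ 1
        g≤1 i = *-mono-≤ (⟦⟧≤1 (col i ≟ᵛ 0ᵛ)) (⟦⟧≤1 (¬? (z i ≟ₚ 0#)))
        somewhere : d₁ < outer z → 0 < sumOver (upTo M) (λ i → free i * g i)
        somewhere d₁< = +-cancelʳ-< 2 0 _ (begin-strict
          2                                                    ≤⟨ 2≤d₁ ⟩
          d₁                                                   <⟨ d₁< ⟩
          outer z                                              ≡⟨ sum-upTo-split₂ M (exc₁≢exc₂ B) exc₁<M exc₂<M g ⟩
          sumOver (upTo M) (λ i → free i * g i) + (g (exc₁ B) + g (exc₂ B)) ≤⟨ +-monoʳ-≤ _ (+-mono-≤ (g≤1 (exc₁ B)) (g≤1 (exc₂ B))) ⟩
          sumOver (upTo M) (λ i → free i * g i) + 2            ∎)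
          where open ≤-Reasoning
        impossible : ¬ (d₁ < outer z)
        impossible d₁< with u , u∈ , 0< ← sum-positive (upTo M) (λ i → free i * g i) (somewhere d₁<)
          = by (exc₁ B ≟ u) (exc₂ B ≟ u) (col u ≟ᵛ 0ᵛ) (z u ≟ₚ 0#) 0<
          where
          by : (q : Dec (exc₁ B ≡ u)) (r : Dec (exc₂ B ≡ u)) (s : Dec (col u ≡ 0ᵛ)) (t : Dec (z u ≡ 0#)) →
               ¬ (0 < (⟦ ¬? q ⟧ * ⟦ ¬? r ⟧) * (⟦ s ⟧ * ⟦ ¬? t ⟧))
          by (no ξ≢u) (no η≢u) (yes cu) (no zu) _ =
            cannot-clear ξ≢u η≢u cu zu (override u 0# z) (override-at u 0# z)
              (override-off u 0# z (ξ≢u ∘ sym)) (override-off u 0# z (η≢u ∘ sym))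
              (λ i u<i → override-off u 0# z (<⇒≢ u<i))
              (+-cancelʳ-≤ 1 _ _ (≤-trans (≤-reflexive (+-comm d₁ 1)) (≤-trans d₁< (≤-reflexive (sym cleared)))))
            where
            cleared : outer (override u 0# z) + 1 ≡ outer z
            cleared = trans (cong (outer (override u 0# z) +_) (sym (⟦⟧-yes (¬? (z u ≟ₚ 0#)) zu)))
              (trans (outer-override 0# z cu (∈-upTo⁻ u∈))
              (trans (cong (outer z +_) (⟦⟧-no (¬? (0# ≟ₚ 0#)) (λ ne → ne refl))) (+-identityʳ _)))
          by (yes _) _ _ _ ()
          by (no _) (yes _) _ _ ()
          by (no _) (no _) (no _) _ ()
          by (no _) (no _) (yes _) (yes _) ()

      new : ℕ → V (suc j)
      new i = z i ∷ col i

      new-initial : ∀ {v i} → v < i → exc₁ B ≢ v → exc₂ B ≢ v → exc₁ B ≢ i → exc₂ B ≢ i → new i ≢ 0ᵛ → new v ≢ 0ᵛ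
      new-initial {v} {i} v<i ξ≢v η≢v ξ≢i η≢i ni nv = by (col i ≟ᵛ 0ᵛ)
        where
        zv = Vec.∷-injectiveˡ nv
        cv = Vec.∷-injectiveʳ nv
        by : ¬ Dec (col i ≡ 0ᵛ)
        by (no ci)  = initial v<i ξ≢v η≢v ξ≢i η≢i ci cv
        -- The outer entry at `i` is moved down to `v` as a 1: the number of outer entries is
        -- unchanged and the higher position is cleared.
        by (yes ci) = cannot-clear ξ≢i η≢i ci zi z″ (override-at i 0# z′)
            (trans (override-off i 0# z′ (ξ≢i ∘ sym)) (override-off v 1# z (ξ≢v ∘ sym)))
            (trans (override-off i 0# z′ (η≢i ∘ sym)) (override-off v 1# z (η≢v ∘ sym)))
            (λ l i<l → trans (override-off i 0# z′ (<⇒≢ i<l)) (override-off v 1# z (<⇒≢ (<-trans v<i i<l))))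
            (≤-reflexive (sym (trans moved outer≡d₁)))
          where
          zi : z i ≢ 0#
          zi zi≡0 = ni (cong₂ _∷_ zi≡0 ci)
          i<M : i < M
          i<M = ≰⇒> (zi ∘ z-out i)
          z′ z″ : ℕ → 𝔽
          z′ = override v 1# z
          z″ = override i 0# z′
          moved : outer z″ ≡ outer z
          moved = +-cancelʳ-≡ 1 _ _ (begin
            outer z″ + 1                            ≡⟨ cong (outer z″ +_) (sym (⟦⟧-yes (¬? (z′ i ≟ₚ 0#)) (λ eq → zi (trans (sym (override-off v 1# z (<⇒≢ v<i))) eq)))) ⟩
            outer z″ + ⟦ ¬? (z′ i ≟ₚ 0#) ⟧          ≡⟨ outer-override 0# z′ ci i<M ⟩
            outer z′ + ⟦ ¬? (0# ≟ₚ 0#) ⟧            ≡⟨ cong (outer z′ +_) (trans (⟦⟧-no (¬? (0# ≟ₚ 0#)) (λ ne → ne refl)) (sym (⟦⟧-no (¬? (z v ≟ₚ 0#)) (λ ne → ne zv)))) ⟩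
            outer z′ + ⟦ ¬? (z v ≟ₚ 0#) ⟧           ≡⟨ outer-override 1# z cv (<-trans v<i i<M) ⟩
            outer z + ⟦ ¬? (1# ≟ₚ 0#) ⟧             ≡⟨ cong (outer z +_) (⟦⟧-yes (¬? (1# ≟ₚ 0#)) 1≢0) ⟩
            outer z + 1                             ∎)
            where open ≡-Reasoning

      -- For `x` nonzero, the new word vanishes exactly where `z` agrees with the old word of
      -- coefficients `a` times the negative inverse of `x`. Its weight is therefore a distance from
      -- `z`, and all of these equal `d`.
      new-constant-weight : ∀ a → a ≢ 0ᵛ → weight (upTo M) new a ≡ d
      new-constant-weight (x ∷ a) xa≢0 = by (x ≟ₚ 0#)
        where
        by : Dec (x ≡ 0#) → weight (upTo M) new (x ∷ a) ≡ d
        by (yes refl) = trans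
          (sum-cong (upTo M) (λ i → cong (λ t → ⟦ ¬? (0# ≟ₚ t) ⟧)
            (trans (cong (_+ₚ dot a (col i)) (*-zeroˡₚ (z i))) (+-idˡ (dot a (col i))))))
          (constant-weight a (xa≢0 ∘ cong (0# ∷_)))
        by (no x≢0) with r , rx ← inverse x≢0 = trans
          (sum-cong (upTo M) (λ i → ⟦⟧-cong (¬? (0# ≟ₚ x *ₚ z i +ₚ dot a (col i))) (¬? (z i ≟ₚ dot ((-ₚ r) • a) (col i)))
            (λ ne eq → ne (from i eq)) (λ ne eq → ne (to i eq))))
          (far-equidistant z far outer≡d₁ ((-ₚ r) • a))
          where
          open ≡-Reasoning
          xr : x *ₚ r ≡ 1#
          xr = trans (*ₚ-comm x r) rx
          from : ∀ i → z i ≡ dot ((-ₚ r) • a) (col i) → 0# ≡ x *ₚ z i +ₚ dot a (col i)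
          from i eq = sym (begin
            x *ₚ z i +ₚ a·c                    ≡⟨ cong (λ t → x *ₚ t +ₚ a·c) (trans eq (dot-•ˡ (-ₚ r) a (col i))) ⟩
            x *ₚ (-ₚ r *ₚ a·c) +ₚ a·c            ≡⟨ cong (λ t → x *ₚ t +ₚ a·c) (sym (-‿distribˡ-* r a·c)) ⟩
            x *ₚ (-ₚ (r *ₚ a·c)) +ₚ a·c          ≡⟨ cong (_+ₚ a·c) (sym (-‿distribʳ-* x (r *ₚ a·c))) ⟩
            -ₚ (x *ₚ (r *ₚ a·c)) +ₚ a·c          ≡⟨ cong (λ t → -ₚ t +ₚ a·c) (trans (sym (*ₚ-assoc x r a·c)) (trans (cong (_*ₚ a·c) xr) (*-idˡ a·c))) ⟩
            -ₚ a·c +ₚ a·c                        ≡⟨ -ₚ-inverseˡ a·c ⟩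
            0#                               ∎)
            where a·c = dot a (col i)
          to : ∀ i → 0# ≡ x *ₚ z i +ₚ dot a (col i) → z i ≡ dot ((-ₚ r) • a) (col i)
          to i eq = sym (begin
            dot ((-ₚ r) • a) (col i)         ≡⟨ dot-•ˡ (-ₚ r) a (col i) ⟩
            -ₚ r *ₚ a·c                        ≡⟨ sym (-‿distribˡ-* r a·c) ⟩
            -ₚ (r *ₚ a·c)                      ≡⟨ -‿distribʳ-* r a·c ⟩
            r *ₚ -ₚ a·c                        ≡⟨ cong (r *ₚ_) (sym (trans (-ₚ-solve a·c (x *ₚ z i) 0# (trans (+ₚ-comm a·c _) (sym eq))) (+-idˡ (-ₚ a·c)))) ⟩
            r *ₚ (x *ₚ z i)                  ≡⟨ sym (*ₚ-assoc r x (z i)) ⟩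
            (r *ₚ x) *ₚ z i                  ≡⟨ trans (cong (_*ₚ z i) rx) (*-idˡ (z i)) ⟩
            z i                              ∎)
            where a·c = dot a (col i)

      step : Invariant B M d new
      step = record
        { vanish          = λ i M≤i → cong₂ _∷_ (z-out i M≤i) (vanish i M≤i)
        ; constant-weight = new-constant-weight
        ; initial         = new-initial
        ; normalised      = norm
        ; exceptional     = proj₂ units
        }
        where
        units = minimal⇒1 z-out B exceptional exc₁<M exc₂<M
          (λ y dom → minimal y (Dominates.beyond dom) (dominates⇒far z y far dom))
        norm : ∀ i → new i ≡ 0ᵛ ⊎ Normalised (new i)
        norm i = by (normalised i) (z i ≟ₚ 0#)
          where
          by : col i ≡ 0ᵛ ⊎ Normalised (col i) → Dec (z i ≡ 0#) → new i ≡ 0ᵛ ⊎ Normalised (new i)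
          by (inj₂ n)  _        = inj₂ (inj₁ n)
          by (inj₁ ci) (yes zi) = inj₁ (cong₂ _∷_ zi ci)
          by (inj₁ ci) (no zi)  = inj₂ (inj₂ (ci , proj₁ units i ci zi))

  -- Codes given by the columns of a generator matrix

  columnsOf : ∀ {k n} → (Fin n → V k) → Matrix k n
  columnsOf C t j = Vec.lookup (C j) t

  Spanned : ∀ {k n} → (Fin n → V k) → Code n
  Spanned C c = ∃[ a ] (∀ j → c j ≡ dot a (C j))

  ∑-dot : ∀ {k} (a : Word k) (u : V k) → ∑ (λ i → a i *ₚ Vec.lookup u i) ≡ dot (Vec.tabulate a) u
  ∑-dot a []      = refl
  ∑-dot a (y ∷ u) = cong (a zero *ₚ y +ₚ_) (∑-dot (a ∘ suc) u)

  ∑-dot-lookup : ∀ {k} (a u : V k) → ∑ (λ i → Vec.lookup a i *ₚ Vec.lookup u i) ≡ dot a u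
  ∑-dot-lookup a u = trans (∑-dot (Vec.lookup a) u) (cong (λ b → dot b u) (Vec.tabulate∘lookup a))

  tabulate-0ᵛ : ∀ {k} (a : Word k) → Vec.tabulate a ≡ 0ᵛ → ∀ i → a i ≡ 0#
  tabulate-0ᵛ a eq i = trans (sym (Vec.lookup∘tabulate a i)) (trans (cong (λ v → Vec.lookup v i) eq) (lookup-0ᵛ i))

  tabulate-≡ : ∀ {k} (u v : V k) → (∀ i → Vec.lookup u i ≡ Vec.lookup v i) → u ≡ v
  tabulate-≡ u v h = trans (sym (Vec.tabulate∘lookup u)) (trans (Vec.tabulate-cong h) (Vec.tabulate∘lookup v))

  infixl 6 _-ᵛ_
  _-ᵛ_ : ∀ {k} → V k → V k → V k
  a -ᵛ b = a +ᵛ (-ₚ 1#) • b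

  dot--ᵛ : ∀ {k} (a b u : V k) → dot (a -ᵛ b) u ≡ dot a u -ₚ dot b u
  dot--ᵛ a b u = trans (dot-+ˡ a _ u) (cong (dot a u +ₚ_) (trans (dot-•ˡ (-ₚ 1#) b u)
    (trans (sym (-‿distribˡ-* 1# (dot b u))) (cong -ₚ_ (*-idˡ (dot b u))))))

  module _ {k n δ} (C : Fin n → V (suc k)) (0<δ : 0 < δ)
           (constant-weight : ∀ a → a ≢ 0ᵛ → weight (allFin n) C a ≡ δ)
           (D : Code n) (D⇔ : ∀ c → D c ⇔ Spanned C c) where

    private
      spanned : ∀ {c} → D c → Spanned C c
      spanned = Equivalence.to (D⇔ _)
      unspanned : ∀ {c} → Spanned C c → D c
      unspanned = Equivalence.from (D⇔ _)

      nonzero-word : ∀ {a} → a ≢ 0ᵛ → ¬ (∀ j → dot a (C j) ≡ 0#)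
      nonzero-word {a} a≢0 h = <⇒≢ 0<δ (trans
        (sym (sum-zero (allFin n) (λ j _ → ⟦⟧-no (¬? (0# ≟ₚ dot a (C j))) (λ ne → ne (sym (h j))))))
        (constant-weight a a≢0))

    columnsOf-generates : IsGeneratorMatrix (columnsOf C) D
    columnsOf-generates = independent , λ c → mk⇔
      (λ Dc → let a , h = spanned Dc in Vec.lookup a , λ j → trans (h j) (sym (∑-dot-lookup a (C j))))
      (λ (a , h) → unspanned (Vec.tabulate a , λ j → trans (h j) (∑-dot a (C j))))
      where
      independent : LinearlyIndependent (columnsOf C)
      independent a h = tabulate-0ᵛ a (decidable-stable (Vec.tabulate a ≟ᵛ 0ᵛ)
        (λ a≢0 → nonzero-word a≢0 (λ j → trans (sym (∑-dot a (C j))) (h j))))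

    spanned-isCode : Is[ n , suc k , δ ]Code D
    spanned-isCode = record
      { linear = record
        { zero-closed = unspanned (0ᵛ , λ j → sym (dot-zeroˡ (C j)))
        ; +-closed = λ x y Dx Dy → let a , ha = spanned Dx ; b , hb = spanned Dy in
            unspanned (a +ᵛ b , λ j → trans (cong₂ _+ₚ_ (ha j) (hb j)) (sym (dot-+ˡ a b (C j))))
        ; *-closed = λ x y Dy → let b , hb = spanned Dy in
            unspanned (x • b , λ j → trans (cong (x *ₚ_) (hb j)) (sym (dot-•ˡ x b (C j)))) }
      ; dimension = columnsOf C , columnsOf-generates
      ; minimumDistance =
          ( word u , word 0ᵛ , unspanned (u , λ _ → refl) , unspanned (0ᵛ , λ _ → refl)
          , (λ eq → nonzero-word u≢0 (λ j → trans (eq j) (dot-zeroˡ (C j))))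
          , trans (distance-≢ u 0ᵛ (λ _ → refl) (λ _ → refl)) (constant-weight (u -ᵛ 0ᵛ) (u≢0 ∘ difference-0 u 0ᵛ)) )
        , λ x y Dx Dy x≢y → let a , ha = spanned Dx ; b , hb = spanned Dy in
            ≤-reflexive (sym (trans (distance-≢ a b ha hb) (constant-weight (a -ᵛ b)
              (λ eq → x≢y (λ j → trans (ha j) (trans (cong (λ c → dot c (C j)) (difference-0 a b eq)) (sym (hb j))))))))
      }
      where
      u : V (suc k)
      u = 1# ∷ 0ᵛ
      u≢0 : u ≢ 0ᵛ
      u≢0 = 1≢0 ∘ Vec.∷-injectiveˡ
      word : V (suc k) → Word n
      word a j = dot a (C j)
      difference-0 : ∀ (a b : V (suc k)) → a -ᵛ b ≡ 0ᵛ → a ≡ b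
      difference-0 a b eq = trans (+ᵛ-zero 1# a b eq) (1• b)
      distance-≢ : ∀ {x y} a b → (∀ j → x j ≡ dot a (C j)) → (∀ j → y j ≡ dot b (C j)) →
                   hamming x y ≡ weight (allFin n) C (a -ᵛ b)
      distance-≢ {x} {y} a b ha hb = trans (length-filter-sum _ (allFin n)) (sum-cong (allFin n) (λ j →
        ⟦⟧-cong (¬? (x j ≟ₚ y j)) (¬? (0# ≟ₚ dot (a -ᵛ b) (C j)))
          (λ ne eq → ne (trans (ha j) (trans (-ₚ≡0 (trans (sym (dot--ᵛ a b (C j))) (sym eq))) (sym (hb j)))))
          (λ ne eq → ne (sym (trans (dot--ᵛ a b (C j))
            (trans (cong (_-ₚ dot b (C j)) (trans (sym (ha j)) (trans eq (hb j)))) (-ₚ-inverseʳ (dot b (C j)))))))))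

  -- The simplex code and its repetition

  simplexLength≡ : ∀ k → simplexLength k ≡ length (points k)
  simplexLength≡ k = trans (cong (λ t → (t ∸ 1) / (p ∸ 1)) (trans (sym (length-points k)) (+-comm _ 1)))
    (m*n/n≡m (length (points k)) (p ∸ 1))
    where
    instance
      p∸1-nonZero : NonZero (p ∸ 1)
      p∸1-nonZero = >-nonZero (m<n⇒0<n∸m p>1)

  Normalised? : ∀ {k} (u : V k) → Dec (Normalised u)
  Normalised? []      = no λ ()
  Normalised? (x ∷ u) = Normalised? u ⊎-dec ((u ≟ᵛ 0ᵛ) ×-dec (x ≟ₚ 1#))

  module _ {k m r : ℕ} (enum : Enumeration (points (suc k)) m) (0<r : 0 < r)
           (C : Fin (m * r) → V (suc k)) (normalised : ∀ j → Normalised (C j))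
           (multiplicity : ∀ {v} → Normalised v → sumOver (allFin (m * r)) (λ j → ⟦ C j ≟ᵛ v ⟧) ≡ r)
           (constant-weight : ∀ a → a ≢ 0ᵛ → weight (allFin (m * r)) C a ≡ p ^ k * r)
           (D : Code (m * r)) (D⇔ : ∀ c → D c ⇔ Spanned C c) where

    open Enumeration enum

    private
      instance
        r-nonZero : NonZero r
        r-nonZero = >-nonZero 0<r

      0<p^k : 0 < p ^ k
      0<p^k = m^n>0 p k

      simplex : Code m
      simplex = Spanned entry

      normalised-entry : ∀ j → Normalised (entry j)
      normalised-entry j = ∈-points⁻ (entry∈ j)

      -- Each point occurs `r` times among the columns `C`, so every weight with respect to `C` is
      -- `r` times the weight in the simplex code, and `r` cancels.
      simplex-weight : ∀ a → a ≢ 0ᵛ → weight (allFin m) entry a ≡ p ^ k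
      simplex-weight a a≢0 = trans (sums f) (*-cancelˡ-≡ _ _ r (begin
        r * sumOver (points (suc k)) f    ≡⟨ sym (sum-*ˡ (points (suc k)) r) ⟩
        sumOver (points (suc k)) (λ v → r * f v)
          ≡⟨ sum-cong-∈ (points (suc k)) (λ v v∈ → trans (*-comm r (f v)) (trans (cong (f v *_) (sym (multiplicity (∈-points⁻ v∈))))
               (trans (sym (sum-*ˡ (allFin (m * r)) (f v))) (sum-cong (allFin (m * r)) (λ j → *-comm (f v) ⟦ C j ≟ᵛ v ⟧))))) ⟩
        sumOver (points (suc k)) (λ v → sumOver (allFin (m * r)) (λ j → ⟦ C j ≟ᵛ v ⟧ * f v))
          ≡⟨ sym (sum-comm (allFin (m * r)) (points (suc k))) ⟩
        sumOver (allFin (m * r)) (λ j → sumOver (points (suc k)) (λ v → ⟦ C j ≟ᵛ v ⟧ * f v))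
          ≡⟨ sum-cong (allFin (m * r)) (λ j → sum-δ _≟ᵛ_ (points-unique (suc k)) (∈-points⁺ (normalised j)) f) ⟩
        sumOver (allFin (m * r)) (f ∘ C)  ≡⟨ constant-weight a a≢0 ⟩
        p ^ k * r                         ≡⟨ *-comm (p ^ k) r ⟩
        r * p ^ k                         ∎))
        where
        open ≡-Reasoning
        f : V (suc k) → ℕ
        f v = ⟦ ¬? (0# ≟ₚ dot a v) ⟧

      generates : IsGeneratorMatrix (columnsOf entry) simplex
      generates = columnsOf-generates entry 0<p^k simplex-weight simplex (λ _ → mk⇔ id id)

      entry-injective : ∀ {i j} → entry i ≡ entry j → i ≡ j
      entry-injective {i} {j} eq with Fin.<-cmp i j
      ... | tri< i<j _ _ = contradiction eq (pairs (points-unique (suc k)) i<j)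
      ... | tri≈ _ i≡j _ = i≡j
      ... | tri> _ _ j<i = contradiction (sym eq) (pairs (points-unique (suc k)) j<i)

      represent : ColumnsRepresentLines (columnsOf entry)
      represent = (λ j h → Normalised≢0 (normalised-entry j) (tabulate-≡ (entry j) 0ᵛ (λ i → trans (h i) (sym (lookup-0ᵛ i))))) , line
        where
        line : ∀ v → NonZeroVector v → _
        line v v≢0 with x , x≢0 , nv ← normalise {u = Vec.tabulate v} (v≢0 ∘ tabulate-0ᵛ v)
                   with j , hj ← find (∈-points⁺ nv) =
          j , (x , λ i → trans (cong (λ w → Vec.lookup w i) hj) (entry-• x i)) , (λ {j′} → unique {j′})
          where
          entry-• : ∀ x i → Vec.lookup (x • Vec.tabulate v) i ≡ x *ₚ v i
          entry-• x i = trans (Vec.lookup-map i (x *ₚ_) (Vec.tabulate v)) (cong (x *ₚ_) (Vec.lookup∘tabulate v i))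
          unique : ∀ {j′} → Line v (λ i → columnsOf entry i j′) → j ≡ j′
          -- Both `entry j′` and `n` are normalised and lie on the line through `v`, so the factor
          -- between them is 1.
          unique {j′} (a , h) with r , rx ← inverse x≢0 = entry-injective (trans hj (sym (trans e≡ (trans (cong (_• n) ar≡1) (1• n)))))
            where
            n = x • Vec.tabulate v
            e≡ : entry j′ ≡ (a *ₚ r) • n
            e≡ = begin
              entry j′                            ≡⟨ tabulate-≡ (entry j′) (a • Vec.tabulate v) (λ i → trans (h i) (sym (entry-• a i))) ⟩
              a • Vec.tabulate v                  ≡⟨ cong (a •_) (sym (1• Vec.tabulate v)) ⟩
              a • (1# • Vec.tabulate v)           ≡⟨ cong (λ t → a • (t • Vec.tabulate v)) (sym rx) ⟩
              a • ((r *ₚ x) • Vec.tabulate v)     ≡⟨ cong (a •_) (sym (•-assoc r x (Vec.tabulate v))) ⟩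
              a • (r • n)                         ≡⟨ •-assoc a r n ⟩
              (a *ₚ r) • n                        ∎
              where open ≡-Reasoning
            ar≡1 : a *ₚ r ≡ 1#
            ar≡1 = Normalised-multiple (a *ₚ r) nv (subst Normalised e≡ (normalised-entry j′))

      equal-counts : ∀ v → sumOver (allFin (m * r)) (λ j → ⟦ C j ≟ᵛ v ⟧)
                         ≡ sumOver (allFin (m * r)) (λ j → ⟦ entry (quotient {m} r j) ≟ᵛ v ⟧)
      equal-counts v = trans (by (Normalised? v)) (sym (trans (sum-quotient m r (λ i → ⟦ entry i ≟ᵛ v ⟧)) (cong (r *_) (sums (λ u → ⟦ u ≟ᵛ v ⟧)))))
        where
        by : Dec (Normalised v) → sumOver (allFin (m * r)) (λ j → ⟦ C j ≟ᵛ v ⟧) ≡ r * sumOver (points (suc k)) (λ u → ⟦ u ≟ᵛ v ⟧)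
        by (yes nv) = trans (multiplicity nv) (sym (trans (cong (r *_)
          (trans (sum-cong (points (suc k)) (λ u → ⟦⟧-cong (u ≟ᵛ v) (v ≟ᵛ u) sym sym))
                 (sum-δ-1 _≟ᵛ_ (points-unique (suc k)) (∈-points⁺ nv)))) (*-identityʳ r)))
        by (no ¬nv) = trans
          (sum-zero (allFin (m * r)) (λ j _ → ⟦⟧-no (C j ≟ᵛ v) (λ { refl → ¬nv (normalised j) })))
          (sym (trans (cong (r *_) (sum-zero (points (suc k)) (λ u u∈ → ⟦⟧-no (u ≟ᵛ v) (λ { refl → ¬nv (∈-points⁻ u∈) })))) (*-zeroʳ r)))

      repetition : IsRepetition r simplex D
      repetition = suc k , columnsOf entry , generates , σ , λ c → mk⇔ (to c) (from c)
        where
        permuted = equal-counts⇒permutation _≟ᵛ_ C (entry ∘ quotient {m} r) equal-counts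
        σ = proj₁ permuted
        Cσ = proj₂ permuted
        G = repeatColumns r (columnsOf entry)
        to : ∀ c → D c → RowSpace G (λ j → c (σ ⟨$⟩ʳ j))
        to c Dc with a , h ← Equivalence.to (D⇔ c) Dc = Vec.lookup a , λ j →
          trans (h (σ ⟨$⟩ʳ j)) (trans (cong (dot a) (Cσ j)) (sym (∑-dot-lookup a (entry (quotient {m} r j)))))
        from : ∀ c → RowSpace G (λ j → c (σ ⟨$⟩ʳ j)) → D c
        from c (a , h) = Equivalence.from (D⇔ c) (Vec.tabulate a , λ j →
          subst (λ i → c i ≡ dot (Vec.tabulate a) (C i)) (Perm.inverseʳ σ)
            (trans (h (σ ⟨$⟩ˡ j)) (trans (∑-dot a (entry (quotient {m} r (σ ⟨$⟩ˡ j)))) (cong (dot (Vec.tabulate a)) (sym (Cσ (σ ⟨$⟩ˡ j)))))))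

    repeated-simplex : Is[ m * r , suc k , p ^ k * r ]Code D
      × (Σ[ S ∈ Code m ] Is[ m , suc k , p ^ k ]Code S × IsSimplex (suc k) S × IsRepetition r S D)
    repeated-simplex =
      spanned-isCode C (*-mono-≤ 0<p^k 0<r) constant-weight D D⇔ ,
      simplex , spanned-isCode entry 0<p^k simplex-weight simplex (λ _ → mk⇔ id id) ,
      (columnsOf entry , generates , represent) , repetition

  -- The words w⁻

  at-combine : ∀ f c i n → at (combine f c) i ≡ at (∑< (bound c + n) (λ t → at c t ⊙ f t)) i
  at-combine f c i n = combine-bound f c (bound c + n) (m≤m+n (bound c) n) i

  ⊙-zero : ∀ a x i → at x i ≡ 0# → at (a ⊙ x) i ≡ 0#
  ⊙-zero a x i eq = trans (cong (a *ₚ_) eq) (*-zeroʳₚ a)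

  ⊙-one : ∀ a x i → at x i ≡ 1# → at (a ⊙ x) i ≡ a
  ⊙-one a x i eq = trans (cong (a *ₚ_) eq) (*-idʳ a)

  -- The expansion is evaluated entry by entry: away from `η` only one basis vector contributes, at
  -- `η` both `f ξ` and `f η` do. Coordinates are thus unique, and the existentially quantified
  -- sequences in the order leave no choice.
  coordinates : ∀ B x c → Coordinates (basis B) x c → ∀ i → at c i ≡ coordinate B (at x) i
  coordinates E x c eq i = sym (trans (eq i) (trans (at-combine e c i (suc i))
    (trans (∑<-spike (bound c + suc i) i i (m≤n+m (suc i) (bound c)) (λ t t≢i → ⊙-zero (at c t) (e t) i (e-off t i (t≢i ∘ sym))))
           (⊙-one (at c i) (e i) i (e-diag i)))))
  coordinates (F ξ η ξ≢η) x c eq i = by (η ≟ i)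
    where
    f = basis (F ξ η ξ≢η)
    f-ξ : ∀ i → at (f ξ) i ≡ at (e ξ) i +ₚ at (e η) i
    f-ξ i with ξ ≟ ξ
    ... | yes _ = refl
    ... | no ne = contradiction refl ne
    f-off : ∀ t → t ≢ ξ → f t ≡ e t
    f-off t t≢ξ with t ≟ ξ
    ... | yes t≡ξ = contradiction t≡ξ t≢ξ
    ... | no _    = refl
    f-zero : ∀ t i → t ≢ i → (t ≡ ξ → η ≢ i) → at (f t) i ≡ 0#
    f-zero t i t≢i h with t ≟ ξ
    ... | yes refl = trans (cong₂ _+ₚ_ (e-off ξ i (t≢i ∘ sym)) (e-off η i (h refl ∘ sym))) (+-idˡ 0#)
    ... | no _     = e-off t i (t≢i ∘ sym)
    f-diag : ∀ i → η ≢ i → at (f i) i ≡ 1#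
    f-diag i η≢i with i ≟ ξ
    ... | yes refl = trans (cong₂ _+ₚ_ (e-diag ξ) (e-off η ξ (η≢i ∘ sym))) (+-idʳ 1#)
    ... | no _     = e-diag i
    x-off : ∀ i → η ≢ i → at x i ≡ at c i
    x-off i η≢i = trans (eq i) (trans (at-combine f c i (suc i))
      (trans (∑<-spike (bound c + suc i) i i (m≤n+m (suc i) (bound c))
               (λ t t≢i → ⊙-zero (at c t) (f t) i (f-zero t i t≢i (λ _ → η≢i))))
             (⊙-one (at c i) (f i) i (f-diag i η≢i))))
    others : ∀ t → t ≢ ξ → t ≢ η → at (at c t ⊙ f t) η ≡ 0#
    others t t≢ξ t≢η = ⊙-zero (at c t) (f t) η (f-zero t η t≢η (λ t≡ξ → contradiction t≡ξ t≢ξ))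
    term-ξ : at (at c ξ ⊙ f ξ) η ≡ at c ξ
    term-ξ = ⊙-one (at c ξ) (f ξ) η (trans (f-ξ η) (trans (cong₂ _+ₚ_ (e-off ξ η (ξ≢η ∘ sym)) (e-diag η)) (+-idˡ 1#)))
    term-η : at (at c η ⊙ f η) η ≡ at c η
    term-η = ⊙-one (at c η) (f η) η (trans (cong (λ g → at g η) (f-off η (ξ≢η ∘ sym))) (e-diag η))
    -- Long enough that the terms at `ξ` and at `η` both occur in the sum, even if `bound c` is
    -- smaller.
    N = bound c + suc (ξ + η)
    ξ<N : ξ < N
    ξ<N = ≤-trans (s≤s (m≤m+n ξ η)) (m≤n+m _ (bound c))
    η<N : η < N
    η<N = ≤-trans (s≤s (m≤n+m η ξ)) (m≤n+m _ (bound c))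
    x-η : at x η ≡ at c ξ +ₚ at c η
    x-η = trans (eq η) (trans (at-combine f c η (suc (ξ + η))) (split (<-cmp ξ η)))
      where
      split : _ → at (∑< N (λ t → at c t ⊙ f t)) η ≡ at c ξ +ₚ at c η
      split (tri< ξ<η _ _) = trans (∑<-spikes N η ξ η ξ<η η<N others) (cong₂ _+ₚ_ term-ξ term-η)
      split (tri≈ _ ξ≡η _) = contradiction ξ≡η ξ≢η
      split (tri> _ _ η<ξ) = trans (∑<-spikes N η η ξ η<ξ ξ<N (λ t t≢η t≢ξ → others t t≢ξ t≢η))
        (trans (cong₂ _+ₚ_ term-η term-ξ) (+ₚ-comm (at c η) (at c ξ)))
    by : Dec (η ≡ i) → at c i ≡ coordinate (F ξ η ξ≢η) (at x) i
    by (yes refl) = trans (-ₚ-solve (at c ξ) (at c η) (at x η) (sym x-η))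
      (sym (trans (coordinate-η {ξ≢η = ξ≢η} (at x)) (cong (λ t → at x η -ₚ t) (x-off ξ (ξ≢η ∘ sym)))))
    by (no η≢i) = trans (sym (x-off i η≢i)) (sym (coordinate-off (F ξ η ξ≢η) (at x) η≢i))

  -- Asymmetry of the order: each strict comparison has its highest differing position. The higher
  -- of the two contradicts the agreement claimed by the other comparison; if they coincide, the
  -- inequalities clash.
  Lower⇒not-least : ∀ B {y z : FinSeq} → Lower B (at y) (at z) → ¬ (z ≈ y ⊎ z <[ basis B ] y)
  Lower⇒not-least B {y} {z} (N , lt , _) (inj₁ z≈y) = <⇒≢ lt (cong toℕ
    (coordinate-agree B (at y) (at z) N (sym (z≈y (exc₁ B))) (sym (z≈y (exc₂ B))) (sym (z≈y N))))
  Lower⇒not-least B {y} {z} (N , lt , above) (inj₂ (c , c′ , zc , yc′ , N′ , lt′ , above′)) with <-cmp N N′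
  ... | tri< N<N′ _ _ = <⇒≢ lt′ (cong toℕ (trans (coordinates B z c zc N′) (trans (sym (above N′ N<N′)) (sym (coordinates B y c′ yc′ N′)))))
  ... | tri≈ _ refl _ = <-asym lt (subst₂ Fin._<_ (coordinates B z c zc N) (coordinates B y c′ yc′ N) lt′)
  ... | tri> _ _ N′<N = <⇒≢ lt (cong toℕ (trans (sym (coordinates B y c′ yc′ N)) (trans (sym (above′ N N′<N)) (coordinates B z c zc N))))

  dist-upTo : ∀ x y M → (∀ i → M ≤ i → at x i ≡ at y i) →
              dist x y ≡ sumOver (upTo M) (λ i → ⟦ ¬? (at x i ≟ₚ at y i) ⟧)
  dist-upTo x y M agree = trans (dist-count x y n (m≤n⊔m M _))
    (trans (count-extend x y (m≤m⊔n M (bound x ⊔ bound y)) agree) (length-filter-sum _ (upTo M)))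
    where n = M ⊔ (bound x ⊔ bound y)

  isPower? : ∀ a → Dec (IsPower a)
  isPower? a with anyUpTo? (λ m → a ≟ p ^ m) (suc a)
  ... | yes (m , _ , eq) = yes (m , eq)
  ... | no none          = no λ { (m , refl) → none (m , m≤n⇒m≤1+n (n<p^n m) , refl) }

  -- Words as linear combinations of the generators

  digitsBelow : ∀ j → ℕ → V j
  digitsBelow zero    b = []
  digitsBelow (suc j) b = digit b j ∷ digitsBelow j b

  entries : ∀ {j} → V j → ℕ → 𝔽
  entries []              = λ _ → 0#
  entries (_∷_ {j} x a) = override j x (entries a)

  prescribe-digits : ∀ j (c : ℕ → 𝔽) → ∃[ b ] b < p ^ j × (∀ i → i < j → digit b i ≡ c i)
  prescribe-digits zero    c = 0 , z<s , λ _ ()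
  prescribe-digits (suc j) c with b′ , b′< , eq ← prescribe-digits j (c ∘ suc) = b , b< , digits-eq
    where
    c₀ = toℕ (c 0)
    b = c₀ + b′ * p
    b< : b < p ^ suc j
    b< = <-≤-trans (+-monoˡ-< (b′ * p) (Fin.toℕ<n (c 0))) (≤-trans (*-monoˡ-≤ p b′<) (≤-reflexive (*-comm (p ^ j) p)))
    b/p : b / p ≡ b′
    b/p = trans (+-distrib-/-∣ʳ c₀ (divides-refl b′)) (cong₂ _+_ (m<n⇒m/n≡0 (Fin.toℕ<n (c 0))) (m*n/n≡m b′ p))
    digits-eq : ∀ i → i < suc j → digit b i ≡ c i
    digits-eq zero    _         = trans (digit-zero b) (trans (mod-cong ([m+kn]%n≡m%n c₀ b′ p)) (mod-toℕ (c 0)))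
    digits-eq (suc i) (s≤s i<j) = trans (digit-suc b i) (trans (cong (λ t → digit t i) b/p) (eq i i<j))

  digitsBelow-entries : ∀ {j} (a : V j) b → (∀ i → i < j → digit b i ≡ entries a i) → digitsBelow j b ≡ a
  digitsBelow-entries []                b eq = refl
  digitsBelow-entries (_∷_ {j} x a) b eq = cong₂ _∷_ (trans (eq j ≤-refl) (override-at j x (entries a)))
    (digitsBelow-entries a b (λ i i<j → trans (eq i (m≤n⇒m≤1+n i<j)) (override-off j x (entries a) (<⇒≢ i<j ∘ sym))))

  digitsBelow-surjective : ∀ {j} (a : V j) → ∃[ b ] b < p ^ j × digitsBelow j b ≡ a
  digitsBelow-surjective {j} a with b , b< , eq ← prescribe-digits j (entries a) = b , b< , digitsBelow-entries a b eq

  module _ (B : 𝓕) (d : ℕ) where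

    private
      w   = w⁻ B d
      lex = w⁻-isLexWords B d

    gen : ℕ → FinSeq
    gen t = w (p ^ t)

    -- The recursion gives this only when `b` is not a power of `p`. For a power the expansion has
    -- the single digit 1, so the sum collapses to that generator.
    word-combine : ∀ b → w b ≈ combine gen (digits b)
    word-combine b = by (isPower? b)
      where
      open Construction (basis B) (basis-spans B) d using (digit-power; digit-power-off)
      by : Dec (IsPower b) → w b ≈ combine gen (digits b)
      by (no ne) = IsLexWords.nonpower lex b ne
      by (yes (m , refl)) i = sym (trans
        (∑<-spike (p ^ m) i m (n<p^n m) λ t t≢m →
          trans (cong (_*ₚ at (gen t) i) (digit-power-off m t t≢m)) (*-zeroˡₚ (at (gen t) i)))
        (trans (cong (_*ₚ at (gen m) i) (digit-power m)) (*-idˡ (at (gen m) i))))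

    column : ∀ j → ℕ → V j
    column zero    i = []
    column (suc j) i = at (gen j) i ∷ column j i

    word-dot : ∀ j {b} → b < p ^ j → ∀ i → at (w b) i ≡ dot (digitsBelow j b) (column j i)
    word-dot j {b} b<p^j i = begin
      at (w b) i                           ≡⟨ word-combine b i ⟩
      at (combine gen (digits b)) i        ≡⟨ combine-bound gen (digits b) (b ⊔ j) (m≤m⊔n b j) i ⟩
      at (∑< (b ⊔ j) terms) i              ≡⟨ ∑<-extend i (m≤n⊔m b j) (λ t j≤t → trans
                                                (cong (_*ₚ at (gen t) i) (digit-small b t (<-≤-trans b<p^j (^-monoʳ-≤ p j≤t))))
                                                (*-zeroˡₚ (at (gen t) i))) ⟩
      at (∑< j terms) i                    ≡⟨ dots j ⟩
      dot (digitsBelow j b) (column j i)   ∎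
      where
      open ≡-Reasoning
      terms : ℕ → FinSeq
      terms t = digit b t ⊙ gen t
      dots : ∀ j → at (∑< j terms) i ≡ dot (digitsBelow j b) (column j i)
      dots zero    = refl
      dots (suc j) = trans (cong (_+ₚ at (terms j) i) (dots j)) (+ₚ-comm (dot (digitsBelow j b) (column j i)) (at (terms j) i))

  -- The invariant for all generators, and the residual code

  module _ (k d′ : ℕ) (2≤d′ : 2 ≤ d′) (B : 𝓕) where

    private
      d = p ^ k * d′
      w = w⁻ B d
      col = column B d

    -- A common window that contains both exceptional positions and the supports of all generators
    -- concerned, so that every distance is a sum over it.
    length-bound : ℕ
    length-bound = suc (exc₁ B + exc₂ B) + maxBound (gen B d) (suc k)

    private
      M = length-bound

      gen-out : ∀ {t} → t ≤ k → ∀ i → M ≤ i → at (gen B d t) i ≡ 0#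
      gen-out {t} t≤k i M≤i = vanishes (gen B d t) i (≤-trans (bound≤maxBound (gen B d) (s≤s t≤k)) (≤-trans (m≤n+m _ (suc (exc₁ B + exc₂ B))) M≤i))

      exc₁<M : exc₁ B < M
      exc₁<M = ≤-trans (s≤s (m≤m+n (exc₁ B) (exc₂ B))) (m≤m+n _ _)

      exc₂<M : exc₂ B < M
      exc₂<M = ≤-trans (s≤s (m≤n+m (exc₂ B) (exc₁ B))) (m≤m+n _ _)

      dist-column : ∀ {j b} z → (∀ i → M ≤ i → col j i ≡ 0ᵛ) → (∀ i → M ≤ i → at z i ≡ 0#) → b < p ^ j →
                    dist z (w b) ≡ Distances.distance M (col j) (at z) (digitsBelow j b)
      dist-column {j} {b} z col-out z-out b< = trans
        (dist-upTo z (w b) M λ i M≤i → trans (z-out i M≤i) (sym (trans (word-dot B d j b< i)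
          (trans (cong (dot (digitsBelow j b)) (col-out i M≤i)) (dot-zeroʳ (digitsBelow j b))))))
        (sum-cong (upTo M) (λ i → cong (λ t → ⟦ ¬? (at z i ≟ₚ t) ⟧) (word-dot B d j b< i)))

    -- The `j` generators found leave `d₁ = p ^ (k - j) * d′`. This is smallest for the last
    -- generator, `j = k`, where it is `d′`; the hypothesis `2 ≤ d′` is thus what keeps `2 ≤ d₁`
    -- throughout.
    invariant : ∀ j → j ≤ suc k → Invariant B length-bound d (col j)
    invariant zero    _ = record
      { vanish          = λ _ _ → refl
      ; constant-weight = λ { [] a≢0 → contradiction refl a≢0 }
      ; initial         = λ _ _ _ _ _ i≢0 → contradiction refl i≢0
      ; normalised      = λ _ → inj₁ refl
      ; exceptional     = trivial B
      }
      where
      trivial : ∀ B → Exceptional B {0} (λ _ → [])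
      trivial E         = tt
      trivial (F _ _ _) = (λ _ → refl) , (λ _ _ → refl)
    invariant (suc j) (s≤s j≤k) = subst (λ δ → Invariant B M δ (col (suc j))) d₁≡
      (step B M (col j) d₁ 2≤d₁ (subst (λ δ → Invariant B M δ (col j)) (sym d₁≡) inv) exc₁<M exc₂<M
        {z = at z} (gen-out j≤k) far minimal)
      where
      inv = invariant j (m≤n⇒m≤1+n j≤k)
      d₁ = p ^ (k ∸ j) * d′
      d₁≡ : p ^ j * d₁ ≡ d
      d₁≡ = trans (sym (*-assoc (p ^ j) _ d′)) (cong (_* d′) (trans (sym (^-distribˡ-+-* p j (k ∸ j))) (cong (p ^_) (m+[n∸m]≡n j≤k))))
      2≤d₁ : 2 ≤ d₁
      2≤d₁ = ≤-trans 2≤d′ (m≤n*m d′ (p ^ (k ∸ j)) {{m^n≢0 p (k ∸ j)}})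
      z = gen B d j
      isMinimum = IsLexWords.power (w⁻-isLexWords B d) (p ^ j) (j , refl)
      -- Every coefficient vector is the digit vector of some `b < p ^ j`, so the distance condition
      -- on the earlier words is one on their whole span.
      far : ∀ a → p ^ j * d₁ ≤ Distances.distance M (col j) (at z) a
      far a with b , b< , refl ← digitsBelow-surjective a = ≤-trans (≤-reflexive d₁≡)
        (≤-trans (IsMinimum.member isMinimum b<) (≤-reflexive (dist-column z (Invariant.vanish inv) (gen-out j≤k) b<)))
      minimal : ∀ y → (∀ i → M ≤ i → y i ≡ 0#) →
        (∀ a → p ^ j * d₁ ≤ Distances.distance M (col j) y a) → ¬ Lower B y (at z)
      minimal y y-out y-far lower = Lower⇒not-least B {y′} {z} lower (IsMinimum.least isMinimum y′ λ {b} b< →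
        ≤-trans (≤-reflexive (sym d₁≡)) (≤-trans (y-far (digitsBelow j b))
          (≤-reflexive (sym (dist-column y′ (Invariant.vanish inv) y-out b<)))))
        where
        y′ : FinSeq
        y′ = finSeq y M y-out

    open Invariant (invariant (suc k) ≤-refl)

    private
      survives? : ∀ i → Dec (col (suc k) i ≢ 0ᵛ)
      survives? i = ¬? (col (suc k) i ≟ᵛ 0ᵛ)

    support : List ℕ
    support = filter survives? (upTo length-bound)

    private
      K = suc k
      0<d′ : 0 < d′
      0<d′ = ≤-trans (s≤s z≤n) 2≤d′

      multiplicity : ∀ {v} → Normalised v → sumOver (upTo M) (λ i → ⟦ col K i ≟ᵛ v ⟧) ≡ d′
      multiplicity nv = *-cancelˡ-≡ _ _ (p ^ k) {{m^n≢0 p k}}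
        (Bonisoli.multiplicity (upTo M) (col K) d normalised constant-weight nv)

      sum-support : ∀ (f : V K → ℕ) → (f 0ᵛ ≡ 0) → sumOver support (f ∘ col K) ≡ sumOver (upTo M) (f ∘ col K)
      sum-support f f0 = trans (sum-filter survives? (upTo M) (f ∘ col K)) (sum-cong (upTo M) (λ i → by (col K i) (col K i ≟ᵛ 0ᵛ)))
        where
        by : ∀ u (q : Dec (u ≡ 0ᵛ)) → ⟦ ¬? q ⟧ * f u ≡ f u
        by u (yes refl) = sym f0
        by u (no _)     = *-identityˡ (f u)

      length-support : length support ≡ simplexLength K * d′
      length-support = begin
        length support                             ≡⟨ length-filter-sum survives? (upTo M) ⟩
        sumOver (upTo M) (λ i → ⟦ ¬? (col K i ≟ᵛ 0ᵛ) ⟧)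
          ≡⟨ sum-cong (upTo M) (λ i → by (col K i) (normalised i)) ⟩
        sumOver (upTo M) (λ i → sumOver (points K) (λ v → ⟦ col K i ≟ᵛ v ⟧))
          ≡⟨ sum-comm (upTo M) (points K) ⟩
        sumOver (points K) (λ v → sumOver (upTo M) (λ i → ⟦ col K i ≟ᵛ v ⟧))
          ≡⟨ sum-cong-∈ (points K) (λ v v∈ → multiplicity (∈-points⁻ v∈)) ⟩
        sumOver (points K) (λ _ → d′)              ≡⟨ sum-const (points K) d′ ⟩
        length (points K) * d′                     ≡⟨ cong (_* d′) (sym (simplexLength≡ K)) ⟩
        simplexLength K * d′                       ∎
        where
        open ≡-Reasoning
        by : ∀ u → u ≡ 0ᵛ ⊎ Normalised u → ⟦ ¬? (u ≟ᵛ 0ᵛ) ⟧ ≡ sumOver (points K) (λ v → ⟦ u ≟ᵛ v ⟧)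
        by u (inj₁ refl) = trans (⟦⟧-no (¬? (u ≟ᵛ 0ᵛ)) (λ ne → ne refl))
          (sym (sum-zero (points K) (λ v v∈ → ⟦⟧-no (u ≟ᵛ v) (Normalised≢0 (∈-points⁻ v∈) ∘ sym))))
        by u (inj₂ nu)   = trans (⟦⟧-yes (¬? (u ≟ᵛ 0ᵛ)) (Normalised≢0 nu)) (sym (sum-δ-1 _≟ᵛ_ (points-unique K) (∈-points⁺ nu)))

      module S = Enumeration (enumerate support length-support)

      C : Fin (simplexLength K * d′) → V K
      C j = col K (S.entry j)

      C≢0 : ∀ j → C j ≢ 0ᵛ
      C≢0 j = proj₂ (∈-filter⁻ survives? {xs = upTo M} (S.entry∈ j))

      C-normalised : ∀ j → Normalised (C j)
      C-normalised j = by (normalised (S.entry j))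
        where
        by : C j ≡ 0ᵛ ⊎ Normalised (C j) → Normalised (C j)
        by (inj₁ eq) = contradiction eq (C≢0 j)
        by (inj₂ n)  = n

      L = Lex⁻ B d K

      lex-word : ∀ a → ∃[ b ] L (w b) × (∀ i → at (w b) i ≡ dot a (col K i))
      lex-word a with b , b< , refl ← digitsBelow-surjective a = b , (b , b< , λ _ → refl) , word-dot B d K b<

      lex-dot : ∀ x → L x → ∃[ a ] (∀ i → at x i ≡ dot a (col K i))
      lex-dot x (b , b< , x≈) = digitsBelow K b , λ i → trans (x≈ i) (word-dot B d K b< i)

      -- The words realise every coefficient vector, and only the zero column is orthogonal to all
      -- of them.
      vanishing : ∀ i → (∀ x → L x → at x i ≡ 0#) → col K i ≡ 0ᵛ
      vanishing i h = orthogonal (col K i) λ a → let b , Lb , eq = lex-word a in trans (sym (eq i)) (h (w b) Lb)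
        where
        orthogonal : ∀ {j} (u : V j) → (∀ a → dot a u ≡ 0#) → u ≡ 0ᵛ
        orthogonal []      h = refl
        orthogonal (y ∷ u) h = cong₂ _∷_
          (trans (sym (trans (cong₂ _+ₚ_ (*-idˡ y) (dot-zeroˡ u)) (+-idʳ y))) (h (1# ∷ 0ᵛ)))
          (orthogonal u (λ a → trans (sym (trans (cong (_+ₚ dot a u) (*-zeroˡₚ y)) (+-idˡ (dot a u)))) (h (0# ∷ a))))

    survivors : Survivors (Lex⁻ B d (suc k)) (simplexLength (suc k) * d′)
    survivors = record
      { position   = S.entry
      ; increasing = S.pairs (AllPairs.filter⁺ survives? (upTo-sorted M))
      ; survives   = λ i → mk⇔
          (λ { (j , refl) h → C≢0 j (vanishing (S.entry j) h) })
          (λ alive → S.find (live i (λ ci → alive (λ x Lx → let a , eq = lex-dot x Lx in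
            trans (eq i) (trans (cong (dot a) ci) (dot-zeroʳ a))))))
      }
      where
      live : ∀ i → col K i ≢ 0ᵛ → i ∈ support
      live i ci = ∈-filter⁺ survives? (∈-upTo⁺ (≰⇒> (ci ∘ vanish i))) ci

    private
      Res⇔ : ∀ c → Res L survivors c ⇔ Spanned C c
      Res⇔ c = mk⇔
        (λ (x , Lx , eq) → let a , xa = lex-dot x Lx in a , λ j → trans (eq j) (xa (S.entry j)))
        (λ (a , eq) → let b , Lb , wb = lex-word a in w b , Lb , λ j → trans (eq j) (sym (wb (S.entry j))))

    residual-is-repeated-simplex :
      let m = simplexLength (suc k)
          R = Res (Lex⁻ B d (suc k)) survivors
      in Is[ m * d′ , suc k , d ]Code R
         × (Σ[ S ∈ Code m ] Is[ m , suc k , p ^ k ]Code S × IsSimplex (suc k) S × IsRepetition d′ S R)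
    residual-is-repeated-simplex = repeated-simplex {k} {simplexLength K} {d′}
      (enumerate (points K) (sym (simplexLength≡ K))) 0<d′ C C-normalised
      (λ {v} nv → trans (S.sums (λ i → ⟦ col K i ≟ᵛ v ⟧))
        (trans (sum-support (λ u → ⟦ u ≟ᵛ v ⟧) (⟦⟧-no (0ᵛ ≟ᵛ v) (Normalised≢0 nv ∘ sym))) (multiplicity nv)))
      (λ a a≢0 → trans (S.sums (λ i → ⟦ ¬? (0# ≟ₚ dot a (col K i)) ⟧))
        (trans (sum-support (λ u → ⟦ ¬? (0# ≟ₚ dot a u) ⟧) (⟦⟧-no (¬? (0# ≟ₚ dot a 0ᵛ)) (λ ne → ne (sym (dot-zeroʳ a)))))
               (constant-weight a a≢0)))
      (Res L survivors) Res⇔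

theorem1p10 : (p : ℕ) (p-prime : Prime p) → let open Codes p p-prime in
  (k d′ : ℕ) → 1 ≤ k → 2 ≤ d′ → (B : 𝓕) →
  let d = p ^ (k ∸ 1) * d′
      m = simplexLength k
      L = Lex⁻ B d k
  in Σ[ s ∈ Survivors L (m * d′) ]
       Is[ m * d′ , k , d ]Code (Res L s)
       × (Σ[ S ∈ Code m ]
            Is[ m , k , p ^ (k ∸ 1) ]Code S
            × IsSimplex k S
            × IsRepetition d′ S (Res L s))
theorem1p10 p p-prime (suc k) d′ _ 2≤d′ B = survivors k d′ 2≤d′ B , residual-is-repeated-simplex k d′ 2≤d′ B
  where open Lexicodes p p-prime
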